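{- Let $0<\epsilon<1/2^k$. An $\epsilon$-almost $k$-wise independent set in $\{0,1\}^n$ in the $L_\infty$-norm of size $$O\left(\frac{k\log n}{2^k\epsilon^2}\right)$$ can be constructed in time $\tilde O(n^k/\epsilon^4)$.
   Context: Let $n\ge2$ and $1\le k\le n$ be integers. A finite (multi)set $S'\subseteq\{0,1\}^n$ is $\epsilon$-almost $k$-wise independent in the $L_\infty$-norm if for all $1\le i_1<\cdots<i_k\le n$ and all $(\sigma_1,\ldots,\sigma_k)\in\{0,1\}^k$, $\left|\Pr_{s\sim U_{S'}}[s_{i_1}=\sigma_1\wedge\cdots\wedge s_{i_k}=\sigma_k]-2^{ -k}\right|\le\epsilon$, where $U_{S'}$ is the uniform distribution on $S'$ and size is counted with multiplicity. The constants in $O(\cdot)$ are absolute. In the time bound, $\tilde O(A)$ means $O(A\cdot\mathrm{poly}(\log T))$, where $T$ is the time complexity of the construction; time is counted in bit operations. -}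

module Defs where

open import Data.Bool using (Bool; true; false; if_then_else_)
import Data.Bool.Properties as Bool
open import Data.Fin using (Fin)
import Data.Fin as Fin
import Data.Fin.Properties as Fin
open import Data.Integer using (+_)
open import Data.List using (List; []; concatMap; filter)
import Data.List as List
open import Data.List.NonEmpty using (List⁺; toList) renaming (length to length⁺)
open import Data.Nat using (ℕ; zero; suc; _+_; _*_; _∸_; _^_; _≤_; _≡ᵇ_)
import Data.Nat as ℕ
open import Data.Nat.Logarithm using (⌊log₂_⌋)
open import Data.Nat.Properties using (m^n≢0)
open import Data.Product using (∃-syntax; _×_)
open import Data.Rational using (ℚ; ∣_∣) renaming (_/_ to _/ℚ_; _-_ to _-ℚ_; _≤_ to _≤ℚ_; _<_ to _<ℚ_)
open import Data.Vec using (Vec; lookup)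
import Data.Vec as Vec
open import Relation.Binary.PropositionalEquality using (_≡_; _≢_)
open import Relation.Unary using (Pred; Decidable)
open import Level using (0ℓ)

-- The stream b₀ b₁ b₂ … stands for the real number Σᵢ bᵢ 2^-(i+1); every real
-- in [0,1] is of this form.  Programs read real parameters through the digits.
Real01 : Set
Real01 = ℕ → Bool

bit : Bool → ℕ
bit b = if b then 1 else 0

-- prefix ε m / 2^m  ≤  ε  ≤  (prefix ε m + 1) / 2^m
prefix : Real01 → ℕ → ℕ
prefix ε zero    = 0
prefix ε (suc m) = 2 * prefix ε m + bit (ε m)

infix 8 _/2^_
_/2^_ : ℕ → ℕ → ℚ
a /2^ m = (+ a /ℚ 2 ^ m) {{m^n≢0 2 m}}

infix 4 _≤ᴿ_ _<ᴿ_ _ᴿ<_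

_≤ᴿ_ : ℚ → Real01 → Set
q ≤ᴿ ε = ∀ m → q ≤ℚ suc (prefix ε m) /2^ m

_<ᴿ_ : ℚ → Real01 → Set
q <ᴿ ε = ∃[ m ] q <ℚ prefix ε m /2^ m

_ᴿ<_ : Real01 → ℚ → Set
ε ᴿ< q = ∃[ m ] suc (prefix ε m) /2^ m <ℚ q

-- a ≤ b / ε ^ j for ε > 0: the inequality a · ε ^ j ≤ b, denominators cleared,
-- at every lower approximation of ε; these increase to ε.
infix 4 _≤_/_↑_
_≤_/_↑_ : ℕ → ℕ → Real01 → ℕ → Set
a ≤ b / ε ↑ j = ∀ m → a * prefix ε m ^ j ≤ b * (2 ^ m) ^ j

-- Probability under the uniform distribution on a nonempty multiset.
Pr[_∣_] : ∀ {A : Set} {P : Pred A 0ℓ} → Decidable P → List⁺ A → ℚ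
Pr[ P? ∣ S ] = + List.length (filter P? (toList S)) /ℚ length⁺ S

Matches : ∀ {n k} → (Fin k → Fin n) → (Fin k → Bool) → Vec Bool n → Set
Matches i σ s = ∀ j → lookup s (i j) ≡ σ j

matches? : ∀ {n k} (i : Fin k → Fin n) (σ : Fin k → Bool) → Decidable (Matches i σ)
matches? i σ s = Fin.all? (λ j → lookup s (i j) Bool.≟ σ j)

AlmostIndependent : ∀ {n} → ℕ → Real01 → List⁺ (Vec Bool n) → Set
AlmostIndependent {n} k ε S =
  (i : Fin k → Fin n) → (∀ a b → a Fin.< b → i a Fin.< i b) →
  (σ : Fin k → Bool) →
  ∣ Pr[ matches? i σ ∣ S ] -ℚ 1 /2^ k ∣ ≤ᴿ ε

-- A random-access machine: programs work on numbered registers and an unbounded memory, both holding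
-- natural numbers, and have read access to the digits of ε and a write-only
-- output tape of bits.

Reg : Set
Reg = ℕ

data Op : Set where
  add sub mul quo : Op

⟦_⟧ : Op → ℕ → ℕ → ℕ
⟦ add ⟧ x y       = x + y
⟦ sub ⟧ x y       = x ∸ y
⟦ mul ⟧ x y       = x * y
⟦ quo ⟧ x zero    = 0
⟦ quo ⟧ x (suc y) = x ℕ./ suc y

data Instr : Set where
  const : Reg → ℕ → Instr              -- R[d] := c
  arith : Op → Reg → Reg → Reg → Instr -- R[d] := R[a] op R[b]
  load  : Reg → Reg → Instr            -- R[d] := M[R[a]]
  store : Reg → Reg → Instr            -- M[R[a]] := R[b]
  digit : Reg → Reg → Instr            -- R[d] := binary digit of ε at index R[a]
  emit  : Reg → Instr                  -- append to the output: 0 if R[a] = 0, else 1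

infixr 5 _⨾_

data Program : Set where
  instr                : Instr → Program
  _⨾_                  : Program → Program → Program
  ifNonZero_then_else_ : Reg → Program → Program → Program
  whileNonZero_loop_   : Reg → Program → Program

record State : Set where
  constructor state
  field
    reg mem : ℕ → ℕ
    output  : List Bool
open State

_[_↦_] : (ℕ → ℕ) → ℕ → ℕ → ℕ → ℕ
(f [ a ↦ v ]) x = if x ≡ᵇ a then v else f x

exec : Real01 → Instr → State → State
exec ε (const d c)      (state r m o) = state (r [ d ↦ c ]) m o
exec ε (arith op d a b) (state r m o) = state (r [ d ↦ ⟦ op ⟧ (r a) (r b) ]) m o
exec ε (load d a)       (state r m o) = state (r [ d ↦ m (r a) ]) m o
exec ε (store a b)      (state r m o) = state r (m [ r a ↦ r b ]) o
exec ε (digit d a)      (state r m o) = state (r [ d ↦ bit (ε (r a)) ]) m o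
exec ε (emit a)         (state r m o) = state r m (o List.∷ʳ (if r a ≡ᵇ 0 then false else true))

-- Length of the binary representation.
size : ℕ → ℕ
size x = suc ⌊log₂ x ⌋

-- Bit operations up to a constant factor: linear for addition and subtraction,
-- schoolbook for multiplication and division.  Memory accesses are charged for
-- the address and for the value.  Register names are fixed by the program, so
-- they contribute only a constant factor and are not charged.
opCost : Op → ℕ → ℕ → ℕ
opCost add x y = size x + size y
opCost sub x y = size x + size y
opCost mul x y = size x * size y
opCost quo x y = size x * size y

cost : Instr → State → ℕ
cost (const d c)      s = size c
cost (arith op d a b) s = opCost op (reg s a) (reg s b)
cost (load d a)       s = size (reg s a) + size (mem s (reg s a))
cost (store a b)      s = size (reg s a) + size (reg s b)
cost (digit d a)      s = size (reg s a)
cost (emit a)         s = size (reg s a)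

-- Runs ε p s s′ t : from s, p halts in state s′ after t bit operations.
data Runs (ε : Real01) : Program → State → State → ℕ → Set where
  run-instr : ∀ {c s} → Runs ε (instr c) s (exec ε c s) (cost c s)
  run-seq   : ∀ {p q s s′ s″ t u} →
              Runs ε p s s′ t → Runs ε q s′ s″ u → Runs ε (p ⨾ q) s s″ (t + u)
  run-then  : ∀ {a p q s s′ t} → reg s a ≢ 0 →
              Runs ε p s s′ t →
              Runs ε (ifNonZero a then p else q) s s′ (size (reg s a) + t)
  run-else  : ∀ {a p q s s′ t} → reg s a ≡ 0 →
              Runs ε q s s′ t →
              Runs ε (ifNonZero a then p else q) s s′ (size (reg s a) + t)
  run-exit  : ∀ {a p s} → reg s a ≡ 0 →
              Runs ε (whileNonZero a loop p) s s (size (reg s a))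
  run-loop  : ∀ {a p s s′ s″ t u} → reg s a ≢ 0 →
              Runs ε p s s′ t → Runs ε (whileNonZero a loop p) s′ s″ u →
              Runs ε (whileNonZero a loop p) s s″ (size (reg s a) + (t + u))

-- Inputs n and k in registers 0 and 1; everything else is zero.
initial : ℕ → ℕ → State
initial n k = state (((λ _ → 0) [ 0 ↦ n ]) [ 1 ↦ k ]) (λ _ → 0) []

-- On input (n, k, ε), p outputs the members of S one after the other, with
-- multiplicity, and halts after t bit operations.
Constructs : Program → (n k : ℕ) → Real01 → List⁺ (Vec Bool n) → ℕ → Set
Constructs p n k ε S t =
  ∃[ s ] Runs ε p (initial n k) s t × output s ≡ concatMap Vec.toList (toList S)

module Submission where

-- The rows are found one after the other, and each row bit by bit, by the method of conditional
-- expectations.  Let K = 2^k, let q be such that 2^-q ≤ ε ≤ 2^(1-q), and M = 4 · 2^q.  A clause (k columns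
-- with a prescribed bit for each) carries two integer weights U and V, initially 1.  A row multiplies U by
-- M − 1 + E and V by M + 1 − E, where E is K if the row satisfies the clause and 0 otherwise.  A random row
-- has E = 1 on average, so some row multiplies the sum of all weights by at most M, and its bits can be
-- chosen greedily, because the conditional expectation of E is 0 or a power of 2.  After
-- m = 32 k ⌊log₂ n⌋ 2^(2q − k) rows no weight exceeds 2 (2n)^k M^m, and Bernoulli's inequality turns this
-- into |a/m − 1/K| ≤ 2^-q for the number a of rows that satisfy the clause.  To choose the bit of column i
-- only the clauses that contain column i are visited.  So a row takes about (2n)^k visits, each with
-- numbers of about m bits, and m² (2n)^k is n^k / ε⁴ up to a polynomial in k, log n and log 1/ε.  Either the
-- running time is below n^k / ε⁴ or its logarithm bounds these three quantities.

open import Defs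
open State
open import Data.Bool using (Bool; true; false; if_then_else_; not)
import Data.Bool.Properties as Bool
open import Data.Fin using (Fin; toℕ)
import Data.Fin as Fin
import Data.Fin.Properties as Fin
open import Data.Integer using (_⊖_) renaming (+_ to pos)
import Data.Integer as ℤ
import Data.Integer.Properties as ℤ
open import Data.List using (List; []; _∷_; _∷ʳ_; _++_; applyUpTo; concatMap; take)
import Data.List as List
import Data.List.Properties as List
open import Data.List.NonEmpty using (List⁺; length; toList)
import Data.List.NonEmpty as List⁺
open import Data.Nat
open import Data.Nat.Divisibility using (n∣m*n)
open import Data.Nat.DivMod
open import Data.Nat.ListAction using (product)
open import Data.Nat.ListAction.Properties using (product-++)
open import Data.Nat.Logarithm using (⌊log₂_⌋; ⌊log₂⌋-mono-≤; ⌊log₂[2^n]⌋≡n; ⌊log₂⌊n/2⌋⌋≡⌊log₂n⌋∸1)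
open import Data.Nat.Properties
open import Data.Nat.Tactic.RingSolver using (solve-∀)
open import Data.Product
open import Data.Rational using (0ℚ) renaming (_/_ to _/ℚ_; _-_ to _-ℚ_; _≤_ to _≤ℚ_; _<_ to _<ℚ_; ∣_∣ to ∣_∣ℚ)
import Data.Rational as ℚ
import Data.Rational.Properties as ℚ
open import Data.Rational.Unnormalised using (mkℚᵘ; *≤*; *<*)
import Data.Rational.Unnormalised as ℚᵘ
import Data.Rational.Unnormalised.Properties as ℚᵘ
open import Data.Sum using (_⊎_; inj₁; inj₂)
open import Data.Vec using (Vec; lookup)
import Data.Vec as Vec
import Data.Vec.Properties as Vec
open import Function using (_∘_; _$_)
open import Relation.Binary.PropositionalEquality
open import Relation.Nullary using (contradiction; yes; no; ¬_)

-- Hoare triples with a bound on the cost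

-- The factors linearize the exponential weights of a Chernoff bound, so that everything stays an
-- integer. Let R = 2^q / K: the tolerance 2^-q is the fraction 1/R of the mean 1/K. Relative to M,
-- a hit multiplies U by 1 + (K - 1)/M and a miss multiplies it by 1 - 1/M; this averages to 1, and
-- (K - 1)/M is less than 1/(4R), a quarter of the tolerated relative deviation. V has the opposite
-- signs and guards against too few hits. The obstacle is the bit cost, since the weights grow to
-- about m log M bits. Two bounds organise the count: H for addresses, codes, counters and row
-- factors, Z for weights and their sums. Every product has a factor of at most H and every quotient
-- has such operands, so no instruction costs more than `size H * size Z`, which is linear in m up
-- to logarithms. A pass over all clauses for every column would cost a further factor n; but a bit
-- affects only the clauses that contain its column, and their codes are enumerated directly by
-- inserting a digit.

snap : ℕ → (ℕ → ℕ) → List ℕ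
snap l r = applyUpTo r l

look : List ℕ → ℕ → ℕ
look []       _       = 0
look (x ∷ _)  zero    = x
look (_ ∷ xs) (suc i) = look xs i

-- Register files are functions, so they are compared through finite prefixes. On an explicit chain
-- of updates a prefix evaluates, updates beyond it disappear, and `refl` suffices; `look` recovers
-- the equation for a single register.
Keep : ℕ → State → State → Set
Keep l s s′ = snap l (reg s′) ≡ snap l (reg s) × mem s′ ≡ mem s × output s′ ≡ output s

module Logic (ε : Real01) (κ : ℕ) where

  -- Total correctness: halting is part of the claim. The time is measured in units of `κ`, a
  -- uniform bound on the cost of one instruction or one test, so that budgets are plain instruction
  -- counts.
  record Tri (b : ℕ) (p : Program) (s : State) (Q : State → Set) : Set where
    constructor tri
    field
      run : ∃[ s′ ] ∃[ t ] Runs ε p s s′ t × t ≤ b * κ × Q s′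

  private variable
    a b b′ : ℕ
    c : Instr
    p q : Program
    s : State
    Q R : State → Set

  last : cost c s ≤ κ → Q (exec ε c s) → Tri 1 (instr c) s Q
  last le post = tri $ _ , _ , run-instr , ≤-trans le (≤-reflexive (sym (*-identityˡ κ))) , post

  bind : Tri b p s Q → (∀ s′ → Q s′ → Tri b′ q s′ R) → Tri (b + b′) (p ⨾ q) s R
  bind {b = b} {b′ = b′} (tri (s′ , t , run , le , post)) next with next s′ post
  ... | tri (s″ , u , run′ , le′ , post′) = tri $
    s″ , t + u , run-seq run run′ ,
    ≤-trans (+-mono-≤ le le′) (≤-reflexive (sym (*-distribʳ-+ κ b b′))) , post′

  step : cost c s ≤ κ → Tri b q (exec ε c s) R → Tri (suc b) (instr c ⨾ q) s R
  step le (tri (s″ , u , run′ , le′ , post′)) = tri $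
    s″ , _ , run-seq run-instr run′ , +-mono-≤ le le′ , post′

  weaken : b ≤ b′ → (∀ s′ → Q s′ → R s′) → Tri b p s Q → Tri b′ p s R
  weaken b≤b′ imp (tri (s′ , t , run , le , post)) = tri $
    s′ , t , run , ≤-trans le (*-monoˡ-≤ κ b≤b′) , imp s′ post

  branch : size (reg s a) ≤ κ →
    (reg s a ≢ 0 → Tri b p s Q) → (reg s a ≡ 0 → Tri b q s Q) →
    Tri (suc b) (ifNonZero a then p else q) s Q
  branch {s = s} {a = a} le on-then on-else with reg s a ≟ 0
  ... | yes z with on-else z
  ...   | tri (s′ , t , run , le′ , post) = tri $ s′ , _ , run-else z run , +-mono-≤ le le′ , post
  branch {s = s} {a = a} le on-then on-else | no nz with on-then nz
  ...   | tri (s′ , t , run , le′ , post) = tri $ s′ , _ , run-then nz run , +-mono-≤ le le′ , post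

  -- The index of the invariant is the number of iterations still to come, which makes termination
  -- part of the rule. Each iteration pays one unit for its test; the last `+ 1` pays for the test
  -- that leaves the loop.
  while : (I : ℕ → State → Set) →
    (∀ j s → I j s → size (reg s a) ≤ κ) →
    (∀ s → I 0 s → reg s a ≡ 0) →
    (∀ j s → I (suc j) s → reg s a ≢ 0) →
    (∀ j s → I (suc j) s → Tri b p s (I j)) →
    ∀ j s → I j s → Tri (j * suc b + 1) (whileNonZero a loop p) s (I 0)
  while I le z nz body zero s inv =
    tri $ s , _ , run-exit (z s inv) , ≤-trans (le 0 s inv) (≤-reflexive (sym (*-identityˡ κ))) , inv
  while {b = b} I le z nz body (suc j) s inv with body j s inv
  ... | tri (s′ , t , run , le′ , inv′) with while I le z nz body j s′ inv′
  ...   | tri (s″ , u , run′ , le″ , inv″) = tri $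
    s″ , _ , run-loop (nz j s inv) run run′ ,
    ≤-trans (+-mono-≤ (le (suc j) s inv) (+-mono-≤ le′ le″)) (≤-reflexive eq) , inv″
    where
    eq : κ + (b * κ + (j * suc b + 1) * κ) ≡ (suc j * suc b + 1) * κ
    eq = begin
      κ + (b * κ + (j * suc b + 1) * κ)  ≡⟨ cong (κ +_) (*-distribʳ-+ κ b (j * suc b + 1)) ⟨
      (suc b + (j * suc b + 1)) * κ      ≡⟨ cong (_* κ) (+-assoc (suc b) (j * suc b) 1) ⟨
      (suc j * suc b + 1) * κ            ∎
      where open ≡-Reasoning

  countdown : (I : ℕ → State → Set) →
    (∀ j s → I j s → size (reg s a) ≤ κ) →
    (∀ j s → I j s → reg s a ≡ j) →
    (∀ j s → I (suc j) s → Tri b p s (I j)) →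
    ∀ j s → I j s → Tri (j * suc b + 1) (whileNonZero a loop p) s (I 0)
  countdown I le eq = while I le (eq 0) λ j s inv z → contradiction (trans (sym (eq (suc j) s inv)) z) λ ()

-- The unit of cost

size-mono : ∀ {x y} → x ≤ y → size x ≤ size y
size-mono x≤y = s≤s (⌊log₂⌋-mono-≤ x≤y)

module Bounds (H Z : ℕ) (2≤H : 2 ≤ H) (H≤Z : H ≤ Z) where
  κ : ℕ
  κ = size H * size Z

  2≤size-H : 2 ≤ size H
  2≤size-H = size-mono 2≤H

  size≤κ : ∀ {x} → x ≤ Z → size x ≤ κ
  size≤κ x≤Z = ≤-trans (size-mono x≤Z) (m≤n*m (size Z) (size H))

  -- Two long operands fit into one unit because `size H` is at least 2.
  add≤κ : ∀ {x y} → x ≤ Z → y ≤ Z → size x + size y ≤ κ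
  add≤κ x≤Z y≤Z = ≤-trans
    (+-mono-≤ (size-mono x≤Z) (≤-trans (size-mono y≤Z) (≤-reflexive (sym (+-identityʳ (size Z))))))
    (*-monoˡ-≤ (size Z) 2≤size-H)

  mul≤κ : ∀ {x y} → x ≤ H → y ≤ Z → size x * size y ≤ κ
  mul≤κ x≤H y≤Z = *-mono-≤ (size-mono x≤H) (size-mono y≤Z)

  small : ∀ {x} → x ≤ H → x ≤ Z
  small x≤H = ≤-trans x≤H H≤Z

-- Digits of clause codes and the product of their factors

infixl 7 _÷_
_÷_ : ℕ → ℕ → ℕ
_÷_ = ⟦ quo ⟧

-- The remainder in the form in which the programs compute it: the machine divides but has no
-- remainder operation.
digitOf : ℕ → ℕ → ℕ
digitOf B x = x ∸ (x ÷ B) * B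

÷≤ : ∀ x y → x ÷ y ≤ x
÷≤ x zero    = z≤n
÷≤ x (suc y) = m/n≤m x (suc y)

÷*≤ : ∀ x y → (x ÷ y) * y ≤ x
÷*≤ x zero    = z≤n
÷*≤ x (suc y) = m/n*n≤m x (suc y)

digitOf≡% : ∀ B x → digitOf (suc B) x ≡ x % suc B
digitOf≡% B x = sym (m%n≡m∸m/n*n x (suc B))

digitOf< : ∀ {B} x → 1 ≤ B → digitOf B x < B
digitOf< {suc B} x _ = subst (_< suc B) (sym (digitOf≡% B x)) (m%n<n x (suc B))

-- For the factor table of a partial row this is E, that is 2^j times the conditional probability
-- that the j literals of `x` hold, provided that they lie in different columns.
digitProduct : (ℕ → ℕ) → ℕ → ℕ → ℕ → ℕ
digitProduct T B zero    x = 1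
digitProduct T B (suc j) x = T (digitOf B x) * digitProduct T B j (x ÷ B)

-- Memory: cell 3d holds the factor of the literal d, cells 3c+1 and 3c+2 hold the weights U and V of the
-- clause c.  The literal 2i + b says that bit i is b; a clause is a number whose k digits in base 2n are
-- literals.
factorAt : (ℕ → ℕ) → ℕ → ℕ
factorAt m d = m (d * 3)

-- Registers after the set-up: 0 n, 1 k, 2 B = 2n, 3 N = B^k, 4 M − 1, 5 M + 1, 6 rows left, 7 columns left, 8 literal 2i,
-- 9 and 10 the two sides of the comparison that decides a bit, 11 literal d, 12 position j, 13 B^j, 14 and 15
-- the sums of E·U and E·V, 16 loop counter, 17 clause c, 18 digits left, 19 rest of c, 20 product E,
-- 21-23 scratch.  A subroutine changes only registers from some bound upwards, whence Keep.
decodeBody decode : Program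
decodeBody =
  instr (const 21 1) ⨾
  instr (arith sub 18 18 21) ⨾
  instr (arith quo 21 19 2) ⨾
  instr (arith mul 22 21 2) ⨾
  instr (arith sub 22 19 22) ⨾
  instr (const 23 3) ⨾
  instr (arith mul 22 22 23) ⨾
  instr (load 22 22) ⨾
  instr (arith mul 20 20 22) ⨾
  -- There is no move instruction: a register is copied by adding it to zero.
  instr (const 19 0) ⨾
  instr (arith add 19 19 21)
decode =
  instr (const 20 1) ⨾
  instr (const 19 0) ⨾
  instr (arith add 19 19 17) ⨾
  instr (const 18 0) ⨾
  instr (arith add 18 18 1) ⨾
  whileNonZero 18 loop decodeBody

module Decode (ε : Real01) (H Z : ℕ) (3≤H : 3 ≤ H) (H≤Z : H ≤ Z) where
  open Bounds H Z (≤-trans (n≤1+n 2) 3≤H) H≤Z public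
  open Logic ε κ public

  tiny≤ : ∀ {x} → x ≤ 3 → x ≤ Z
  tiny≤ x≤3 = small (≤-trans x≤3 3≤H)

  0≤Z = tiny≤ {0} z≤n
  1≤Z = tiny≤ {1} (s≤s z≤n)
  2≤Z = tiny≤ {2} (s≤s (s≤s z≤n))
  3≤Z = tiny≤ {3} ≤-refl

  module _ (g : List ℕ) (m : ℕ → ℕ) (o : List Bool) (total : ℕ) where
    private
      B = look g 2

    -- The factor `2 ^ j` in the bound reserves room for the j factors still to come, each at most
    -- 2, so the partial product stays short.
    DecodeInv : ℕ → State → Set
    DecodeInv j s =
      (snap 18 (reg s) ≡ g × mem s ≡ m × output s ≡ o) ×
      reg s 18 ≡ j × reg s 18 ≤ H × reg s 19 ≤ H × reg s 20 * 2 ^ j ≤ H ×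
      reg s 20 * digitProduct (factorAt m) B j (reg s 19) ≡ total

  decodeBody-spec : ∀ g m o total → 1 ≤ look g 2 → look g 2 * 3 ≤ H →
    (∀ d → d < look g 2 → factorAt m d ≤ 2) →
    ∀ j s → DecodeInv g m o total (suc j) s →
    Tri 11 decodeBody s (DecodeInv g m o total j)
  decodeBody-spec g m o total 1≤B 3B≤H T≤2 j (state r _ _)
    ((refl , refl , refl) , j≡ , j≤ , x≤ , E≤ , tot) =
    step (size≤κ 1≤Z) $
    step (add≤κ (small j≤) 1≤Z) $
    step (mul≤κ x≤ (small B≤)) $
    step (mul≤κ y≤ (small B≤)) $
    step (add≤κ (small x≤) (small yB≤)) $
    step (size≤κ 3≤Z) $
    step (mul≤κ d≤ 3≤Z) $
    step (add≤κ (small d3≤) (≤-trans T≤ 2≤Z)) $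
    step (mul≤κ e≤ (≤-trans T≤ 2≤Z)) $
    step (size≤κ 0≤Z) $
    last (add≤κ 0≤Z (small y≤))
      ( (refl , refl , refl)
      , cong (_∸ 1) j≡
      , ≤-trans (m∸n≤m (r 18) 1) j≤
      , y≤
      , ≤-trans (*-monoˡ-≤ (2 ^ j) (*-monoʳ-≤ (r 20) T≤)) (≤-trans (≤-reflexive (*-assoc (r 20) 2 (2 ^ j))) E≤)
      , trans (*-assoc (r 20) _ _) tot )
    where
    x = r 19
    d<B = digitOf< {r 2} x 1≤B
    T≤ = T≤2 (digitOf (r 2) x) d<B
    B≤ : r 2 ≤ H
    B≤ = ≤-trans (m≤m*n (r 2) 3) 3B≤H
    y≤ : x ÷ r 2 ≤ H
    y≤ = ≤-trans (÷≤ x (r 2)) x≤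
    yB≤ = ≤-trans (÷*≤ x (r 2)) x≤
    d≤ : digitOf (r 2) x ≤ H
    d≤ = ≤-trans (m∸n≤m x (x ÷ r 2 * r 2)) x≤
    d3≤ : digitOf (r 2) x * 3 ≤ H
    d3≤ = ≤-trans (*-monoˡ-≤ 3 (<⇒≤ d<B)) 3B≤H
    e≤ : r 20 ≤ H
    e≤ = ≤-trans (m≤m*n (r 20) (2 ^ suc j) {{m^n≢0 2 (suc j)}}) E≤

  decode-spec : ∀ s (let r = reg s) → 1 ≤ r 1 → 1 ≤ r 2 → r 2 * 3 ≤ H → r 1 ≤ H → 2 ^ r 1 ≤ H → r 17 ≤ H →
    (∀ d → d < r 2 → factorAt (mem s) d ≤ 2) →
    Tri (18 * r 1) decode s (λ s′ → Keep 18 s s′ ×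
      reg s′ 20 ≤ H × reg s′ 20 ≡ digitProduct (factorAt (mem s)) (r 2) (r 1) (r 17))
  decode-spec s@(state r m o) 1≤k 1≤B 3B≤H k≤ 2^k≤ c≤ T≤2 =
    weaken le finish $
    step (size≤κ 1≤Z) $
    step (size≤κ 0≤Z) $
    step (add≤κ 0≤Z (small c≤)) $
    step (size≤κ 0≤Z) $
    step (add≤κ 0≤Z (small k≤)) $
    countdown (DecodeInv (snap 18 r) m o total)
      (λ { j s (_ , _ , j≤ , _) → size≤κ (small j≤) })
      (λ { _ _ (_ , j≡ , _) → j≡ })
      (decodeBody-spec (snap 18 r) m o total 1≤B 3B≤H T≤2)
      (r 1) _
      ((refl , refl , refl) , refl , k≤ , c≤ , ≤-trans (≤-reflexive (*-identityˡ _)) 2^k≤ , *-identityˡ _)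
    where
    total = digitProduct (factorAt m) (r 2) (r 1) (r 17)
    finish : ∀ s′ → DecodeInv (snap 18 r) m o total 0 s′ → Keep 18 s s′ ×
      reg s′ 20 ≤ H × reg s′ 20 ≡ digitProduct (factorAt m) (r 2) (r 1) (r 17)
    finish s′ (keep , _ , _ , _ , E≤ , tot) =
      keep , subst (_≤ H) (*-identityʳ _) E≤ , trans (sym (*-identityʳ _)) tot
    le : 5 + (r 1 * 12 + 1) ≤ 18 * r 1
    le = ≤-trans (≤-reflexive (eq (r 1))) (≤-trans (+-monoʳ-≤ (12 * r 1) (*-monoʳ-≤ 6 1≤k)) (≤-reflexive (eq′ (r 1))))
      where
      eq : ∀ a → 5 + (a * 12 + 1) ≡ 12 * a + 6 * 1
      eq = solve-∀
      eq′ : ∀ a → 12 * a + 6 * a ≡ 18 * a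
      eq′ = solve-∀

-- Sums over the clauses that contain a given literal

sumBelow : (ℕ → ℕ) → ℕ → ℕ
sumBelow f zero    = 0
sumBelow f (suc n) = f n + sumBelow f n

-- The code whose digit at the position of weight P is d and whose other digits are those of y.
insertDigit : ℕ → ℕ → ℕ → ℕ → ℕ
insertDigit B P d y = ((y ÷ P) * B + d) * P + (y ∸ (y ÷ P) * P)

upperWeight lowerWeight : (ℕ → ℕ) → ℕ → ℕ
upperWeight m c = m (c * 3 + 1)
lowerWeight m c = m (c * 3 + 1 + 1)

positionSum : (ℕ → ℕ) → ℕ → ℕ → ℕ → ℕ → ℕ
positionSum f B N d P = sumBelow (λ y → f (insertDigit B P d y)) (N ÷ B)

-- Visits k · N/B codes instead of all N: for each position it runs over the codes of the other k -
-- 1 digits. A code that contains d several times is visited as often.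
literalSum : (ℕ → ℕ) → ℕ → ℕ → ℕ → ℕ → ℕ
literalSum f B N k d = sumBelow (λ j → positionSum f B N d (B ^ j)) k

weighted : (ℕ → ℕ) → ℕ → ℕ → (ℕ → ℕ) → ℕ → ℕ
weighted m k B W c = digitProduct (factorAt m) B k c * W c

pow÷ : ∀ {B} j → 1 ≤ B → B ^ suc j ÷ B ≡ B ^ j
pow÷ {suc B} j _ = trans (cong (_/ suc B) (*-comm (suc B) (suc B ^ j))) (m*n/n≡m (suc B ^ j) (suc B))

1≤pow÷ : ∀ {k B} → 1 ≤ k → 1 ≤ B → 1 ≤ B ^ k ÷ B
1≤pow÷ {suc k} {B} _ 1≤B = subst (1 ≤_) (sym (pow÷ k 1≤B)) (m^n>0 B {{>-nonZero 1≤B}} k)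

m<n*o⇒m÷o<n : ∀ {m n o} → 1 ≤ o → m < n * o → m ÷ o < n
m<n*o⇒m÷o<n {m} {n} {suc o} _ = m<n*o⇒m/o<n

-- As y has only k - 1 digits, its part above position j is less than B^(k - 1 - j) and can be
-- shifted up by one digit.
insertDigit-< : ∀ {B k j d y} → 1 ≤ B → j < k → d < B → y < B ^ k ÷ B → insertDigit B (B ^ j) d y < B ^ k
insertDigit-< {B} {suc k} {j} {d} {y} 1≤B (s≤s j≤k) d<B y< = begin-strict
  (a * B + d) * P + (y ∸ a * P)  <⟨ +-monoʳ-< ((a * B + d) * P) (digitOf< y 1≤P) ⟩
  (a * B + d) * P + P            ≡⟨ +-comm _ P ⟩
  suc (a * B + d) * P            ≤⟨ *-monoˡ-≤ P (begin
    suc (a * B + d)  ≡⟨ +-suc (a * B) d ⟨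
    a * B + suc d    ≤⟨ +-monoʳ-≤ (a * B) d<B ⟩
    a * B + B        ≡⟨ +-comm (a * B) B ⟩
    suc a * B        ≤⟨ *-monoˡ-≤ B a< ⟩
    Q * B            ∎) ⟩
  Q * B * P                      ≡⟨ eq Q B P ⟩
  B * (Q * P)                    ≡⟨ cong (B *_) QP≡ ⟩
  B ^ suc k                      ∎
  where
  open ≤-Reasoning
  P = B ^ j
  Q = B ^ (k ∸ j)
  a = y ÷ P
  1≤P : 1 ≤ P
  1≤P = m^n>0 B {{>-nonZero 1≤B}} j
  QP≡ : Q * P ≡ B ^ k
  QP≡ = trans (sym (^-distribˡ-+-* B (k ∸ j) j)) (cong (B ^_) (m∸n+n≡m j≤k))
  a< : suc a ≤ Q
  a< = m<n*o⇒m÷o<n {n = Q} 1≤P (subst (y <_) (trans (pow÷ k 1≤B) (sym QP≡)) y<)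
  eq : ∀ q b p → q * b * p ≡ b * (q * p)
  eq = solve-∀

-- Hides additive overhead in the leading constant, so that every budget becomes a constant times a
-- product of parameters.
absorb : ∀ a b {x} → 1 ≤ x → a + b * x ≤ (a + b) * x
absorb a b {x} 1≤x = begin
  a + b * x      ≡⟨ cong (_+ b * x) (*-identityʳ a) ⟨
  a * 1 + b * x  ≤⟨ +-monoˡ-≤ (b * x) (*-monoʳ-≤ a 1≤x) ⟩
  a * x + b * x  ≡⟨ *-distribʳ-+ x a b ⟨
  (a + b) * x    ∎
  where open ≤-Reasoning

loop-≤ : ∀ i b {x} → 1 ≤ i → 1 ≤ x → i * suc (b * x) + 1 ≤ (2 + b) * (i * x)
loop-≤ i b {x} 1≤i 1≤x = begin
  i * suc (b * x) + 1        ≤⟨ +-mono-≤ (*-monoʳ-≤ i (+-monoˡ-≤ (b * x) 1≤x)) (*-mono-≤ 1≤i 1≤x) ⟩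
  i * (x + b * x) + i * x    ≡⟨ eq i b x ⟩
  (2 + b) * (i * x)          ∎
  where
  open ≤-Reasoning
  eq : ∀ i b x → i * (x + b * x) + i * x ≡ (2 + b) * (i * x)
  eq = solve-∀

sumInnerBody sumInner sumOuterBody sumLiteral : Program
sumInnerBody =
  instr (const 21 1) ⨾
  instr (arith sub 16 16 21) ⨾
  instr (arith quo 17 16 13) ⨾
  instr (arith mul 21 17 13) ⨾
  instr (arith sub 21 16 21) ⨾
  instr (arith mul 17 17 2) ⨾
  instr (arith add 17 17 11) ⨾
  instr (arith mul 17 17 13) ⨾
  instr (arith add 17 17 21) ⨾
  decode ⨾
  instr (const 22 3) ⨾
  instr (arith mul 21 17 22) ⨾
  instr (const 22 1) ⨾
  instr (arith add 21 21 22) ⨾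
  instr (load 23 21) ⨾
  instr (arith mul 23 20 23) ⨾
  instr (arith add 14 14 23) ⨾
  instr (arith add 21 21 22) ⨾
  instr (load 23 21) ⨾
  instr (arith mul 23 20 23) ⨾
  instr (arith add 15 15 23)
sumInner = whileNonZero 16 loop sumInnerBody
sumOuterBody =
  instr (const 21 1) ⨾
  instr (arith sub 12 12 21) ⨾
  instr (arith quo 13 13 2) ⨾
  instr (arith quo 16 3 2) ⨾
  sumInner
sumLiteral =
  instr (const 14 0) ⨾
  instr (const 15 0) ⨾
  instr (const 12 0) ⨾
  instr (arith add 12 12 1) ⨾
  instr (const 13 0) ⨾
  instr (arith add 13 13 3) ⨾
  whileNonZero 12 loop sumOuterBody

module Sums (ε : Real01) (H Z : ℕ) (3≤H : 3 ≤ H) (H≤Z : H ≤ Z) where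
  open Decode ε H Z 3≤H H≤Z public

  record Env (k B N : ℕ) (m : ℕ → ℕ) : Set where
    field
      1≤k  : 1 ≤ k
      k≤H  : k ≤ H
      2^k≤ : 2 ^ k ≤ H
      1≤B  : 1 ≤ B
      3B≤H : B * 3 ≤ H
      N≡   : N ≡ B ^ k
      -- The summand 2 covers the address 3c + 2 of the last cell of a clause.
      3N≤H : N * 3 + 2 ≤ H
      T≤2  : ∀ d → d < B → factorAt m d ≤ 2
      U≤Z  : ∀ c → c < N → upperWeight m c ≤ Z
      V≤Z  : ∀ c → c < N → lowerWeight m c ≤ Z
    B≤H : B ≤ H
    B≤H = ≤-trans (m≤m*n B 3) 3B≤H
    N≤H : N ≤ H
    N≤H = ≤-trans (m≤m*n N 3) (≤-trans (m≤m+n (N * 3) 2) 3N≤H)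
    c3≤ : ∀ {c} → c < N → c * 3 + 1 + 1 ≤ H
    c3≤ {c} c< = ≤-trans (≤-trans (≤-reflexive (+-assoc (c * 3) 1 1)) (+-monoˡ-≤ 2 (*-monoˡ-≤ 3 (<⇒≤ c<)))) 3N≤H

  -- The totals X and Y are fixed in advance as accumulator plus terms still to come. A bound on the
  -- totals then bounds every partial sum and every term, as the cost estimates require.
  InnerInv : List ℕ → (ℕ → ℕ) → List Bool → ℕ → ℕ → ℕ → State → Set
  InnerInv g m o X Y y s =
    (snap 14 (reg s) ≡ g × mem s ≡ m × output s ≡ o) ×
    reg s 16 ≡ y × reg s 16 ≤ H × y ≤ N ÷ B ×
    reg s 14 + sumBelow (λ y → weighted m k B (upperWeight m) (insertDigit B P d y)) y ≡ X ×
    reg s 15 + sumBelow (λ y → weighted m k B (lowerWeight m) (insertDigit B P d y)) y ≡ Y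
    where
    k = look g 1
    B = look g 2
    N = look g 3
    d = look g 11
    P = look g 13

  sumInnerBody-spec : ∀ g m o X Y → X ≤ Z → Y ≤ Z → Env (look g 1) (look g 2) (look g 3) m →
    1 ≤ look g 13 → look g 13 ≤ H →
    (∀ y → y < look g 3 ÷ look g 2 → insertDigit (look g 2) (look g 13) (look g 11) y < look g 3) →
    ∀ y s → InnerInv g m o X Y (suc y) s →
    Tri (38 * look g 1) sumInnerBody s (InnerInv g m o X Y y)
  sumInnerBody-spec g m o X Y X≤Z Y≤Z env 1≤P P≤H ins< y (state r _ _)
    ((refl , refl , refl) , y≡ , y≤H , y< , Xeq , Yeq) =
    weaken (≤-trans (≤-reflexive (eq₁ (r 1))) (absorb 20 18 1≤k)) (λ s post → post) $
    step (size≤κ 1≤Z) $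
    step (add≤κ (small y≤H) 1≤Z) $
    step (mul≤κ y′≤H (small P≤H)) $
    step (mul≤κ a≤H (small P≤H)) $
    step (add≤κ (small y′≤H) (small aP≤H)) $
    step (mul≤κ a≤H (small B≤H)) $
    step (add≤κ (small aB≤H) (small d≤H)) $
    step (mul≤κ aBd≤H (small P≤H)) $
    step (add≤κ (small aBdP≤H) (small lo≤H)) $
    bind (decode-spec _ 1≤k 1≤B 3B≤H k≤H 2^k≤ c≤H T≤2)
    λ { (state r′ _ _) ((keep , refl , refl) , E≤H , E≡) →
      after r′ keep E≤H E≡ }
    where
    open Env env
    y′ = r 16 ∸ 1
    y′≡ : y′ ≡ y
    y′≡ = cong (_∸ 1) y≡
    a = y′ ÷ r 13
    lo = y′ ∸ a * r 13
    c = insertDigit (r 2) (r 13) (r 11) y′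
    c<N : c < r 3
    c<N = subst (λ y → insertDigit (r 2) (r 13) (r 11) y < r 3) (sym y′≡) (ins< y y<)
    c≤H : c ≤ H
    c≤H = ≤-trans (<⇒≤ c<N) N≤H
    y′≤H : y′ ≤ H
    y′≤H = ≤-trans (m∸n≤m (r 16) 1) y≤H
    a≤H : a ≤ H
    a≤H = ≤-trans (÷≤ y′ (r 13)) y′≤H
    aP≤H : a * r 13 ≤ H
    aP≤H = ≤-trans (÷*≤ y′ (r 13)) y′≤H
    lo≤H : lo ≤ H
    lo≤H = ≤-trans (m∸n≤m y′ (a * r 13)) y′≤H
    aBdP≤H : (a * r 2 + r 11) * r 13 ≤ H
    aBdP≤H = ≤-trans (m≤m+n _ lo) c≤H
    aBd≤H : a * r 2 + r 11 ≤ H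
    aBd≤H = ≤-trans (m≤m*n (a * r 2 + r 11) (r 13) {{>-nonZero 1≤P}}) aBdP≤H
    aB≤H : a * r 2 ≤ H
    aB≤H = ≤-trans (m≤m+n (a * r 2) (r 11)) aBd≤H
    d≤H : r 11 ≤ H
    d≤H = ≤-trans (m≤n+m (r 11) (a * r 2)) aBd≤H
    eq₁ : ∀ k → 9 + (18 * k + 11) ≡ 20 + 18 * k
    eq₁ = solve-∀
    fX = λ y → weighted m (r 1) (r 2) (upperWeight m) (insertDigit (r 2) (r 13) (r 11) y)
    fY = λ y → weighted m (r 1) (r 2) (lowerWeight m) (insertDigit (r 2) (r 13) (r 11) y)
    after : ∀ r′ →
      let r₁ = (((((r [ 21 ↦ 1 ]) [ 16 ↦ y′ ]) [ 17 ↦ a ]) [ 21 ↦ lo ]) [ 17 ↦ c ]) in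
      snap 18 r′ ≡ snap 18 r₁ →
      r′ 20 ≤ H → r′ 20 ≡ digitProduct (factorAt m) (r 2) (r 1) c →
      Tri 11 _ (state r′ m o) (InnerInv (snap 14 r) m o X Y y)
    after r′ keep E≤H E≡ =
      step (size≤κ 3≤Z) $
      step (mul≤κ r17≤H 3≤Z) $
      step (size≤κ 1≤Z) $
      step (add≤κ (small 3c≤H) 1≤Z) $
      step (add≤κ (small 3c1≤H) U≤) $
      step (mul≤κ E≤H U≤) $
      step (add≤κ X≤ EU≤) $
      step (add≤κ (small 3c1≤H) 1≤Z) $
      step (add≤κ (small 3c2≤H) V≤) $
      step (mul≤κ E≤H V≤) $
      last (add≤κ Y≤ EV≤)
        ( (cong (take 14) keep , refl , refl)
        , trans r16≡ y′≡
        , subst (_≤ H) (sym r16≡) y′≤H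
        , <⇒≤ y<
        , Xpost
        , Ypost )
      where
      at : ∀ i → look (snap 18 r′) i ≡ look (snap 18 (((((r [ 21 ↦ 1 ]) [ 16 ↦ y′ ]) [ 17 ↦ a ]) [ 21 ↦ lo ]) [ 17 ↦ c ])) i
      at i = cong (λ l → look l i) keep
      r17≡ : r′ 17 ≡ c
      r17≡ = at 17
      r16≡ : r′ 16 ≡ y′
      r16≡ = at 16
      r17<N = subst (_< r 3) (sym r17≡) c<N
      r17≤H = subst (_≤ H) (sym r17≡) c≤H
      3c2≤H = c3≤ r17<N
      3c1≤H = ≤-trans (m≤m+n (r′ 17 * 3 + 1) 1) 3c2≤H
      3c≤H = ≤-trans (m≤m+n (r′ 17 * 3) 1) 3c1≤H
      U≤ = U≤Z (r′ 17) r17<N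
      V≤ = V≤Z (r′ 17) r17<N
      term : ∀ W → r′ 20 * W (r′ 17) ≡ weighted m (r 1) (r 2) W (insertDigit (r 2) (r 13) (r 11) y)
      term W = trans (cong₂ _*_ E≡ (cong W r17≡))
        (cong (λ y → weighted m (r 1) (r 2) W (insertDigit (r 2) (r 13) (r 11) y)) y′≡)
      Xpost : r′ 14 + r′ 20 * upperWeight m (r′ 17) + sumBelow fX y ≡ X
      Xpost = trans (cong₂ (λ u v → u + v + sumBelow fX y) (at 14) (term (upperWeight m)))
        (trans (+-assoc (r 14) (fX y) _) Xeq)
      Ypost : r′ 15 + r′ 20 * lowerWeight m (r′ 17) + sumBelow fY y ≡ Y
      Ypost = trans (cong₂ (λ u v → u + v + sumBelow fY y) (at 15) (term (lowerWeight m)))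
        (trans (+-assoc (r 15) (fY y) _) Yeq)
      X+≤ : r′ 14 + r′ 20 * upperWeight m (r′ 17) ≤ Z
      X+≤ = ≤-trans (m≤m+n _ (sumBelow fX y)) (≤-trans (≤-reflexive Xpost) X≤Z)
      Y+≤ : r′ 15 + r′ 20 * lowerWeight m (r′ 17) ≤ Z
      Y+≤ = ≤-trans (m≤m+n _ (sumBelow fY y)) (≤-trans (≤-reflexive Ypost) Y≤Z)
      X≤ = ≤-trans (m≤m+n (r′ 14) _) X+≤
      EU≤ = ≤-trans (m≤n+m _ (r′ 14)) X+≤
      Y≤ = ≤-trans (m≤m+n (r′ 15) _) Y+≤
      EV≤ = ≤-trans (m≤n+m _ (r′ 15)) Y+≤

  -- Register 13 starts at N = B^k and is divided by B at the beginning of the body, so the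
  -- iteration that leads from `suc j` to `j` works at the position of weight B^j.
  OuterInv : List ℕ → (ℕ → ℕ) → List Bool → ℕ → ℕ → ℕ → State → Set
  OuterInv g m o X Y j s =
    (snap 12 (reg s) ≡ g × mem s ≡ m × output s ≡ o) ×
    reg s 12 ≡ j × reg s 12 ≤ H × j ≤ k × reg s 13 ≡ B ^ j ×
    reg s 14 + literalSum (weighted m k B (upperWeight m)) B N j d ≡ X ×
    reg s 15 + literalSum (weighted m k B (lowerWeight m)) B N j d ≡ Y
    where
    k = look g 1
    B = look g 2
    N = look g 3
    d = look g 11

  pow≤N : ∀ {k B N m j} → Env k B N m → j ≤ k → B ^ j ≤ N
  pow≤N {k} {B} env j≤k = ≤-trans (^-monoʳ-≤ B {{>-nonZero 1≤B}} j≤k) (≤-reflexive (sym N≡))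
    where open Env env

  1≤N÷B : ∀ {k B N m} → Env k B N m → 1 ≤ N ÷ B
  1≤N÷B {k} {B} env = subst (λ N → 1 ≤ N ÷ B) (sym N≡) (1≤pow÷ {k} 1≤k 1≤B)
    where open Env env

  sumOuterBody-spec : ∀ g m o X Y → X ≤ Z → Y ≤ Z → Env (look g 1) (look g 2) (look g 3) m →
    look g 11 < look g 2 →
    ∀ j s → OuterInv g m o X Y (suc j) s →
    Tri (44 * (look g 3 ÷ look g 2 * look g 1)) sumOuterBody s (OuterInv g m o X Y j)
  sumOuterBody-spec g m o X Y X≤Z Y≤Z env d<B j (state r _ _)
    ((refl , refl , refl) , j≡ , j≤H , j<k , P≡ , Xeq , Yeq) =
    weaken (≤-trans (+-monoʳ-≤ 4 (loop-≤ (r 3 ÷ r 2) 38 (1≤N÷B env) 1≤k))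
                    (absorb 4 40 (*-mono-≤ (1≤N÷B env) 1≤k))) finish $
    step (size≤κ 1≤Z) $
    step (add≤κ (small j≤H) 1≤Z) $
    step (mul≤κ P≤H (small B≤H)) $
    step (mul≤κ N≤H (small B≤H)) $
    countdown (InnerInv (snap 14 r′) m o X₁ Y₁)
      (λ { _ _ (_ , _ , y≤ , _) → size≤κ (small y≤) })
      (λ { _ _ (_ , y≡ , _) → y≡ })
      (sumInnerBody-spec (snap 14 r′) m o X₁ Y₁ (total₁≤Z upperWeight (r 14) X Xeq X≤Z) (total₁≤Z lowerWeight (r 15) Y Yeq Y≤Z) env 1≤P′ P′≤H
        (λ y y< → subst (insertDigit (r 2) P′ (r 11) y <_) (sym N≡)
          (subst (λ P → insertDigit (r 2) P (r 11) y < r 2 ^ r 1) (sym P′≡)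
            (insertDigit-< 1≤B j<k d<B (subst (λ N → y < N ÷ r 2) N≡ y<)))))
      (r 3 ÷ r 2) _
      ((refl , refl , refl) , refl , ≤-trans (÷≤ (r 3) (r 2)) N≤H , ≤-refl , refl , refl)
    where
    open Env env
    P′ = r 13 ÷ r 2
    P≤H : r 13 ≤ H
    P≤H = ≤-trans (≤-reflexive P≡) (≤-trans (pow≤N env j<k) N≤H)
    P′≡ : P′ ≡ r 2 ^ j
    P′≡ = trans (cong (_÷ r 2) P≡) (pow÷ j 1≤B)
    1≤P′ : 1 ≤ P′
    1≤P′ = subst (1 ≤_) (sym P′≡) (m^n>0 (r 2) {{>-nonZero 1≤B}} j)
    P′≤H : P′ ≤ H
    P′≤H = ≤-trans (÷≤ (r 13) (r 2)) P≤H
    r′ = ((((r [ 21 ↦ 1 ]) [ 12 ↦ r 12 ∸ 1 ]) [ 13 ↦ P′ ]) [ 16 ↦ r 3 ÷ r 2 ])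
    f : ((ℕ → ℕ) → ℕ → ℕ) → ℕ → ℕ
    f W = weighted m (r 1) (r 2) (W m)
    rest : ((ℕ → ℕ) → ℕ → ℕ) → ℕ
    rest W = literalSum (f W) (r 2) (r 3) j (r 11)
    total₁ : ((ℕ → ℕ) → ℕ → ℕ) → ℕ → ℕ
    total₁ W x = x + positionSum (f W) (r 2) (r 3) (r 11) P′
    total₁+rest : ∀ W x t → x + literalSum (f W) (r 2) (r 3) (suc j) (r 11) ≡ t → total₁ W x + rest W ≡ t
    total₁+rest W x t eq = trans (cong (λ P → x + positionSum (f W) (r 2) (r 3) (r 11) P + rest W) P′≡)
      (trans (+-assoc x _ _) eq)
    total₁≤Z : ∀ W x t → x + literalSum (f W) (r 2) (r 3) (suc j) (r 11) ≡ t → t ≤ Z → total₁ W x ≤ Z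
    total₁≤Z W x t eq t≤Z = ≤-trans (m≤m+n _ (rest W)) (≤-trans (≤-reflexive (total₁+rest W x t eq)) t≤Z)
    X₁ Y₁ : ℕ
    X₁ = total₁ upperWeight (r 14)
    Y₁ = total₁ lowerWeight (r 15)
    finish : ∀ s′ → InnerInv (snap 14 r′) m o X₁ Y₁ 0 s′ → OuterInv (snap 12 r) m o X Y j s′
    finish s′ ((keep , mem≡ , out≡) , _ , _ , _ , Xeq′ , Yeq′) =
      (cong (take 12) keep , mem≡ , out≡) ,
      trans r12≡ (cong (_∸ 1) j≡) ,
      subst (_≤ H) (sym r12≡) (≤-trans (m∸n≤m (r 12) 1) j≤H) ,
      <⇒≤ j<k ,
      trans (cong (λ l → look l 13) keep) P′≡ ,
      trans (cong (_+ rest upperWeight) (trans (sym (+-identityʳ _)) Xeq′)) (total₁+rest upperWeight (r 14) X Xeq) ,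
      trans (cong (_+ rest lowerWeight) (trans (sym (+-identityʳ _)) Yeq′)) (total₁+rest lowerWeight (r 15) Y Yeq)
      where
      r12≡ : reg s′ 12 ≡ r 12 ∸ 1
      r12≡ = cong (λ l → look l 12) keep

  sumLiteral-spec : ∀ s (let r = reg s; m = mem s) → Env (r 1) (r 2) (r 3) m → r 11 < r 2 →
    literalSum (weighted m (r 1) (r 2) (upperWeight m)) (r 2) (r 3) (r 1) (r 11) ≤ Z →
    literalSum (weighted m (r 1) (r 2) (lowerWeight m)) (r 2) (r 3) (r 1) (r 11) ≤ Z →
    Tri (52 * (r 1 * (r 3 ÷ r 2 * r 1))) sumLiteral s (λ s′ → Keep 12 s s′ ×
      reg s′ 14 ≡ literalSum (weighted m (r 1) (r 2) (upperWeight m)) (r 2) (r 3) (r 1) (r 11) ×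
      reg s′ 15 ≡ literalSum (weighted m (r 1) (r 2) (lowerWeight m)) (r 2) (r 3) (r 1) (r 11))
  sumLiteral-spec (state r m o) env d<B X≤Z Y≤Z =
    weaken (≤-trans (+-monoʳ-≤ 6 (loop-≤ (r 1) 44 1≤k (*-mono-≤ (1≤N÷B env) 1≤k)))
             (absorb 6 46 (*-mono-≤ 1≤k (*-mono-≤ (1≤N÷B env) 1≤k)))) finish $
    step (size≤κ 0≤Z) $
    step (size≤κ 0≤Z) $
    step (size≤κ 0≤Z) $
    step (add≤κ 0≤Z (small k≤H)) $
    step (size≤κ 0≤Z) $
    step (add≤κ 0≤Z (small N≤H)) $
    countdown (OuterInv (snap 12 r) m o _ _)
      (λ { _ _ (_ , _ , j≤ , _) → size≤κ (small j≤) })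
      (λ { _ _ (_ , j≡ , _) → j≡ })
      (sumOuterBody-spec (snap 12 r) m o _ _ X≤Z Y≤Z env d<B)
      (r 1) _
      ((refl , refl , refl) , refl , k≤H , ≤-refl , N≡ , refl , refl)
    where
    open Env env
    finish : ∀ s′ → OuterInv (snap 12 r) m o _ _ 0 s′ → _
    finish s′ (keep , _ , _ , _ , _ , Xeq , Yeq) =
      keep , trans (sym (+-identityʳ _)) Xeq , trans (sym (+-identityʳ _)) Yeq

-- Setting its variable doubles the conditional probability of a clause or makes it 0.
settled : Bool → ℕ
settled b = if b then 2 else 0

-- Choosing and writing the bit of one column

setColumn : Bool → Program
setColumn b =
  instr (const 22 (settled b)) ⨾
  instr (const 23 (settled (not b))) ⨾
  instr (const 20 3) ⨾
  instr (arith mul 19 8 20) ⨾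
  instr (store 19 23) ⨾
  instr (arith mul 19 11 20) ⨾
  instr (store 19 22) ⨾
  -- `settled b` is 2 or 0, so emitting it appends `b`.
  instr (emit 22) ⨾
  instr (const 20 2) ⨾
  instr (arith add 8 8 20)

columnBody : Program
columnBody =
  instr (const 21 1) ⨾
  instr (arith sub 7 7 21) ⨾
  instr (const 11 0) ⨾
  instr (arith add 11 11 8) ⨾
  sumLiteral ⨾
  instr (const 9 0) ⨾
  instr (arith add 9 9 14) ⨾
  instr (const 10 0) ⨾
  instr (arith add 10 10 15) ⨾
  instr (const 21 1) ⨾
  instr (arith add 11 11 21) ⨾
  sumLiteral ⨾
  -- The sums for the literal 2i + 1 are added crosswise: register 9 becomes X₀ + Y₁ and register 10
  -- becomes X₁ + Y₀, so no negative number occurs.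
  instr (arith add 9 9 15) ⨾
  instr (arith add 10 10 14) ⨾
  instr (arith sub 21 9 10) ⨾
  (ifNonZero 21 then setColumn true else setColumn false)

settle : (ℕ → ℕ) → ℕ → Bool → ℕ → ℕ
settle m d b = (m [ d * 3 ↦ settled (not b) ]) [ (d + 1) * 3 ↦ settled b ]

module Column (ε : Real01) (H Z : ℕ) (3≤H : 3 ≤ H) (H≤Z : H ≤ Z) where
  open Sums ε H Z 3≤H H≤Z public

  literalX literalY : (ℕ → ℕ) → (ℕ → ℕ) → ℕ → ℕ
  literalX r m = literalSum (weighted m (r 1) (r 2) (upperWeight m)) (r 2) (r 3) (r 1)
  literalY r m = literalSum (weighted m (r 1) (r 2) (lowerWeight m)) (r 2) (r 3) (r 1)

  -- Setting the variable to b raises the potential by X_b − X_{¬b} − (Y_b − Y_{¬b}).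
  GoodBit : (ℕ → ℕ) → (ℕ → ℕ) → ℕ → Bool → Set
  GoodBit r m d true  = literalX r m (d + 1) + literalY r m d ≤ literalX r m d + literalY r m (d + 1)
  GoodBit r m d false = literalX r m d + literalY r m (d + 1) ≤ literalX r m (d + 1) + literalY r m d

  settled≤2 : ∀ b → settled b ≤ 2
  settled≤2 true  = ≤-refl
  settled≤2 false = z≤n

  emitted : ∀ b → (if settled b ≡ᵇ 0 then false else true) ≡ b
  emitted true  = refl
  emitted false = refl

  setColumn-spec : ∀ b s (let r = reg s) → r 11 ≡ r 8 + 1 → r 11 * 3 ≤ H → r 8 + 2 ≤ H →
    Tri 10 (setColumn b) s (λ s′ → snap 8 (reg s′) ≡ snap 8 r × reg s′ 8 ≡ r 8 + 2 ×
      mem s′ ≡ settle (mem s) (r 8) b × output s′ ≡ output s ∷ʳ b)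
  setColumn-spec b (state r m o) d≡ 3d≤H i≤H =
    step (size≤κ v≤Z) $
    step (size≤κ v̄≤Z) $
    step (size≤κ 3≤Z) $
    step (mul≤κ i≤ 3≤Z) $
    step (add≤κ (small 3i≤) v̄≤Z) $
    step (mul≤κ d≤ 3≤Z) $
    step (add≤κ (small 3d≤H) v≤Z) $
    step (size≤κ v≤Z) $
    step (size≤κ 2≤Z) $
    last (add≤κ (small i≤) 2≤Z)
      (refl , refl , cong (λ d → (m [ r 8 * 3 ↦ settled (not b) ]) [ d * 3 ↦ settled b ]) d≡ , cong (o ∷ʳ_) (emitted b))
    where
    v≤Z : settled b ≤ Z
    v≤Z = ≤-trans (settled≤2 b) 2≤Z
    v̄≤Z : settled (not b) ≤ Z
    v̄≤Z = ≤-trans (settled≤2 (not b)) 2≤Z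
    i≤ : r 8 ≤ H
    i≤ = ≤-trans (m≤m+n (r 8) 2) i≤H
    d≤ : r 11 ≤ H
    d≤ = ≤-trans (m≤m*n (r 11) 3) 3d≤H
    3i≤ : r 8 * 3 ≤ H
    3i≤ = ≤-trans (*-monoˡ-≤ 3 (≤-trans (m≤m+n (r 8) 1) (≤-reflexive (sym d≡)))) 3d≤H

  columnBody-spec : ∀ s (let r = reg s; m = mem s) → Env (r 1) (r 2) (r 3) m →
    r 7 ≤ H → r 8 + 1 < r 2 →
    (∀ d d′ → d < r 2 → d′ < r 2 → literalX r m d + literalY r m d′ ≤ Z) →
    Tri (128 * (r 1 * (r 3 ÷ r 2 * r 1))) columnBody s (λ s′ → snap 7 (reg s′) ≡ snap 7 r ×
      reg s′ 7 ≡ r 7 ∸ 1 × reg s′ 8 ≡ r 8 + 2 ×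
      ∃[ b ] GoodBit r m (r 8) b × mem s′ ≡ settle m (r 8) b × output s′ ≡ output s ∷ʳ b)
  columnBody-spec (state r m o) env j≤H i< sums≤Z =
    weaken le (λ _ post → post) $
    step (size≤κ 1≤Z) $
    step (add≤κ (small j≤H) 1≤Z) $
    step (size≤κ 0≤Z) $
    step (add≤κ 0≤Z (small i≤H)) $
    bind (sumLiteral-spec _ env i<B (X≤Z (r 8) i<B) (Y≤Z (r 8) i<B))
    λ { (state r₁ _ _) ((keep₁ , refl , refl) , X₀≡ , Y₀≡) →
    step (size≤κ 0≤Z) $
    step (add≤κ 0≤Z (≤-trans (≤-reflexive X₀≡) (X≤Z (r 8) i<B))) $
    step (size≤κ 0≤Z) $
    step (add≤κ 0≤Z (≤-trans (≤-reflexive Y₀≡) (Y≤Z (r 8) i<B))) $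
    step (size≤κ 1≤Z) $
    step (add≤κ (small (≤-trans (≤-reflexive (cong (λ l → look l 11) keep₁)) i≤H)) 1≤Z) $
    second r₁ keep₁ X₀≡ Y₀≡ }
    where
    open Env env
    i<B : r 8 < r 2
    i<B = ≤-trans (s≤s (m≤m+n (r 8) 1)) i<
    i≤H : r 8 ≤ H
    i≤H = ≤-trans (<⇒≤ i<B) B≤H
    X≤Z : ∀ d → d < r 2 → literalX r m d ≤ Z
    X≤Z d d<B = ≤-trans (m≤m+n _ (literalY r m d)) (sums≤Z d d d<B d<B)
    Y≤Z : ∀ d → d < r 2 → literalY r m d ≤ Z
    Y≤Z d d<B = ≤-trans (m≤n+m _ (literalX r m d)) (sums≤Z d d d<B d<B)
    S = 52 * (r 1 * (r 3 ÷ r 2 * r 1))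
    r₀ = ((r [ 21 ↦ 1 ]) [ 7 ↦ r 7 ∸ 1 ]) [ 11 ↦ r 8 ]
    Post : State → Set
    Post s′ = snap 7 (reg s′) ≡ snap 7 r ×
      reg s′ 7 ≡ r 7 ∸ 1 × reg s′ 8 ≡ r 8 + 2 ×
      ∃[ b ] GoodBit r m (r 8) b × mem s′ ≡ settle m (r 8) b × output s′ ≡ o ∷ʳ b
    le : 4 + (S + (6 + (S + 14))) ≤ 128 * (r 1 * (r 3 ÷ r 2 * r 1))
    le = ≤-trans (≤-reflexive (eq (r 1 * (r 3 ÷ r 2 * r 1))))
      (absorb 24 104 (*-mono-≤ 1≤k (*-mono-≤ (1≤N÷B env) 1≤k)))
      where
      eq : ∀ x → 4 + (52 * x + (6 + (52 * x + 14))) ≡ 24 + 104 * x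
      eq = solve-∀
    second : ∀ r₁ → snap 12 r₁ ≡ snap 12 r₀ → r₁ 14 ≡ literalX r m (r 8) → r₁ 15 ≡ literalY r m (r 8) →
      Tri (S + 14) _ (state ((((((r₁ [ 9 ↦ 0 ]) [ 9 ↦ r₁ 14 ]) [ 10 ↦ 0 ]) [ 10 ↦ r₁ 15 ]) [ 21 ↦ 1 ]) [ 11 ↦ r₁ 11 + 1 ]) m o) Post
    second r₁ keep₁ X₀≡ Y₀≡ =
      weaken (≤-reflexive (cong (λ k → 52 * k + 14) (cong (λ l → look l 1 * (look l 3 ÷ look l 2 * look l 1)) keep₁))) (λ _ post → post) $
      bind (sumLiteral-spec _ (subst (λ l → Env (look l 1) (look l 2) (look l 3) m) (sym keep₁) env) d<
        (subst (_≤ Z) (sym X₁≡) (X≤Z (r 8 + 1) i<)) (subst (_≤ Z) (sym Y₁≡) (Y≤Z (r 8 + 1) i<)))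
      λ { (state r₂ _ _) ((keep₂ , refl , refl) , X₁≡′ , Y₁≡′) → third r₂ keep₂ (trans X₁≡′ X₁≡) (trans Y₁≡′ Y₁≡) }
      where
      at₁ : ∀ i → look (snap 12 r₁) i ≡ look (snap 12 r₀) i
      at₁ i = cong (λ l → look l i) keep₁
      d≡ : r₁ 11 + 1 ≡ r 8 + 1
      d≡ = cong (_+ 1) (at₁ 11)
      d< : r₁ 11 + 1 < r₁ 2
      d< = subst₂ _<_ (sym d≡) (sym (at₁ 2)) i<
      X₁≡ : literalX r₁ m (r₁ 11 + 1) ≡ literalX r m (r 8 + 1)
      X₁≡ = cong (λ l → literalX (look l) m (look l 11 + 1)) keep₁
      Y₁≡ : literalY r₁ m (r₁ 11 + 1) ≡ literalY r m (r 8 + 1)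
      Y₁≡ = cong (λ l → literalY (look l) m (look l 11 + 1)) keep₁
      third : ∀ r₂ →
        snap 12 r₂ ≡ snap 12 ((((r₁ [ 9 ↦ r₁ 14 ]) [ 10 ↦ r₁ 15 ])) [ 11 ↦ r₁ 11 + 1 ]) →
        r₂ 14 ≡ literalX r m (r 8 + 1) → r₂ 15 ≡ literalY r m (r 8 + 1) →
        Tri 14 _ (state r₂ m o) Post
      third r₂ keep₂ X₂≡ Y₂≡ =
        step (add≤κ (≤-trans (m≤m+n (r₂ 9) _) A≤) (≤-trans (m≤n+m (r₂ 15) _) A≤)) $
        step (add≤κ (≤-trans (m≤n+m (r₂ 10) _) B≤) (≤-trans (m≤m+n (r₂ 14) _) (≤-trans (≤-reflexive (+-comm (r₂ 14) (r₂ 10))) B≤′))) $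
        step (add≤κ A≤ B≤′) $
        branch (size≤κ (≤-trans (m∸n≤m _ (r₂ 10 + r₂ 14)) A≤))
          (λ nz → set true (subst₂ _≤_ Beq A≡ (<⇒≤ (m∸n≢0⇒n<m nz))))
          (λ z → set false (subst₂ _≤_ A≡ Beq (m∸n≡0⇒m≤n z)))
        where
        at₂ : ∀ i → look (snap 12 r₂) i ≡ look (snap 12 ((((r₁ [ 9 ↦ r₁ 14 ]) [ 10 ↦ r₁ 15 ])) [ 11 ↦ r₁ 11 + 1 ])) i
        at₂ i = cong (λ l → look l i) keep₂
        A≡ : r₂ 9 + r₂ 15 ≡ literalX r m (r 8) + literalY r m (r 8 + 1)
        A≡ = cong₂ _+_ (trans (at₂ 9) X₀≡) Y₂≡
        Beq : r₂ 10 + r₂ 14 ≡ literalX r m (r 8 + 1) + literalY r m (r 8)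
        Beq = trans (+-comm (r₂ 10) (r₂ 14)) (cong₂ _+_ X₂≡ (trans (at₂ 10) Y₀≡))
        A≤ : r₂ 9 + r₂ 15 ≤ Z
        A≤ = subst (_≤ Z) (sym A≡) (sums≤Z (r 8) (r 8 + 1) i<B i<)
        B≤′ : r₂ 10 + r₂ 14 ≤ Z
        B≤′ = subst (_≤ Z) (sym Beq) (sums≤Z (r 8 + 1) (r 8) i< i<B)
        B≤ : r₂ 14 + r₂ 10 ≤ Z
        B≤ = subst (_≤ Z) (+-comm (r₂ 10) (r₂ 14)) B≤′
        r₂8≡ : r₂ 8 ≡ r 8
        r₂8≡ = trans (at₂ 8) (at₁ 8)
        r₂11≡ : r₂ 11 ≡ r 8 + 1
        r₂11≡ = trans (at₂ 11) d≡
        set : ∀ b → GoodBit r m (r 8) b → Tri 10 (setColumn b)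
          (state (((r₂ [ 9 ↦ r₂ 9 + r₂ 15 ]) [ 10 ↦ r₂ 10 + r₂ 14 ]) [ 21 ↦ (r₂ 9 + r₂ 15) ∸ (r₂ 10 + r₂ 14) ]) m o) Post
        set b good = weaken ≤-refl
          (λ { s′ (keep , i≡ , mem≡ , out≡) →
            trans (cong (take 7) keep) (trans (cong (take 7) keep₂) (cong (take 7) keep₁)) ,
            trans (cong (λ l → look l 7) keep) (trans (at₂ 7) (at₁ 7)) ,
            trans i≡ (cong (_+ 2) r₂8≡) ,
            b , good , trans mem≡ (cong (λ i → settle m i b) r₂8≡) , out≡ })
          (setColumn-spec b _ (trans r₂11≡ (cong (_+ 1) (sym r₂8≡)))
            (≤-trans (≤-reflexive (cong (_* 3) r₂11≡)) (≤-trans (*-monoˡ-≤ 3 (<⇒≤ i<)) 3B≤H))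
            (≤-trans (≤-reflexive (trans (cong (_+ 2) r₂8≡) (trans (+-suc (r 8) 1) refl))) (≤-trans i< B≤H)))

-- Finite sums

sum-cong : ∀ {f g} n → (∀ i → i < n → f i ≡ g i) → sumBelow f n ≡ sumBelow g n
sum-cong zero    _  = refl
sum-cong (suc n) eq = cong₂ _+_ (eq n ≤-refl) (sum-cong n λ i i<n → eq i (m≤n⇒m≤1+n i<n))

sum-mono : ∀ {f g} n → (∀ i → i < n → f i ≤ g i) → sumBelow f n ≤ sumBelow g n
sum-mono zero    _  = z≤n
sum-mono (suc n) le = +-mono-≤ (le n ≤-refl) (sum-mono n λ i i<n → le i (m≤n⇒m≤1+n i<n))

sum-+ : ∀ f g n → sumBelow (λ i → f i + g i) n ≡ sumBelow f n + sumBelow g n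
sum-+ f g zero    = refl
sum-+ f g (suc n) = trans (cong (f n + g n +_) (sum-+ f g n)) (eq (f n) (g n) (sumBelow f n) (sumBelow g n))
  where
  eq : ∀ a b c d → a + b + (c + d) ≡ a + c + (b + d)
  eq = solve-∀

sum-* : ∀ a f n → sumBelow (λ i → a * f i) n ≡ a * sumBelow f n
sum-* a f zero    = sym (*-zeroʳ a)
sum-* a f (suc n) = trans (cong (a * f n +_) (sum-* a f n)) (sym (*-distribˡ-+ a (f n) (sumBelow f n)))

sum-const : ∀ a n → sumBelow (λ _ → a) n ≡ n * a
sum-const a zero    = refl
sum-const a (suc n) = cong (a +_) (sum-const a n)

term≤sum : ∀ f {i} n → i < n → f i ≤ sumBelow f n
term≤sum f {i} (suc n) i<1+n with i ≟ n
... | yes refl = m≤m+n (f n) (sumBelow f n)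
... | no  i≢n  = ≤-trans (term≤sum f n (≤∧≢⇒< (s≤s⁻¹ i<1+n) i≢n)) (m≤n+m (sumBelow f n) (f n))

sum-swap : ∀ (f : ℕ → ℕ → ℕ) m n →
  sumBelow (λ i → sumBelow (f i) n) m ≡ sumBelow (λ j → sumBelow (λ i → f i j) m) n
sum-swap f zero    n = sym (trans (sum-const 0 n) (*-zeroʳ n))
sum-swap f (suc m) n = trans (cong (sumBelow (f m) n +_) (sum-swap f m n))
  (sym (sum-+ (f m) (λ j → sumBelow (λ i → f i j) m) n))

sum-split : ∀ f a n → sumBelow f (a + n) ≡ sumBelow (λ l → f (n + l)) a + sumBelow f n
sum-split f zero    n = refl
sum-split f (suc a) n = trans (cong₂ _+_ (cong f (+-comm a n)) (sum-split f a n)) (sym (+-assoc (f (n + a)) _ _))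

-- Splits the index into quotient and remainder by a. With a power of B as a, this separates the
-- digits of a code above a position from those below it.
sum-block : ∀ f b a → sumBelow f (b * a) ≡ sumBelow (λ h → sumBelow (λ l → f (h * a + l)) a) b
sum-block f zero    a = refl
sum-block f (suc b) a = trans (sum-split f a (b * a)) (cong (sumBelow (λ l → f (b * a + l)) a +_) (sum-block f b a))

sum-head : ∀ f n → sumBelow f (suc n) ≡ f 0 + sumBelow (f ∘ suc) n
sum-head f zero    = refl
sum-head f (suc n) = trans (cong (f (suc n) +_) (sum-head f n)) (eq (f (suc n)) (f 0) (sumBelow (f ∘ suc) n))
  where
  eq : ∀ a b c → a + (b + c) ≡ b + (a + c)
  eq = solve-∀

indicator : ℕ → ℕ → ℕ
indicator a b = bit (a ≡ᵇ b)

≡ᵇ-refl : ∀ n → (n ≡ᵇ n) ≡ true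
≡ᵇ-refl zero    = refl
≡ᵇ-refl (suc n) = ≡ᵇ-refl n

≢⇒≡ᵇ : ∀ m n → m ≢ n → (m ≡ᵇ n) ≡ false
≢⇒≡ᵇ zero    zero    m≢n = contradiction refl m≢n
≢⇒≡ᵇ zero    (suc n) m≢n = refl
≢⇒≡ᵇ (suc m) zero    m≢n = refl
≢⇒≡ᵇ (suc m) (suc n) m≢n = ≢⇒≡ᵇ m n (m≢n ∘ cong suc)

indicator-refl : ∀ n → indicator n n ≡ 1
indicator-refl n = cong bit (≡ᵇ-refl n)

indicator-≢ : ∀ {m n} → m ≢ n → indicator m n ≡ 0
indicator-≢ {m} {n} m≢n = cong bit (≢⇒≡ᵇ m n m≢n)

sum-indicator-≥ : ∀ d (F : ℕ → ℕ) n → n ≤ d → sumBelow (λ i → indicator i d * F i) n ≡ 0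
sum-indicator-≥ d F zero    _   = refl
sum-indicator-≥ d F (suc n) n<d = trans
  (cong (λ b → b * F n + sumBelow (λ i → indicator i d * F i) n) (indicator-≢ (<⇒≢ n<d)))
  (sum-indicator-≥ d F n (<⇒≤ n<d))

sum-indicator : ∀ {d} (F : ℕ → ℕ) n → d < n → sumBelow (λ i → indicator i d * F i) n ≡ F d
sum-indicator {d} F (suc n) d<1+n with n ≟ d
... | yes refl = trans (cong₂ (λ b s → b * F n + s) (indicator-refl n) (sum-indicator-≥ n F n ≤-refl))
  (trans (+-identityʳ _) (+-identityʳ (F n)))
... | no  n≢d  = trans (cong (λ b → b * F n + sumBelow (λ i → indicator i d * F i) n) (indicator-≢ n≢d))
  (sum-indicator F n (≤∧≢⇒< (s≤s⁻¹ d<1+n) (n≢d ∘ sym)))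

[h*P+l]÷P : ∀ h {P l} → l < P → (h * P + l) ÷ P ≡ h
[h*P+l]÷P h {suc P} {l} l<P = trans (+-distrib-/-∣ˡ l (n∣m*n h))
  (trans (cong₂ _+_ (m*n/n≡m h (suc P)) (m<n⇒m/n≡0 l<P)) (+-identityʳ h))

digitOf[h*P+l] : ∀ h {P l} → l < P → digitOf P (h * P + l) ≡ l
digitOf[h*P+l] h {P} {l} l<P = trans (cong (λ q → h * P + l ∸ q * P) ([h*P+l]÷P h l<P)) (m+n∸m≡n (h * P) l)

÷-÷ : ∀ x {a b} → 1 ≤ a → 1 ≤ b → x ÷ (a * b) ≡ x ÷ a ÷ b
÷-÷ x {suc a} {suc b} _ _ = sym (m/n/o≡m/[n*o] x (suc a) (suc b))

÷1 : ∀ x → x ÷ 1 ≡ x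
÷1 = n/1≡n

countDigit : ℕ → ℕ → ℕ → ℕ → ℕ
countDigit B d zero    x = 0
countDigit B d (suc j) x = indicator (digitOf B x) d + countDigit B d j (x ÷ B)

countDigit-sum : ∀ {B} d j x → 1 ≤ B →
  sumBelow (λ i → indicator (digitOf B (x ÷ B ^ i)) d) j ≡ countDigit B d j x
countDigit-sum d zero x 1≤B = refl
countDigit-sum {B} d (suc j) x 1≤B = trans (sum-head (λ i → indicator (digitOf B (x ÷ B ^ i)) d) j)
  (cong₂ _+_ (cong (λ x → indicator (digitOf B x) d) (÷1 x))
    (trans (sum-cong j λ i _ → cong (λ x → indicator (digitOf B x) d) (÷-÷ x 1≤B (m^n>0 B {{>-nonZero 1≤B}} i)))
      (countDigit-sum d j (x ÷ B) 1≤B)))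

-- Cut a code at position j into upper part h, digit e and lower part l. `insertDigit` lets h and l
-- vary with e = d; inserting the indicator of e = d extends the sum to all e, and the three sums
-- merge into one over all codes.
positionSum-indicator : ∀ f {B k d j} → 1 ≤ B → d < B → j < k →
  positionSum f B (B ^ k) d (B ^ j) ≡ sumBelow (λ c → indicator (digitOf B (c ÷ B ^ j)) d * f c) (B ^ k)
positionSum-indicator f {B} {suc k} {d} {j} 1≤B d<B (s≤s j≤k) = begin
  sumBelow (λ y → f (insertDigit B P d y)) (B ^ suc k ÷ B)
    ≡⟨ cong (sumBelow (λ y → f (insertDigit B P d y))) (trans (pow÷ k 1≤B) (sym QP≡)) ⟩
  sumBelow (λ y → f (insertDigit B P d y)) (Q * P)
    ≡⟨ sum-block (λ y → f (insertDigit B P d y)) Q P ⟩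
  sumBelow (λ h → sumBelow (λ l → f (insertDigit B P d (h * P + l))) P) Q
    ≡⟨ sum-cong Q (λ h _ → sum-cong P λ l l<P → cong f (insert≡ h l l<P)) ⟩
  sumBelow (λ h → F h d) Q
    ≡⟨ sum-cong Q (λ h _ → sum-indicator (F h) B d<B) ⟨
  sumBelow (λ h → sumBelow (λ e → indicator e d * F h e) B) Q
    ≡⟨ sum-cong Q (λ h _ → sum-cong B λ e e<B → trans (cong (λ e′ → indicator e′ d * F h e) (sym (digitOf[h*P+l] h e<B)))
         (sym (sum-* (indicator (digitOf B (h * B + e)) d) (λ l → f ((h * B + e) * P + l)) P))) ⟩
  sumBelow (λ h → sumBelow (λ e → G (h * B + e)) B) Q
    ≡⟨ sum-block G Q B ⟨
  sumBelow G (Q * B)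
    ≡⟨ sum-cong (Q * B) (λ g _ → sum-cong P λ l l<P → cong (λ x → indicator (digitOf B x) d * f (g * P + l)) ([h*P+l]÷P g l<P)) ⟨
  sumBelow (λ g → sumBelow (λ l → indicator (digitOf B ((g * P + l) ÷ P)) d * f (g * P + l)) P) (Q * B)
    ≡⟨ sum-block (λ c → indicator (digitOf B (c ÷ P)) d * f c) (Q * B) P ⟨
  sumBelow (λ c → indicator (digitOf B (c ÷ P)) d * f c) (Q * B * P)
    ≡⟨ cong (sumBelow (λ c → indicator (digitOf B (c ÷ P)) d * f c)) (trans (eq Q B P) (cong (B *_) QP≡)) ⟩
  sumBelow (λ c → indicator (digitOf B (c ÷ P)) d * f c) (B ^ suc k) ∎
  where
  open ≡-Reasoning
  P = B ^ j
  Q = B ^ (k ∸ j)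
  F : ℕ → ℕ → ℕ
  F h e = sumBelow (λ l → f ((h * B + e) * P + l)) P
  G : ℕ → ℕ
  G g = sumBelow (λ l → indicator (digitOf B g) d * f (g * P + l)) P
  QP≡ : Q * P ≡ B ^ k
  QP≡ = trans (sym (^-distribˡ-+-* B (k ∸ j) j)) (cong (B ^_) (m∸n+n≡m j≤k))
  insert≡ : ∀ h l → l < P → insertDigit B P d (h * P + l) ≡ (h * B + d) * P + l
  insert≡ h l l<P = cong₂ (λ a b → (a * B + d) * P + b) ([h*P+l]÷P h l<P) (digitOf[h*P+l] h l<P)
  eq : ∀ q b p → q * b * p ≡ b * (q * p)
  eq = solve-∀

-- Exchanging the sums over positions and over codes counts, for each code, the positions that hold
-- d. For increasing columns this count is 0 or 1.
literalSum-count : ∀ f {B k d} → 1 ≤ B → d < B →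
  literalSum f B (B ^ k) k d ≡ sumBelow (λ c → countDigit B d k c * f c) (B ^ k)
literalSum-count f {B} {k} {d} 1≤B d<B = begin
  literalSum f B (B ^ k) k d
    ≡⟨ sum-cong k (λ j j<k → positionSum-indicator f 1≤B d<B j<k) ⟩
  sumBelow (λ j → sumBelow (λ c → indicator (digitOf B (c ÷ B ^ j)) d * f c) (B ^ k)) k
    ≡⟨ sum-swap (λ j c → indicator (digitOf B (c ÷ B ^ j)) d * f c) k (B ^ k) ⟩
  sumBelow (λ c → sumBelow (λ j → indicator (digitOf B (c ÷ B ^ j)) d * f c) k) (B ^ k)
    ≡⟨ sum-cong (B ^ k) (λ c _ → trans (sum-cong k λ j _ → *-comm (indicator (digitOf B (c ÷ B ^ j)) d) (f c))
         (trans (sum-* (f c) (λ j → indicator (digitOf B (c ÷ B ^ j)) d) k)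
         (trans (cong (f c *_) (countDigit-sum d k c 1≤B)) (*-comm (f c) _)))) ⟩
  sumBelow (λ c → countDigit B d k c * f c) (B ^ k) ∎
  where open ≡-Reasoning

-- Conditional expectations

-- Twice the probability of the literal when the row starts with the given bits and continues
-- uniformly: 1 for an open column, 2 or 0 for a decided one.
literalFactor : List Bool → ℕ → ℕ
literalFactor []      d             = 1
literalFactor (b ∷ x) zero          = settled (not b)
literalFactor (b ∷ x) (suc zero)    = settled b
literalFactor (b ∷ x) (suc (suc d)) = literalFactor x d

literal : ℕ → Bool → ℕ
literal i b = i * 2 + bit b

data LiteralOf (d : ℕ) : Set where
  literalOf : ∀ i b → d ≡ literal i b → LiteralOf d

toLiteral : ∀ d → LiteralOf d
toLiteral zero          = literalOf 0 false refl
toLiteral (suc zero)    = literalOf 0 true refl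
toLiteral (suc (suc d)) with toLiteral d
... | literalOf i b eq = literalOf (suc i) b (cong (suc ∘ suc) eq)

literal÷2 : ∀ i b → literal i b ÷ 2 ≡ i
literal÷2 i true  = [h*P+l]÷P i {2} {1} ≤-refl
literal÷2 i false = [h*P+l]÷P i {2} {0} (s≤s z≤n)

digitOf-literal : ∀ i b → digitOf 2 (literal i b) ≡ bit b
digitOf-literal i true  = digitOf[h*P+l] i {2} {1} ≤-refl
digitOf-literal i false = digitOf[h*P+l] i {2} {0} (s≤s z≤n)

literalFactor-unset : ∀ x {i} b → List.length x ≤ i → literalFactor x (literal i b) ≡ 1
literalFactor-unset []      b     _         = refl
literalFactor-unset (_ ∷ x) b     (s≤s len) = literalFactor-unset x b len

agrees : Bool → Bool → Bool
agrees true  b = b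
agrees false b = not b

literalFactor-new : ∀ x b σ → literalFactor (x ∷ʳ b) (literal (List.length x) σ) ≡ settled (agrees σ b)
literalFactor-new []      b true  = refl
literalFactor-new []      b false = refl
literalFactor-new (_ ∷ x) b σ     = literalFactor-new x b σ

literalFactor-old : ∀ x b {i} σ → i ≢ List.length x →
  literalFactor (x ∷ʳ b) (literal i σ) ≡ literalFactor x (literal i σ)
literalFactor-old []      b {zero}  σ     i≢ = contradiction refl i≢
literalFactor-old []      b {suc i} σ     i≢ = refl
literalFactor-old (_ ∷ x) b {zero}  true  i≢ = refl
literalFactor-old (_ ∷ x) b {zero}  false i≢ = refl
literalFactor-old (_ ∷ x) b {suc i} σ     i≢ = literalFactor-old x b σ (i≢ ∘ cong suc)

literal-injective : ∀ {i j b c} → literal i b ≡ literal j c → i ≡ j × bit b ≡ bit c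
literal-injective {i} {j} {b} {c} eq =
  trans (sym (literal÷2 i b)) (trans (cong (_÷ 2) eq) (literal÷2 j c)) ,
  trans (sym (digitOf-literal i b)) (trans (cong (digitOf 2) eq) (digitOf-literal j c))

-- 1 if the variables of the j lowest digits of x increase strictly, starting from p at least; otherwise 0.
increasing : ℕ → ℕ → ℕ → ℕ → ℕ
increasing B zero    p x = 1
increasing B (suc j) p x = (1 ∸ (p ∸ digitOf B x ÷ 2)) * increasing B j (suc (digitOf B x ÷ 2)) (x ÷ B)

increasing-suc : ∀ {B} j {p} x → increasing B (suc j) p x ≢ 0 →
  p ≤ digitOf B x ÷ 2 × increasing B j (suc (digitOf B x ÷ 2)) (x ÷ B) ≢ 0
increasing-suc {B} j {p} x nz with p ∸ digitOf B x ÷ 2 in eq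
... | zero  = m∸n≡0⇒m≤n eq , λ z → nz (trans (+-identityʳ _) z)
... | suc e = contradiction (cong (_* increasing B j (suc (digitOf B x ÷ 2)) (x ÷ B)) (0∸n≡0 e)) nz

module _ (B : ℕ) (x : List Bool) where
  private
    i = List.length x
    E = digitProduct (literalFactor x) B
    E⁺ : Bool → ℕ → ℕ → ℕ
    E⁺ b = digitProduct (literalFactor (x ∷ʳ b)) B
    occurrences : Bool → ℕ → ℕ → ℕ
    occurrences σ = countDigit B (literal i σ)

  -- All columns of c are at least p and hence come after column i, so the new bit changes none of
  -- its factors.
  untouched : ∀ b σ j {p} c → i < p → increasing B j p c ≢ 0 →
    occurrences σ j c ≡ 0 × E⁺ b j c ≡ E j c
  untouched b σ zero    c i<p nz = refl , refl
  untouched b σ (suc j) {p} c i<p nz with increasing-suc j c nz | toLiteral (digitOf B c)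
  ... | p≤ , nz′ | literalOf i′ σ′ eq =
    cong₂ _+_ (indicator-≢ λ d≡ → i′≢i (proj₁ (literal-injective {b = σ′} {σ} (trans (sym eq) d≡)))) (proj₁ rec) ,
    cong₂ _*_ (subst (λ d → literalFactor (x ∷ʳ b) d ≡ literalFactor x d) (sym eq) (literalFactor-old x b σ′ i′≢i)) (proj₂ rec)
    where
    i′≡ : digitOf B c ÷ 2 ≡ i′
    i′≡ = trans (cong (_÷ 2) eq) (literal÷2 i′ σ′)
    i<i′ : i < i′
    i<i′ = ≤-trans i<p (subst (p ≤_) i′≡ p≤)
    i′≢i : i′ ≢ i
    i′≢i e = <⇒≢ i<i′ (sym e)
    rec = untouched b σ j (c ÷ B) (s≤s (subst (i ≤_) (sym i′≡) (<⇒≤ i<i′))) nz′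

  -- Says, without subtraction, that E changes by (occurrences of the literal b - occurrences of the
  -- opposite literal) · E. Increasing columns contain column i at most once; an agreeing literal
  -- doubles E, an opposite one makes it 0, and otherwise nothing changes.
  set-column : ∀ b j {p} c → increasing B j p c ≢ 0 →
    E⁺ b j c + occurrences (not b) j c * E j c ≡ E j c + occurrences b j c * E j c
  set-column b zero    c nz = refl
  set-column b (suc j) {p} c nz with increasing-suc j c nz | toLiteral (digitOf B c)
  ... | p≤ , nz′ | literalOf i′ σ eq with i′ ≟ i
  ...   | no i′≢i = begin
    literalFactor (x ∷ʳ b) d * E⁺ b j c′ + (indicator d (literal i (not b)) + o̅) * (t * e)
      ≡⟨ cong₂ (λ u v → u * E⁺ b j c′ + (v + o̅) * (t * e)) same (absent (not b)) ⟩
    t * E⁺ b j c′ + o̅ * (t * e)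
      ≡⟨ eq₁ t (E⁺ b j c′) o̅ e ⟩
    t * (E⁺ b j c′ + o̅ * e)
      ≡⟨ cong (t *_) (set-column b j c′ nz′) ⟩
    t * (e + o * e)
      ≡⟨ eq₂ t e o ⟩
    t * e + (0 + o) * (t * e)
      ≡⟨ cong (λ v → t * e + (v + o) * (t * e)) (absent b) ⟨
    t * e + (indicator d (literal i b) + o) * (t * e) ∎
    where
    open ≡-Reasoning
    d = digitOf B c
    c′ = c ÷ B
    t = literalFactor x d
    e = E j c′
    o̅ = occurrences (not b) j c′
    o = occurrences b j c′
    same : literalFactor (x ∷ʳ b) d ≡ t
    same = subst (λ d → literalFactor (x ∷ʳ b) d ≡ literalFactor x d) (sym eq) (literalFactor-old x b σ i′≢i)
    absent : ∀ τ → indicator d (literal i τ) ≡ 0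
    absent τ = indicator-≢ λ d≡ → i′≢i (proj₁ (literal-injective {b = σ} {τ} (trans (sym eq) d≡)))
    eq₁ : ∀ t e⁺ o e → t * e⁺ + o * (t * e) ≡ t * (e⁺ + o * e)
    eq₁ = solve-∀
    eq₂ : ∀ t e o → t * (e + o * e) ≡ t * e + (0 + o) * (t * e)
    eq₂ = solve-∀
  ...   | yes refl = begin
    literalFactor (x ∷ʳ b) d * E⁺ b j c′ + (indicator d (literal i (not b)) + occurrences (not b) j c′) * (t * e)
      ≡⟨ cong₂ (λ u v → literalFactor (x ∷ʳ b) d * u + (indicator d (literal i (not b)) + v) * (t * e))
           (proj₂ (rest b)) (proj₁ (rest (not b))) ⟩
    literalFactor (x ∷ʳ b) d * e + (indicator d (literal i (not b)) + 0) * (t * e)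
      ≡⟨ here b σ eq ⟩
    t * e + (indicator d (literal i b) + 0) * (t * e)
      ≡⟨ cong (λ v → t * e + (indicator d (literal i b) + v) * (t * e)) (proj₁ (rest b)) ⟨
    t * e + (indicator d (literal i b) + occurrences b j c′) * (t * e) ∎
    where
    open ≡-Reasoning
    d = digitOf B c
    c′ = c ÷ B
    t = literalFactor x d
    e = E j c′
    rest : ∀ τ → occurrences τ j c′ ≡ 0 × E⁺ b j c′ ≡ e
    rest τ = untouched b τ j c′ (s≤s (≤-reflexive (sym (trans (cong (_÷ 2) eq) (literal÷2 i σ))))) nz′
    indicator-same : ∀ {σ τ} → bit σ ≢ bit τ → indicator (literal i σ) (literal i τ) ≡ 0
    indicator-same {σ} {τ} ne = indicator-≢ λ e → ne (proj₂ (literal-injective {i} {i} {σ} {τ} e))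
    double : ∀ e → 2 * e + (0 + 0) * (1 * e) ≡ 1 * e + (1 + 0) * (1 * e)
    double = solve-∀
    drop : ∀ e → 0 * e + (1 + 0) * (1 * e) ≡ 1 * e + (0 + 0) * (1 * e)
    drop = solve-∀
    values : ∀ {u v w z u′ v′ w′} → u ≡ u′ → v ≡ v′ → w ≡ w′ → z ≡ 1 →
      u′ * e + (v′ + 0) * (1 * e) ≡ 1 * e + (w′ + 0) * (1 * e) →
      u * e + (v + 0) * (z * e) ≡ z * e + (w + 0) * (z * e)
    values refl refl refl refl eq = eq
    here : ∀ b σ → d ≡ literal i σ →
      literalFactor (x ∷ʳ b) d * e + (indicator d (literal i (not b)) + 0) * (t * e) ≡
      t * e + (indicator d (literal i b) + 0) * (t * e)
    here b σ eq rewrite eq with b | σ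
    ... | true  | true  = values (literalFactor-new x true true) (indicator-same {true} {false} λ ())
      (indicator-refl (literal i true)) (literalFactor-unset x true ≤-refl) (double e)
    ... | true  | false = values (literalFactor-new x true false) (indicator-refl (literal i false))
      (indicator-same {false} {true} λ ()) (literalFactor-unset x false ≤-refl) (drop e)
    ... | false | true  = values (literalFactor-new x false true) (indicator-refl (literal i true))
      (indicator-same {true} {false} λ ()) (literalFactor-unset x true ≤-refl) (drop e)
    ... | false | false = values (literalFactor-new x false false) (indicator-same {false} {true} λ ())
      (indicator-refl (literal i false)) (literalFactor-unset x false ≤-refl) (double e)

satisfaction : ℕ → ℕ → List Bool → ℕ → ℕ
satisfaction B k x = digitProduct (literalFactor x) B k

expected : ℕ → ℕ → List Bool → (ℕ → ℕ) → ℕ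
expected B k x W = sumBelow (λ c → satisfaction B k x c * W c) (B ^ k)

-- M times the conditional expectation of the next total weight is M (ΣU + ΣV) + (expected x U − ΣU) − (expected x V − ΣV).
Balanced : ℕ → ℕ → (ℕ → ℕ) → (ℕ → ℕ) → List Bool → Set
Balanced B k U V x = expected B k x U + sumBelow V (B ^ k) ≤ sumBelow U (B ^ k) + expected B k x V

literalWeight : ℕ → ℕ → List Bool → (ℕ → ℕ) → Bool → ℕ
literalWeight B k x W σ = literalSum (λ c → satisfaction B k x c * W c) B (B ^ k) k (literal (List.length x) σ)

-- Codes whose columns do not increase stand for no clause. Giving them weight 0 is simpler than
-- skipping them, and `set-column` is needed for the other codes only.
Supported : ℕ → ℕ → (ℕ → ℕ) → Set
Supported B k W = ∀ c → W c ≡ 0 ⊎ increasing B k 0 c ≢ 0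

module _ {B k : ℕ} (1≤B : 1 ≤ B) where
  private
    N = B ^ k
    E : List Bool → ℕ → ℕ
    E = satisfaction B k

  balanced-[] : ∀ U V → Balanced B k U V []
  balanced-[] U V = ≤-reflexive (cong₂ _+_ (sum-cong N λ c _ → one U c) (sym (sum-cong N λ c _ → one V c)))
    where
    prod : ∀ j c → digitProduct (literalFactor []) B j c ≡ 1
    prod zero    c = refl
    prod (suc j) c = trans (+-identityʳ _) (prod j (c ÷ B))
    one : ∀ (W : ℕ → ℕ) c → E [] c * W c ≡ W c
    one W c = trans (cong (_* W c) (prod k c)) (+-identityʳ (W c))

  -- The weighted sum of `set-column` over all codes; `literalSum-count` turns the occurrences into
  -- the sums that the program computes.
  expected-∷ʳ : ∀ x b {W} → Supported B k W → literal (List.length x) true < B →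
    expected B k (x ∷ʳ b) W + literalWeight B k x W (not b) ≡ expected B k x W + literalWeight B k x W b
  expected-∷ʳ x b {W} supp i<B = begin
    expected B k (x ∷ʳ b) W + literalWeight B k x W (not b)
      ≡⟨ cong (expected B k (x ∷ʳ b) W +_) (literalSum-count f {k = k} 1≤B (lit< (not b))) ⟩
    expected B k (x ∷ʳ b) W + sumBelow (λ c → o (not b) c * f c) N
      ≡⟨ sum-+ (λ c → E (x ∷ʳ b) c * W c) (λ c → o (not b) c * f c) N ⟨
    sumBelow (λ c → E (x ∷ʳ b) c * W c + o (not b) c * f c) N
      ≡⟨ sum-cong N (λ c _ → pointwise c) ⟩
    sumBelow (λ c → E x c * W c + o b c * f c) N
      ≡⟨ sum-+ (λ c → E x c * W c) (λ c → o b c * f c) N ⟩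
    expected B k x W + sumBelow (λ c → o b c * f c) N
      ≡⟨ cong (expected B k x W +_) (literalSum-count f {k = k} 1≤B (lit< b)) ⟨
    expected B k x W + literalWeight B k x W b ∎
    where
    open ≡-Reasoning
    f : ℕ → ℕ
    f c = E x c * W c
    o : Bool → ℕ → ℕ
    o σ = countDigit B (literal (List.length x) σ) k
    lit< : ∀ σ → literal (List.length x) σ < B
    lit< true  = i<B
    lit< false = ≤-trans (s≤s (+-monoʳ-≤ (List.length x * 2) z≤n)) i<B
    eq : ∀ e o e₀ w → e * w + o * (e₀ * w) ≡ (e + o * e₀) * w
    eq = solve-∀
    pointwise : ∀ c → E (x ∷ʳ b) c * W c + o (not b) c * f c ≡ E x c * W c + o b c * f c
    pointwise c = trans (eq (E (x ∷ʳ b) c) (o (not b) c) (E x c) (W c))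
      (trans (cases (supp c)) (sym (eq (E x c) (o b c) (E x c) (W c))))
      where
      cases : W c ≡ 0 ⊎ increasing B k 0 c ≢ 0 →
        (E (x ∷ʳ b) c + o (not b) c * E x c) * W c ≡ (E x c + o b c * E x c) * W c
      cases (inj₁ z)  = trans (cong (a *_) z) (trans (*-zeroʳ a) (sym (trans (cong (a′ *_) z) (*-zeroʳ a′))))
        where
        a = E (x ∷ʳ b) c + o (not b) c * E x c
        a′ = E x c + o b c * E x c
      cases (inj₂ nz) = cong (_* W c) (set-column B x b k c nz)

  -- By `expected-∷ʳ` the new bit changes the difference of the two sides by X_b - X_¬b - (Y_b -
  -- Y_¬b), which the choice of b makes nonpositive.
  balanced-∷ʳ : ∀ {U V} x b → Supported B k U → Supported B k V → literal (List.length x) true < B →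
    literalWeight B k x U b + literalWeight B k x V (not b) ≤ literalWeight B k x U (not b) + literalWeight B k x V b →
    Balanced B k U V x → Balanced B k U V (x ∷ʳ b)
  balanced-∷ʳ {U} {V} x b U-supp V-supp i<B good bal = +-cancelʳ-≤ (Xn + Yb) _ _ (begin
    expected B k (x ∷ʳ b) U + sumBelow V N + (Xn + Yb)   ≡⟨ eq (expected B k (x ∷ʳ b) U) (sumBelow V N) Xn Yb ⟩
    expected B k (x ∷ʳ b) U + Xn + (sumBelow V N + Yb)   ≡⟨ cong (_+ (sumBelow V N + Yb)) (expected-∷ʳ x b U-supp i<B) ⟩
    expected B k x U + Xb + (sumBelow V N + Yb)          ≡⟨ eq (expected B k x U) Xb (sumBelow V N) Yb ⟩
    expected B k x U + sumBelow V N + (Xb + Yb)          ≤⟨ +-monoˡ-≤ (Xb + Yb) bal ⟩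
    sumBelow U N + expected B k x V + (Xb + Yb)          ≡⟨ eq (sumBelow U N) (expected B k x V) Xb Yb ⟩
    sumBelow U N + Xb + (expected B k x V + Yb)          ≡⟨ cong (sumBelow U N + Xb +_) (expected-∷ʳ x b V-supp i<B) ⟨
    sumBelow U N + Xb + (expected B k (x ∷ʳ b) V + Yn)   ≡⟨ eq (sumBelow U N) Xb (expected B k (x ∷ʳ b) V) Yn ⟩
    sumBelow U N + expected B k (x ∷ʳ b) V + (Xb + Yn)   ≤⟨ +-monoʳ-≤ (sumBelow U N + expected B k (x ∷ʳ b) V) good ⟩
    sumBelow U N + expected B k (x ∷ʳ b) V + (Xn + Yb)   ∎)
    where
    open ≤-Reasoning
    Xb = literalWeight B k x U b
    Xn = literalWeight B k x U (not b)
    Yb = literalWeight B k x V b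
    Yn = literalWeight B k x V (not b)
    eq : ∀ a b c d → a + b + (c + d) ≡ a + c + (b + d)
    eq = solve-∀

  -- Here `suc M` is the growth factor per row. Expanded, the left side exceeds the right by
  -- (expected U - ΣU) - (expected V - ΣV), and this is what `Balanced` bounds by 0. The bound on E
  -- makes the truncated subtraction exact.
  total-step : ∀ {U V} x M → (∀ c → c < N → E x c ≤ suc (suc M)) → Balanced B k U V x →
    sumBelow (λ c → (M + E x c) * U c) N + sumBelow (λ c → (suc (suc M) ∸ E x c) * V c) N
      ≤ suc M * (sumBelow U N + sumBelow V N)
  total-step {U} {V} x M E≤ bal = +-cancelʳ-≤ (expected B k x V) _ _ (begin
    A + A′ + expected B k x V
      ≡⟨ +-assoc A A′ (expected B k x V) ⟩
    A + (A′ + expected B k x V)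
      ≡⟨ cong₂ _+_ (trans (sum-cong N λ c _ → *-distribʳ-+ (U c) M (E x c))
                      (trans (sum-+ (λ c → M * U c) (λ c → E x c * U c) N) (cong (_+ expected B k x U) (sum-* M U N))))
           (trans (sym (sum-+ (λ c → (suc (suc M) ∸ E x c) * V c) (λ c → E x c * V c) N))
             (trans (sum-cong N (λ c c<N → trans (sym (*-distribʳ-+ (V c) (suc (suc M) ∸ E x c) (E x c)))
               (cong (_* V c) (m∸n+n≡m (E≤ c c<N))))) (sum-* (suc (suc M)) V N))) ⟩
    M * ΣU + expected B k x U + suc (suc M) * ΣV
      ≡⟨ eq M ΣU (expected B k x U) ΣV ⟩
    M * ΣU + suc M * ΣV + (expected B k x U + ΣV)
      ≤⟨ +-monoʳ-≤ (M * ΣU + suc M * ΣV) bal ⟩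
    M * ΣU + suc M * ΣV + (ΣU + expected B k x V)
      ≡⟨ eq₂ M ΣU ΣV (expected B k x V) ⟩
    suc M * (ΣU + ΣV) + expected B k x V ∎)
    where
    open ≤-Reasoning
    A = sumBelow (λ c → (M + E x c) * U c) N
    A′ = sumBelow (λ c → (suc (suc M) ∸ E x c) * V c) N
    ΣU = sumBelow U N
    ΣV = sumBelow V N
    eq : ∀ m u e v → m * u + e + (2 + m) * v ≡ m * u + (1 + m) * v + (e + v)
    eq = solve-∀
    eq₂ : ∀ m u v e → m * u + (1 + m) * v + (u + e) ≡ (1 + m) * (u + v) + e
    eq₂ = solve-∀

-- Estimates for products and sums, and the layout of the memory

digitProduct-≤ : ∀ {T B} → 1 ≤ B → (∀ d → d < B → T d ≤ 2) → ∀ j x → digitProduct T B j x ≤ 2 ^ j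
digitProduct-≤ 1≤B T≤2 zero    x = ≤-refl
digitProduct-≤ {T} {B} 1≤B T≤2 (suc j) x = *-mono-≤ (T≤2 _ (digitOf< x 1≤B)) (digitProduct-≤ 1≤B T≤2 j (x ÷ B))

digitProduct-cong : ∀ {T T′ B} → 1 ≤ B → (∀ d → d < B → T d ≡ T′ d) → ∀ j x → digitProduct T B j x ≡ digitProduct T′ B j x
digitProduct-cong 1≤B eq zero    x = refl
digitProduct-cong {B = B} 1≤B eq (suc j) x = cong₂ _*_ (eq _ (digitOf< x 1≤B)) (digitProduct-cong 1≤B eq j (x ÷ B))

literalSum-cong : ∀ {f g B k d} → 1 ≤ B → d < B → (∀ c → c < B ^ k → f c ≡ g c) →
  literalSum f B (B ^ k) k d ≡ literalSum g B (B ^ k) k d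
literalSum-cong {B = B} {k} {d} 1≤B d<B eq = sum-cong k λ j j<k → sum-cong (B ^ k ÷ B) λ y y< →
  eq _ (insertDigit-< 1≤B j<k d<B y<)

literalSum-≤ : ∀ {f B k d b} → 1 ≤ B → d < B → (∀ c → c < B ^ k → f c ≤ b) →
  literalSum f B (B ^ k) k d ≤ k * (B ^ k * b)
literalSum-≤ {f} {B} {k} {d} {b} 1≤B d<B f≤b = ≤-trans
  (sum-mono k λ j j<k → ≤-trans (sum-mono (B ^ k ÷ B) λ y y< → f≤b _ (insertDigit-< 1≤B j<k d<B y<))
    (≤-trans (≤-reflexive (sum-const b (B ^ k ÷ B))) (*-monoˡ-≤ b (÷≤ (B ^ k) B))))
  (≤-reflexive (sum-const (B ^ k * b) k))

update-≡ : ∀ m a {v} → (m [ a ↦ v ]) a ≡ v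
update-≡ m a {v} = cong (λ b → if b then v else m a) (≡ᵇ-refl a)

update-≢ : ∀ m {a x v} → x ≢ a → (m [ a ↦ v ]) x ≡ m x
update-≢ m {a} {x} {v} x≢a = cong (λ b → if b then v else m x) (≢⇒≡ᵇ x a x≢a)

*3-injective : ∀ {c d} → c * 3 ≡ d * 3 → c ≡ d
*3-injective {c} {d} = *-cancelʳ-≡ c d 3

-- The residues modulo 3 keep the factors and the two kinds of weights in disjoint cells.
slot01 : ∀ d c → d * 3 ≢ c * 3 + 1
slot01 zero    zero    ()
slot01 zero    (suc c) ()
slot01 (suc d) zero    ()
slot01 (suc d) (suc c) eq = slot01 d c (suc-injective (suc-injective (suc-injective eq)))

slot02 : ∀ d c → d * 3 ≢ c * 3 + 1 + 1
slot02 zero    zero    ()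
slot02 zero    (suc c) ()
slot02 (suc d) zero    ()
slot02 (suc d) (suc c) eq = slot02 d c (suc-injective (suc-injective (suc-injective eq)))

slot12 : ∀ d c → d * 3 + 1 ≢ c * 3 + 1 + 1
slot12 d c eq = slot01 d c (+-cancelʳ-≡ 1 (d * 3) (c * 3 + 1) eq)

slot11 : ∀ {c d} → c * 3 + 1 ≡ d * 3 + 1 → c ≡ d
slot11 {c} {d} eq = *3-injective (+-cancelʳ-≡ 1 (c * 3) (d * 3) eq)

slot22 : ∀ {c d} → c * 3 + 1 + 1 ≡ d * 3 + 1 + 1 → c ≡ d
slot22 {c} {d} eq = slot11 (+-cancelʳ-≡ 1 (c * 3 + 1) (d * 3 + 1) eq)

putWeights : (ℕ → ℕ) → ℕ → ℕ → ℕ → ℕ → ℕ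
putWeights m c u v = (m [ c * 3 + 1 ↦ u ]) [ c * 3 + 1 + 1 ↦ v ]

module _ (m : ℕ → ℕ) (c u v : ℕ) where
  private
    m₁ = m [ c * 3 + 1 ↦ u ]

  putWeights-factor : ∀ d → factorAt (putWeights m c u v) d ≡ factorAt m d
  putWeights-factor d = trans (update-≢ m₁ (slot02 d c)) (update-≢ m (slot01 d c))

  putWeights-upper : upperWeight (putWeights m c u v) c ≡ u
  putWeights-upper = trans (update-≢ m₁ (slot12 c c)) (update-≡ m (c * 3 + 1))

  putWeights-lower : lowerWeight (putWeights m c u v) c ≡ v
  putWeights-lower = update-≡ m₁ (c * 3 + 1 + 1)

  putWeights-upper-≢ : ∀ {d} → d ≢ c → upperWeight (putWeights m c u v) d ≡ upperWeight m d
  putWeights-upper-≢ {d} d≢c = trans (update-≢ m₁ (slot12 d c)) (update-≢ m (d≢c ∘ slot11))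

  putWeights-lower-≢ : ∀ {d} → d ≢ c → lowerWeight (putWeights m c u v) d ≡ lowerWeight m d
  putWeights-lower-≢ {d} d≢c = trans (update-≢ m₁ (d≢c ∘ slot22)) (update-≢ m (slot12 c d ∘ sym))

module _ (m : ℕ → ℕ) (i : ℕ) (b : Bool) where
  private
    m₁ = m [ i * 2 * 3 ↦ settled (not b) ]

  settle-upper : ∀ c → upperWeight (settle m (i * 2) b) c ≡ upperWeight m c
  settle-upper c = trans (update-≢ m₁ (slot01 (i * 2 + 1) c ∘ sym)) (update-≢ m (slot01 (i * 2) c ∘ sym))

  settle-lower : ∀ c → lowerWeight (settle m (i * 2) b) c ≡ lowerWeight m c
  settle-lower c = trans (update-≢ m₁ (slot02 (i * 2 + 1) c ∘ sym)) (update-≢ m (slot02 (i * 2) c ∘ sym))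

  settle-new : ∀ σ → factorAt (settle m (i * 2) b) (literal i σ) ≡ settled (agrees σ b)
  settle-new true  = update-≡ m₁ ((i * 2 + 1) * 3)
  settle-new false = trans (update-≢ m₁ λ eq → literal-false≢true (*3-injective eq))
    (trans (cong (λ d → m₁ (d * 3)) (+-identityʳ (i * 2))) (update-≡ m (i * 2 * 3)))
    where
    literal-false≢true : literal i false ≢ literal i true
    literal-false≢true eq = contradiction (proj₂ (literal-injective {i} {i} {false} {true} eq)) λ ()

  settle-old : ∀ {j} σ → j ≢ i → factorAt (settle m (i * 2) b) (literal j σ) ≡ factorAt m (literal j σ)
  settle-old {j} σ j≢i = trans (update-≢ m₁ λ eq → j≢i (proj₁ (literal-injective {b = σ} {true} (*3-injective eq))))
    (update-≢ m λ eq → j≢i (proj₁ (literal-injective {b = σ} {false} (trans (*3-injective eq) (sym (+-identityʳ (i * 2)))))))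

settle-literalFactor : ∀ {m B} x b → (∀ d → d < B → factorAt m d ≡ literalFactor x d) →
  ∀ d → d < B → factorAt (settle m (List.length x * 2) b) d ≡ literalFactor (x ∷ʳ b) d
settle-literalFactor {m} x b agree d d<B with toLiteral d
... | literalOf j σ refl with j ≟ List.length x
...   | yes refl = trans (settle-new m (List.length x) b σ) (sym (literalFactor-new x b σ))
...   | no  j≢   = trans (settle-old m (List.length x) b σ j≢) (trans (agree d d<B) (sym (literalFactor-old x b σ j≢)))

literalFactor≤2 : ∀ x d → literalFactor x d ≤ 2
literalFactor≤2 []      d             = s≤s z≤n
literalFactor≤2 (b ∷ x) zero          = bound (not b)
  where
  bound : ∀ b → settled b ≤ 2
  bound true  = ≤-refl
  bound false = z≤n
literalFactor≤2 (true  ∷ x) (suc zero) = ≤-refl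
literalFactor≤2 (false ∷ x) (suc zero) = z≤n
literalFactor≤2 (b ∷ x) (suc (suc d)) = literalFactor≤2 x d

-- One row: resetting the factors, choosing the bits, updating the weights

resetBody weightBody row : Program
resetBody =
  instr (const 21 1) ⨾
  instr (arith sub 16 16 21) ⨾
  instr (const 22 3) ⨾
  instr (arith mul 22 16 22) ⨾
  instr (store 22 21)
weightBody =
  instr (const 21 1) ⨾
  instr (arith sub 16 16 21) ⨾
  instr (const 17 0) ⨾
  instr (arith add 17 17 16) ⨾
  decode ⨾
  instr (const 22 3) ⨾
  instr (arith mul 21 17 22) ⨾
  instr (const 22 1) ⨾
  instr (arith add 21 21 22) ⨾
  instr (load 23 21) ⨾
  instr (arith add 19 4 20) ⨾
  instr (arith mul 23 19 23) ⨾
  instr (store 21 23) ⨾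
  instr (arith add 21 21 22) ⨾
  instr (load 23 21) ⨾
  instr (arith sub 19 5 20) ⨾
  instr (arith mul 23 19 23) ⨾
  instr (store 21 23)
row =
  instr (const 16 0) ⨾
  instr (arith add 16 16 2) ⨾
  (whileNonZero 16 loop resetBody) ⨾
  instr (const 7 0) ⨾
  instr (arith add 7 7 0) ⨾
  instr (const 8 0) ⨾
  (whileNonZero 7 loop columnBody) ⨾
  instr (const 16 0) ⨾
  instr (arith add 16 16 3) ⨾
  (whileNonZero 16 loop weightBody)

module Rows (ε : Real01) (H Z : ℕ) (3≤H : 3 ≤ H) (H≤Z : H ≤ Z) where
  open Column ε H Z 3≤H H≤Z public

  ResetInv : List ℕ → (ℕ → ℕ) → List Bool → ℕ → State → Set
  ResetInv g m₀ o y s =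
    snap 16 (reg s) ≡ g × output s ≡ o × reg s 16 ≡ y × reg s 16 ≤ H × y ≤ look g 2 ×
    (∀ c → upperWeight (mem s) c ≡ upperWeight m₀ c) ×
    (∀ c → lowerWeight (mem s) c ≡ lowerWeight m₀ c) ×
    (∀ d → y ≤ d → d < look g 2 → factorAt (mem s) d ≡ 1)

  resetBody-spec : ∀ g m₀ o → look g 2 * 3 ≤ H → ∀ y s → ResetInv g m₀ o (suc y) s →
    Tri 5 resetBody s (ResetInv g m₀ o y)
  resetBody-spec g m₀ o 3B≤H y (state r m _) (refl , refl , y≡ , y≤ , y<B , U≡ , V≡ , T≡) =
    step (size≤κ 1≤Z) $
    step (add≤κ (small y≤) 1≤Z) $
    step (size≤κ 3≤Z) $
    step (mul≤κ y′≤ 3≤Z) $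
    last (add≤κ (small 3y≤) 1≤Z)
      ( refl , refl , y′≡ , y′≤ , <⇒≤ y<B
      , (λ c → trans (update-≢ m (slot01 (r 16 ∸ 1) c ∘ sym)) (U≡ c))
      , (λ c → trans (update-≢ m (slot02 (r 16 ∸ 1) c ∘ sym)) (V≡ c))
      , T≡′ )
    where
    y′≡ : r 16 ∸ 1 ≡ y
    y′≡ = cong (_∸ 1) y≡
    y′≤ : r 16 ∸ 1 ≤ H
    y′≤ = ≤-trans (m∸n≤m (r 16) 1) y≤
    3y≤ : (r 16 ∸ 1) * 3 ≤ H
    3y≤ = ≤-trans (*-monoˡ-≤ 3 (≤-trans (≤-reflexive y′≡) (<⇒≤ y<B))) 3B≤H
    T≡′ : ∀ d → y ≤ d → d < r 2 → factorAt (m [ (r 16 ∸ 1) * 3 ↦ 1 ]) d ≡ 1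
    T≡′ d y≤d d<B with d ≟ r 16 ∸ 1
    ... | yes refl = update-≡ m ((r 16 ∸ 1) * 3)
    ... | no  d≢   = trans (update-≢ m (d≢ ∘ *3-injective))
      (T≡ d (≤∧≢⇒< y≤d (λ y≡d → d≢ (trans (sym y≡d) (sym y′≡)))) d<B)

  WeightInv : List ℕ → (ℕ → ℕ) → List Bool → ℕ → State → Set
  WeightInv g m₀ o y s =
    snap 16 (reg s) ≡ g × output s ≡ o × reg s 16 ≡ y × reg s 16 ≤ H × y ≤ look g 3 ×
    (∀ d → factorAt (mem s) d ≡ factorAt m₀ d) ×
    (∀ c → c < y → upperWeight (mem s) c ≡ upperWeight m₀ c) ×
    (∀ c → c < y → lowerWeight (mem s) c ≡ lowerWeight m₀ c) ×
    (∀ c → y ≤ c → c < look g 3 → upperWeight (mem s) c ≡ (look g 4 + E c) * upperWeight m₀ c) ×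
    (∀ c → y ≤ c → c < look g 3 → lowerWeight (mem s) c ≡ (look g 5 ∸ E c) * lowerWeight m₀ c)
    where
    E = digitProduct (factorAt m₀) (look g 2) (look g 1)

  weightBody-spec : ∀ g m₀ o → Env (look g 1) (look g 2) (look g 3) m₀ →
    look g 4 + 2 ^ look g 1 ≤ H → look g 5 ≤ H →
    (∀ c → c < look g 3 → (look g 4 + 2 ^ look g 1) * upperWeight m₀ c ≤ Z) →
    (∀ c → c < look g 3 → look g 5 * lowerWeight m₀ c ≤ Z) →
    ∀ y s → WeightInv g m₀ o (suc y) s → Tri (35 * look g 1) weightBody s (WeightInv g m₀ o y)
  weightBody-spec g m₀ o env M≤H M⁺≤H U≤ V≤ y (state r m _) (refl , refl , y≡ , y≤ , y<N , T≡ , U< , V< , U≥ , V≥) =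
    weaken (≤-trans (≤-reflexive (eq₁ (r 1))) (absorb 17 18 1≤k)) (λ _ post → post) $
    step (size≤κ 1≤Z) $
    step (add≤κ (small y≤) 1≤Z) $
    step (size≤κ 0≤Z) $
    step (add≤κ 0≤Z (small y′≤)) $
    bind (decode-spec _ 1≤k 1≤B 3B≤H k≤H 2^k≤ y′≤ (λ d d<B → ≤-trans (≤-reflexive (T≡ d)) (T≤2 d d<B)))
    λ { (state r′ _ _) ((keep , refl , refl) , E≤H , E≡) → after r′ keep E≤H E≡ }
    where
    open Env env
    eq₁ : ∀ k → 4 + (18 * k + 13) ≡ 17 + 18 * k
    eq₁ = solve-∀
    y′≡ : r 16 ∸ 1 ≡ y
    y′≡ = cong (_∸ 1) y≡
    y′≤ : r 16 ∸ 1 ≤ H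
    y′≤ = ≤-trans (m∸n≤m (r 16) 1) y≤
    E = digitProduct (factorAt m₀) (r 2) (r 1)
    r₀ = ((r [ 21 ↦ 1 ]) [ 16 ↦ r 16 ∸ 1 ]) [ 17 ↦ r 16 ∸ 1 ]
    after : ∀ r′ → snap 18 r′ ≡ snap 18 r₀ → r′ 20 ≤ H → r′ 20 ≡ digitProduct (factorAt m) (r 2) (r 1) (r 16 ∸ 1) →
      Tri 13 _ (state r′ m o) (WeightInv (snap 16 r) m₀ o y)
    after r′ keep E≤H E≡ =
      step (size≤κ 3≤Z) $
      step (mul≤κ c≤H 3≤Z) $
      step (size≤κ 1≤Z) $
      step (add≤κ (small 3c≤H) 1≤Z) $
      step (add≤κ (small 3c1≤H) U≤Z′) $
      step (add≤κ (small (≤-trans (m≤m+n (r′ 4) (r′ 20)) f≤H)) (small E≤H)) $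
      step (mul≤κ f≤H U≤Z′) $
      step (add≤κ (small 3c1≤H) fU≤Z) $
      step (add≤κ (small 3c1≤H) 1≤Z) $
      step (add≤κ (small 3c2≤H) V₁≤Z) $
      step (add≤κ (small M⁺≤) (small E≤H)) $
      step (mul≤κ f⁻≤H V₁≤Z) $
      last (add≤κ (small 3c2≤H) gV≤Z)
        ( cong (take 16) keep , refl , trans (at 16) y′≡ , subst (_≤ H) (sym (at 16)) y′≤ , <⇒≤ y<N
        , (λ d → trans (putWeights-factor m c _ _ d) (T≡ d))
        , (λ d d<y → trans (putWeights-upper-≢ m c _ _ (<y⇒≢c d<y)) (U< d (m≤n⇒m≤1+n d<y)))
        , (λ d d<y → trans (putWeights-lower-≢ m c _ _ (<y⇒≢c d<y)) (V< d (m≤n⇒m≤1+n d<y)))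
        , upper , lower )
      where
      at : ∀ i → look (snap 18 r′) i ≡ look (snap 18 r₀) i
      at i = cong (λ l → look l i) keep
      c = r′ 17
      c≡ : c ≡ y
      c≡ = trans (at 17) y′≡
      c<N : c < r 3
      c<N = subst (_< r 3) (sym c≡) y<N
      c≤H : c ≤ H
      c≤H = ≤-trans (<⇒≤ c<N) N≤H
      3c2≤H = c3≤ c<N
      3c1≤H = ≤-trans (m≤m+n (c * 3 + 1) 1) 3c2≤H
      3c≤H = ≤-trans (m≤m+n (c * 3) 1) 3c1≤H
      c<1+y : c < suc y
      c<1+y = s≤s (≤-reflexive c≡)
      -- The lower weight is loaded after the new upper weight has been stored, whence this
      -- intermediate memory.
      m₁ = m [ c * 3 + 1 ↦ (r′ 4 + r′ 20) * upperWeight m c ]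
      E≡′ : r′ 20 ≡ E c
      E≡′ = trans E≡ (trans (digitProduct-cong 1≤B (λ d _ → T≡ d) (r 1) (r 16 ∸ 1)) (cong E (trans y′≡ (sym c≡))))
      E≤ : r′ 20 ≤ 2 ^ r 1
      E≤ = subst (_≤ 2 ^ r 1) (sym E≡′) (digitProduct-≤ 1≤B T≤2 (r 1) c)
      f≤ : r′ 4 + r′ 20 ≤ r 4 + 2 ^ r 1
      f≤ = +-mono-≤ (≤-reflexive (at 4)) E≤
      f≤H : r′ 4 + r′ 20 ≤ H
      f≤H = ≤-trans f≤ M≤H
      M⁺≤ : r′ 5 ≤ H
      M⁺≤ = subst (_≤ H) (sym (at 5)) M⁺≤H
      f⁻≤H : r′ 5 ∸ r′ 20 ≤ H
      f⁻≤H = ≤-trans (m∸n≤m (r′ 5) (r′ 20)) M⁺≤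
      Ueq : upperWeight m c ≡ upperWeight m₀ c
      Ueq = U< c c<1+y
      Veq : lowerWeight m₁ c ≡ lowerWeight m₀ c
      Veq = trans (update-≢ m (slot12 c c ∘ sym)) (V< c c<1+y)
      U≤Z′ : upperWeight m c ≤ Z
      U≤Z′ = subst (_≤ Z) (sym Ueq) (U≤Z c c<N)
      V₁≤Z : lowerWeight m₁ c ≤ Z
      V₁≤Z = subst (_≤ Z) (sym Veq) (V≤Z c c<N)
      fU≤Z : (r′ 4 + r′ 20) * upperWeight m c ≤ Z
      fU≤Z = ≤-trans (*-mono-≤ f≤ (≤-reflexive Ueq)) (U≤ c c<N)
      gV≤Z : (r′ 5 ∸ r′ 20) * lowerWeight m₁ c ≤ Z
      gV≤Z = ≤-trans (*-mono-≤ (≤-trans (m∸n≤m (r′ 5) (r′ 20)) (≤-reflexive (at 5))) (≤-reflexive Veq)) (V≤ c c<N)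
      <y⇒≢c : ∀ {d} → d < y → d ≢ c
      <y⇒≢c d<y refl = <⇒≢ d<y c≡
      upper : ∀ d → y ≤ d → d < r 3 →
        upperWeight (putWeights m c ((r′ 4 + r′ 20) * upperWeight m c) ((r′ 5 ∸ r′ 20) * lowerWeight m₁ c)) d ≡ (r 4 + E d) * upperWeight m₀ d
      upper d y≤d d<N with d ≟ c
      ... | yes refl = trans (putWeights-upper m c _ _) (cong₂ _*_ (cong₂ _+_ (at 4) E≡′) Ueq)
      ... | no  d≢c  = trans (putWeights-upper-≢ m c _ _ d≢c) (U≥ d (≤∧≢⇒< y≤d (λ y≡d → d≢c (trans (sym y≡d) (sym c≡)))) d<N)
      lower : ∀ d → y ≤ d → d < r 3 →
        lowerWeight (putWeights m c ((r′ 4 + r′ 20) * upperWeight m c) ((r′ 5 ∸ r′ 20) * lowerWeight m₁ c)) d ≡ (r 5 ∸ E d) * lowerWeight m₀ d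
      lower d y≤d d<N with d ≟ c
      ... | yes refl = trans (putWeights-lower m c _ _) (cong₂ _*_ (cong₂ _∸_ (at 5) E≡′) Veq)
      ... | no  d≢c  = trans (putWeights-lower-≢ m c _ _ d≢c) (V≥ d (≤∧≢⇒< y≤d (λ y≡d → d≢c (trans (sym y≡d) (sym c≡)))) d<N)

  record Fixed (n k B N M⁻ M⁺ : ℕ) : Set where
    field
      1≤k  : 1 ≤ k
      k≤H  : k ≤ H
      2^k≤ : 2 ^ k ≤ H
      n≤H  : n ≤ H
      1≤n  : 1 ≤ n
      B≡   : B ≡ n * 2
      1≤B  : 1 ≤ B
      3B≤H : B * 3 ≤ H
      N≡   : N ≡ B ^ k
      3N≤H : N * 3 + 2 ≤ H
      M⁺≡  : M⁺ ≡ suc (suc M⁻)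
      M⁺≤H : M⁺ ≤ H
      M≤H  : M⁻ + 2 ^ k ≤ H
      2^k≤M⁺ : 2 ^ k ≤ M⁺

  -- A common bound `W` for the current weights, together with room below Z for what one row forms
  -- from them: a product with a row factor, and the sum of one X and one Y.
  record Weights (k B N M⁻ M⁺ : ℕ) (U V : ℕ → ℕ) : Set where
    field
      U-supp : Supported B k U
      V-supp : Supported B k V
      W      : ℕ
      U≤W    : ∀ c → c < N → U c ≤ W
      V≤W    : ∀ c → c < N → V c ≤ W
      W≤Z    : W ≤ Z
      MW≤Z   : (M⁻ + 2 ^ k) * W ≤ Z
      M⁺W≤Z  : M⁺ * W ≤ Z
      sums≤Z : k * (N * (2 ^ k * W)) + k * (N * (2 ^ k * W)) ≤ Z

  Stored : ℕ → (ℕ → ℕ) → (ℕ → ℕ) → (ℕ → ℕ) → Set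
  Stored N U V m = (∀ c → c < N → upperWeight m c ≡ U c) × (∀ c → c < N → lowerWeight m c ≡ V c)

  module _ {n k B N M⁻ M⁺ U V} (fixed : Fixed n k B N M⁻ M⁺) (weights : Weights k B N M⁻ M⁺ U V) where
    open Fixed fixed
    open Weights weights

    storedEnv : ∀ {m} → (∀ d → d < B → factorAt m d ≤ 2) → Stored N U V m → Env k B N m
    storedEnv T≤2 (U≡ , V≡) = record
      { 1≤k = 1≤k ; k≤H = k≤H ; 2^k≤ = 2^k≤ ; 1≤B = 1≤B ; 3B≤H = 3B≤H ; N≡ = N≡ ; 3N≤H = 3N≤H ; T≤2 = T≤2
      ; U≤Z = λ c c<N → ≤-trans (≤-reflexive (U≡ c c<N)) (≤-trans (U≤W c c<N) W≤Z)
      ; V≤Z = λ c c<N → ≤-trans (≤-reflexive (V≡ c c<N)) (≤-trans (V≤W c c<N) W≤Z) }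

    ColumnInv : List ℕ → List Bool → ℕ → State → Set
    ColumnInv g o j s =
      snap 7 (reg s) ≡ g × reg s 7 ≡ j × reg s 7 ≤ H ×
      ∃[ x ] List.length x + j ≡ n × reg s 8 ≡ List.length x * 2 × output s ≡ o ++ x ×
        (∀ d → d < B → factorAt (mem s) d ≡ literalFactor x d) ×
        Stored N U V (mem s) × Balanced B k U V x

    literalSum-stored : ∀ {m W W′} x σ → literal (List.length x) σ < B →
      (∀ d → d < B → factorAt m d ≡ literalFactor x d) → (∀ c → c < N → W c ≡ W′ c) →
      literalSum (weighted m k B W) B N k (literal (List.length x) σ) ≡ literalWeight B k x W′ σ
    literalSum-stored {m} {W} x σ d<B T≡ W≡ = trans
      (cong (λ N → literalSum (weighted m k B W) B N k (literal (List.length x) σ)) N≡)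
      (literalSum-cong {k = k} 1≤B d<B λ c c< →
        cong₂ _*_ (digitProduct-cong 1≤B T≡ k c) (W≡ c (subst (c <_) (sym N≡) c<)))

    weightedSum≤ : ∀ {m W′} d → d < B → (∀ d → d < B → factorAt m d ≤ 2) → (∀ c → c < N → W′ c ≤ W) →
      literalSum (weighted m k B W′) B N k d ≤ k * (N * (2 ^ k * W))
    weightedSum≤ {m} {W′} d d<B T≤2 W′≤ = subst
      (λ N → literalSum (weighted m k B W′) B N k d ≤ k * (N * (2 ^ k * W))) (sym N≡)
      (literalSum-≤ {k = k} 1≤B d<B λ c c< → *-mono-≤ (digitProduct-≤ 1≤B T≤2 k c) (W′≤ c (subst (c <_) (sym N≡) c<)))

    column-step : ∀ o j s → let r = reg s in
      r 1 ≡ k → r 2 ≡ B → r 3 ≡ N → ColumnInv (snap 7 r) o (suc j) s →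
      Tri (128 * (k * (N ÷ B * k))) columnBody s (ColumnInv (snap 7 r) o j)
    column-step o j (state r m _) refl refl refl (_ , j≡ , j≤ , x , len , i≡ , refl , T≡ , stored@(U≡ , V≡) , bal) =
      weaken ≤-refl finish
        (columnBody-spec _ (storedEnv T≤2 stored) j≤ (subst (λ i → i + 1 < r 2) (sym i≡) lit<)
          λ d d′ d< d′< → ≤-trans (+-mono-≤
            (weightedSum≤ {m} d d< T≤2 λ c c<N → ≤-trans (≤-reflexive (U≡ c c<N)) (U≤W c c<N))
            (weightedSum≤ {m} d′ d′< T≤2 λ c c<N → ≤-trans (≤-reflexive (V≡ c c<N)) (V≤W c c<N))) sums≤Z)
      where
      i = List.length x
      T≤2 : ∀ d → d < r 2 → factorAt m d ≤ 2
      T≤2 d d<B = ≤-trans (≤-reflexive (T≡ d d<B)) (literalFactor≤2 x d)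
      lit< : literal i true < r 2
      lit< = subst (suc (i * 2 + 1) ≤_) (sym B≡) (≤-trans (≤-reflexive (eq i))
        (*-monoˡ-≤ 2 (≤-trans (≤-trans (s≤s (m≤m+n i j)) (≤-reflexive (sym (+-suc i j)))) (≤-reflexive len))))
        where
        eq : ∀ i → 1 + (i * 2 + 1) ≡ suc i * 2
        eq = solve-∀
      lit<′ : ∀ σ → literal i σ < r 2
      lit<′ true  = lit<
      lit<′ false = ≤-trans (s≤s (+-monoʳ-≤ (i * 2) z≤n)) lit<
      ω : (ℕ → ℕ) → Bool → ℕ
      ω = literalWeight (r 2) (r 1) x
      X≡ : ∀ σ → literalX r m (literal i σ) ≡ ω U σ
      X≡ σ = literalSum-stored {m} x σ (lit<′ σ) T≡ U≡
      Y≡ : ∀ σ → literalY r m (literal i σ) ≡ ω V σ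
      Y≡ σ = literalSum-stored {m} x σ (lit<′ σ) T≡ V≡
      X₀≡ : literalX r m (r 8) ≡ ω U false
      X₀≡ = trans (cong (literalX r m) (trans i≡ (sym (+-identityʳ (i * 2))))) (X≡ false)
      Y₀≡ : literalY r m (r 8) ≡ ω V false
      Y₀≡ = trans (cong (literalY r m) (trans i≡ (sym (+-identityʳ (i * 2))))) (Y≡ false)
      X₁≡ : literalX r m (r 8 + 1) ≡ ω U true
      X₁≡ = trans (cong (literalX r m) (cong (_+ 1) i≡)) (X≡ true)
      Y₁≡ : literalY r m (r 8 + 1) ≡ ω V true
      Y₁≡ = trans (cong (literalY r m) (cong (_+ 1) i≡)) (Y≡ true)
      choice : ∀ b → GoodBit r m (r 8) b →
        ω U b + ω V (not b) ≤
        ω U (not b) + ω V b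
      choice true  = subst₂ _≤_ (cong₂ _+_ X₁≡ Y₀≡) (cong₂ _+_ X₀≡ Y₁≡)
      choice false = subst₂ _≤_ (cong₂ _+_ X₀≡ Y₁≡) (cong₂ _+_ X₁≡ Y₀≡)
      finish : ∀ s′ → _ → ColumnInv (snap 7 r) o j s′
      finish (state r′ _ _) (keep , j′≡ , i′≡ , b , good , refl , refl) =
        keep , trans j′≡ (cong (_∸ 1) j≡) , subst (_≤ H) (sym j′≡) (≤-trans (m∸n≤m (r 7) 1) j≤) ,
        x ∷ʳ b ,
        trans (cong (_+ j) (List.length-++ x)) (trans (+-assoc i 1 j) len) ,
        trans i′≡ (trans (cong (_+ 2) i≡) (trans (sym (*-distribʳ-+ 2 i 1)) (cong (_* 2) (sym (List.length-++ x))))) ,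
        List.++-assoc o x (b ∷ []) ,
        subst (λ i₂ → ∀ d → d < r 2 → factorAt (settle m i₂ b) d ≡ literalFactor (x ∷ʳ b) d) (sym i≡)
          (settle-literalFactor {m} x b T≡) ,
        subst (λ i₂ → Stored (r 3) U V (settle m i₂ b)) (sym i≡)
          ( (λ c c<N → trans (settle-upper m i b c) (U≡ c c<N))
          , (λ c c<N → trans (settle-lower m i b c) (V≡ c c<N))) ,
        balanced-∷ʳ {r 2} {r 1} 1≤B x b U-supp V-supp lit< (choice b good) bal

    -- One column takes about k positions times N/B codes times k digits. Since B = 2n, the n
    -- columns together stay within k² N, which also covers the weight updates of order k N.
    rowCost : ℕ
    rowCost = k * (k * N)

    RowPost : State → State → Set
    RowPost s s′ = snap 7 (reg s′) ≡ snap 7 (reg s) ×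
      ∃[ x ] List.length x ≡ n × output s′ ≡ output s ++ x × Balanced B k U V x ×
        Stored N (λ c → (M⁻ + satisfaction B k x c) * U c)
                 (λ c → (M⁺ ∸ satisfaction B k x c) * V c) (mem s′)

    row-spec : ∀ s → let r = reg s in snap 6 r ≡ n ∷ k ∷ B ∷ N ∷ M⁻ ∷ M⁺ ∷ [] → Stored N U V (mem s) →
      Tri (181 * rowCost) row s (RowPost s)
    row-spec (state r m o) globals stored₀@(U≡₀ , V≡₀) =
      weaken cost≤ (λ _ post → post) $
      step (size≤κ 0≤Z) $
      step (add≤κ 0≤Z (small (subst (_≤ H) (sym (at 2)) B≤H))) $
      bind (countdown (ResetInv (snap 16 r) m o)
        (λ { _ _ (_ , _ , _ , y≤ , _) → size≤κ (small y≤) })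
        (λ { _ _ (_ , _ , y≡ , _) → y≡ })
        (resetBody-spec (snap 16 r) m o (subst (λ b → b * 3 ≤ H) (sym (at 2)) 3B≤H))
        B _
        (refl , refl , at 2 , subst (_≤ H) (sym (at 2)) B≤H , ≤-reflexive (sym (at 2)) ,
         (λ _ → refl) , (λ _ → refl) , λ d B≤d d<B → contradiction (≤-trans d<B (≤-trans (≤-reflexive (at 2)) B≤d)) (<-irrefl refl)))
      λ { (state r₁ m₁ _) (keep₁ , refl , _ , _ , _ , U≡₁ , V≡₁ , T≡₁) →
      step (size≤κ 0≤Z) $
      step (add≤κ 0≤Z (small (≤-trans (≤-reflexive (at⁺ r₁ 0 (cong (take 7) keep₁))) n≤H))) $
      step (size≤κ 0≤Z) $
      bind (countdown (ColumnInv (snap 7 r) o)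
        (λ { _ _ (_ , _ , j≤ , _) → size≤κ (small j≤) })
        (λ { _ _ (_ , j≡ , _) → j≡ })
        (λ { j s′ inv@(keep , _) → weaken ≤-refl (λ { s″ (keep′ , rest) → trans keep′ keep , rest })
             (column-step o j s′ (at⁺ (reg s′) 1 keep) (at⁺ (reg s′) 2 keep) (at⁺ (reg s′) 3 keep) (refl , proj₂ inv)) })
        n _
        ( cong (take 7) keep₁ , at⁺ r₁ 0 (cong (take 7) keep₁)
        , ≤-trans (≤-reflexive (at⁺ r₁ 0 (cong (take 7) keep₁))) n≤H
        , [] , refl , refl , sym (List.++-identityʳ o)
        , (λ d d<B → T≡₁ d z≤n (subst (d <_) (sym (at 2)) d<B))
        , ((λ c c<N → trans (U≡₁ c) (U≡₀ c c<N)) , (λ c c<N → trans (V≡₁ c) (V≡₀ c c<N)))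
        , balanced-[] {B} {k} 1≤B U V ))
      λ { (state r₂ m₂ _) (keep₂ , _ , _ , x , len , _ , refl , T≡ , stored , bal) →
      step (size≤κ 0≤Z) $
      step (add≤κ 0≤Z (small (≤-trans (≤-reflexive (at⁺ r₂ 3 keep₂)) N≤H))) $
      weights-loop r₂ m₂ keep₂ x len T≡ stored bal } }
      where
      at : ∀ i → look (snap 6 r) i ≡ look (n ∷ k ∷ B ∷ N ∷ M⁻ ∷ M⁺ ∷ []) i
      at i = cong (λ l → look l i) globals
      at⁺ : ∀ r′ i → snap 7 r′ ≡ snap 7 r → look (snap 6 r′) i ≡ look (n ∷ k ∷ B ∷ N ∷ M⁻ ∷ M⁺ ∷ []) i
      at⁺ r′ i keep = trans (cong (λ l → look (take 6 l) i) keep) (at i)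
      B≤H : B ≤ H
      B≤H = ≤-trans (m≤m*n B 3) 3B≤H
      N≤H : N ≤ H
      N≤H = ≤-trans (m≤m*n N 3) (≤-trans (m≤m+n (N * 3) 2) 3N≤H)
      cost≤ : 2 + (B * 6 + 1 + (3 + (n * suc (128 * (k * (N ÷ B * k))) + 1 + (2 + (N * suc (35 * k) + 1))))) ≤ 181 * rowCost
      cost≤ = ≤-trans
        (+-mono-≤ (const≤ 2) (+-mono-≤ reset≤ (+-mono-≤ (const≤ 3) (+-mono-≤ columns≤ (+-mono-≤ (const≤ 2) weights≤)))))
        (≤-reflexive (eq rowCost))
        where
        1≤N : 1 ≤ N
        1≤N = subst (1 ≤_) (sym N≡) (m^n>0 B {{>-nonZero 1≤B}} k)
        1≤N÷B′ : 1 ≤ N ÷ B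
        1≤N÷B′ = subst (λ N → 1 ≤ N ÷ B) (sym N≡) (1≤pow÷ {k} 1≤k 1≤B)
        kN≤ : k * N ≤ rowCost
        kN≤ = m≤n*m (k * N) k {{>-nonZero 1≤k}}
        N≤ : N ≤ rowCost
        N≤ = ≤-trans (m≤n*m N k {{>-nonZero 1≤k}}) kN≤
        B≤N : B ≤ N
        B≤N = ≤-trans (≤-trans (m≤m*n B (N ÷ B) {{>-nonZero 1≤N÷B′}}) (≤-reflexive (*-comm B (N ÷ B)))) (÷*≤ N B)
        const≤ : ∀ a → a ≤ a * rowCost
        const≤ a = m≤m*n a rowCost {{>-nonZero (≤-trans 1≤N N≤)}}
        reset≤ : B * 6 + 1 ≤ 7 * rowCost
        reset≤ = ≤-trans (+-mono-≤ (≤-trans (≤-reflexive (*-comm B 6)) (*-monoʳ-≤ 6 (≤-trans B≤N N≤))) (const≤ 1))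
          (≤-reflexive (eq₆ rowCost))
          where
          eq₆ : ∀ x → 6 * x + 1 * x ≡ 7 * x
          eq₆ = solve-∀
        columns≤ : n * suc (128 * (k * (N ÷ B * k))) + 1 ≤ 130 * rowCost
        columns≤ = ≤-trans (loop-≤ n 128 1≤n (*-mono-≤ 1≤k (*-mono-≤ 1≤N÷B′ 1≤k)))
          (*-monoʳ-≤ 130 (≤-trans (≤-reflexive (eqₙ n k (N ÷ B))) (*-monoʳ-≤ k (*-monoʳ-≤ k
            (≤-trans (*-monoʳ-≤ (N ÷ B) (≤-trans (m≤m*n n 2) (≤-reflexive (sym B≡)))) (÷*≤ N B))))))
          where
          eqₙ : ∀ n k q → n * (k * (q * k)) ≡ k * (k * (q * n))
          eqₙ = solve-∀
        weights≤ : N * suc (35 * k) + 1 ≤ 37 * rowCost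
        weights≤ = ≤-trans (loop-≤ N 35 1≤N 1≤k) (*-monoʳ-≤ 37 (≤-trans (≤-reflexive (*-comm N k)) kN≤))
        eq : ∀ x → 2 * x + (7 * x + (3 * x + (130 * x + (2 * x + 37 * x)))) ≡ 181 * x
        eq = solve-∀
      weights-loop : ∀ r₂ m₂ → snap 7 r₂ ≡ snap 7 r → ∀ x → List.length x + 0 ≡ n →
        (∀ d → d < B → factorAt m₂ d ≡ literalFactor x d) → Stored N U V m₂ → Balanced B k U V x →
        Tri (N * suc (35 * k) + 1) (whileNonZero 16 loop weightBody)
          (state ((r₂ [ 16 ↦ 0 ]) [ 16 ↦ r₂ 3 ]) m₂ (o ++ x)) (RowPost (state r m o))
      weights-loop r₂ m₂ keep₂ x len T≡ stored@(U≡ , V≡) bal =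
        weaken ≤-refl finish $
        countdown (WeightInv (snap 16 r₃) m₂ (o ++ x))
          (λ { _ _ (_ , _ , _ , y≤ , _) → size≤κ (small y≤) })
          (λ { _ _ (_ , _ , y≡ , _) → y≡ })
          (λ y s inv → weaken (≤-reflexive (cong (35 *_) (at₂ 1))) (λ _ post → post)
            (weightBody-spec (snap 16 r₃) m₂ (o ++ x)
              (back (λ l → Env (look l 1) (look l 2) (look l 3) m₂) env)
              (back (λ l → look l 4 + 2 ^ look l 1 ≤ H) M≤H)
              (back (λ l → look l 5 ≤ H) M⁺≤H)
              (back (λ l → ∀ c → c < look l 3 → (look l 4 + 2 ^ look l 1) * upperWeight m₂ c ≤ Z)
                λ c c<N → ≤-trans (*-monoʳ-≤ (M⁻ + 2 ^ k) (≤-trans (≤-reflexive (U≡ c c<N)) (U≤W c c<N))) MW≤Z)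
              (back (λ l → ∀ c → c < look l 3 → look l 5 * lowerWeight m₂ c ≤ Z)
                λ c c<N → ≤-trans (*-monoʳ-≤ M⁺ (≤-trans (≤-reflexive (V≡ c c<N)) (V≤W c c<N))) M⁺W≤Z)
              y s inv))
          N _
          ( refl , refl , at₂ 3 , ≤-trans (≤-reflexive (at₂ 3)) N≤H , ≤-reflexive (sym (at₂ 3))
          , (λ _ → refl) , (λ _ _ → refl) , (λ _ _ → refl)
          , (λ c N≤c c< → contradiction (≤-trans c< (≤-trans (≤-reflexive (at₂ 3)) N≤c)) (<-irrefl refl))
          , (λ c N≤c c< → contradiction (≤-trans c< (≤-trans (≤-reflexive (at₂ 3)) N≤c)) (<-irrefl refl)) )
        where
        r₃ = (r₂ [ 16 ↦ 0 ]) [ 16 ↦ r₂ 3 ]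
        globals₂ : snap 6 r₂ ≡ n ∷ k ∷ B ∷ N ∷ M⁻ ∷ M⁺ ∷ []
        globals₂ = trans (cong (take 6) keep₂) globals
        at₂ : ∀ i → look (snap 6 r₂) i ≡ look (n ∷ k ∷ B ∷ N ∷ M⁻ ∷ M⁺ ∷ []) i
        at₂ i = cong (λ l → look l i) globals₂
        back : (P : List ℕ → Set) → P (n ∷ k ∷ B ∷ N ∷ M⁻ ∷ M⁺ ∷ []) → P (snap 6 r₂)
        back P = subst P (sym globals₂)
        env : Env k B N m₂
        env = storedEnv (λ d d<B → ≤-trans (≤-reflexive (T≡ d d<B)) (literalFactor≤2 x d)) stored
        E≡ : ∀ c → digitProduct (factorAt m₂) (r₂ 2) (r₂ 1) c ≡ satisfaction B k x c
        E≡ c = trans (cong (λ l → digitProduct (factorAt m₂) (look l 2) (look l 1) c) globals₂)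
          (digitProduct-cong 1≤B T≡ k c)
        finish : ∀ s′ → WeightInv (snap 16 r₃) m₂ (o ++ x) 0 s′ → RowPost (state r m o) s′
        finish s′ (keep , out≡ , _ , _ , _ , _ , _ , _ , U′≡ , V′≡) =
          trans (cong (take 7) keep) keep₂ , x , trans (sym (+-identityʳ _)) len , out≡ , bal ,
          (λ c c<N → trans (U′≡ c z≤n (subst (c <_) (sym (at₂ 3)) c<N))
            (cong₂ _*_ (cong₂ _+_ (at₂ 4) (E≡ c)) (U≡ c c<N))) ,
          (λ c c<N → trans (V′≡ c z≤n (subst (c <_) (sym (at₂ 3)) c<N))
            (cong₂ _*_ (cong₂ _∸_ (at₂ 5) (E≡ c)) (V≡ c c<N)))

-- Initial weights and the loop over the rows

increasingBody initBody mainBody : Program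
increasingBody =
  instr (const 21 1) ⨾
  instr (arith sub 18 18 21) ⨾
  instr (arith quo 21 19 2) ⨾
  instr (arith mul 22 21 2) ⨾
  instr (arith sub 22 19 22) ⨾
  instr (const 19 0) ⨾
  instr (arith add 19 19 21) ⨾
  instr (const 23 2) ⨾
  instr (arith quo 22 22 23) ⨾
  -- In this loop register 17 holds the least admissible column p; the flag 1 ∸ (p ∸ column) is 1 if
  -- the column is at least p and 0 otherwise.
  instr (arith sub 23 17 22) ⨾
  instr (const 21 1) ⨾
  instr (arith sub 23 21 23) ⨾
  instr (arith mul 20 20 23) ⨾
  instr (arith add 17 21 22)
initBody =
  instr (const 21 1) ⨾
  instr (arith sub 16 16 21) ⨾
  instr (const 20 1) ⨾
  instr (const 17 0) ⨾
  instr (const 19 0) ⨾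
  instr (arith add 19 19 16) ⨾
  instr (const 18 0) ⨾
  instr (arith add 18 18 1) ⨾
  (whileNonZero 18 loop increasingBody) ⨾
  instr (const 22 3) ⨾
  instr (arith mul 21 16 22) ⨾
  instr (const 22 1) ⨾
  instr (arith add 21 21 22) ⨾
  instr (store 21 20) ⨾
  instr (arith add 21 21 22) ⨾
  instr (store 21 20)
mainBody =
  instr (const 21 1) ⨾
  instr (arith sub 6 6 21) ⨾
  row

increasing≤1 : ∀ B j p x → increasing B j p x ≤ 1
increasing≤1 B zero    p x = ≤-refl
increasing≤1 B (suc j) p x = *-mono-≤ (m∸n≤m 1 (p ∸ digitOf B x ÷ 2)) (increasing≤1 B j (suc (digitOf B x ÷ 2)) (x ÷ B))

-- Closed form of either weight of c after the given rows, with g the row factor as a function of E.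
-- The leading factor is the initial weight: 1 for a clause, 0 for any other code.
rowsWeight : ∀ {n} → ℕ → ℕ → (ℕ → ℕ) → List (Vec Bool n) → ℕ → ℕ
rowsWeight B k g rows c = increasing B k 0 c * product (List.map (λ s → g (satisfaction B k (Vec.toList s) c)) rows)

module _ {n : ℕ} (B k : ℕ) (g : ℕ → ℕ) where
  rowsWeight-∷ʳ : ∀ (rows : List (Vec Bool n)) s c →
    rowsWeight B k g (rows ∷ʳ s) c ≡ g (satisfaction B k (Vec.toList s) c) * rowsWeight B k g rows c
  rowsWeight-∷ʳ rows s c = begin
    w * product (List.map f (rows ∷ʳ s))             ≡⟨ cong (λ l → w * product l) (List.map-++ f rows (s ∷ [])) ⟩
    w * product (List.map f rows ++ f s ∷ [])        ≡⟨ cong (w *_) (product-++ (List.map f rows) (f s ∷ [])) ⟩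
    w * (product (List.map f rows) * (f s * 1))      ≡⟨ eq w (product (List.map f rows)) (f s) ⟩
    f s * (w * product (List.map f rows))            ∎
    where
    open ≡-Reasoning
    w = increasing B k 0 c
    f = λ s → g (satisfaction B k (Vec.toList s) c)
    eq : ∀ a b c → a * (b * (c * 1)) ≡ c * (a * b)
    eq = solve-∀

  rowsWeight-supported : ∀ (rows : List (Vec Bool n)) → Supported B k (rowsWeight B k g rows)
  rowsWeight-supported rows c with increasing B k 0 c
  ... | zero  = inj₁ refl
  ... | suc _ = inj₂ λ ()

  rowsWeight-≤ : ∀ {F m} → 1 ≤ F → (∀ (s : Vec Bool n) c → g (satisfaction B k (Vec.toList s) c) ≤ F) →
    ∀ rows → List.length rows ≤ m → ∀ c → rowsWeight B k g rows c ≤ F ^ m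
  rowsWeight-≤ {F} 1≤F g≤ rows len≤ c = ≤-trans
    (*-mono-≤ (increasing≤1 B k 0 c) (≤-trans (product≤ rows) (^-monoʳ-≤ F {{>-nonZero 1≤F}} len≤)))
    (≤-reflexive (*-identityˡ _))
    where
    product≤ : ∀ rows → product (List.map (λ s → g (satisfaction B k (Vec.toList s) c)) rows) ≤ F ^ List.length rows
    product≤ []         = ≤-refl
    product≤ (s ∷ rows) = *-mono-≤ (g≤ s c) (product≤ rows)

module Main (ε : Real01) (H Z : ℕ) (3≤H : 3 ≤ H) (H≤Z : H ≤ Z) where
  open Rows ε H Z 3≤H H≤Z public

  IncreasingInv : List ℕ → (ℕ → ℕ) → List Bool → ℕ → ℕ → State → Set
  IncreasingInv g m o total j s =
    (snap 17 (reg s) ≡ g × mem s ≡ m × output s ≡ o) ×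
    reg s 18 ≡ j × reg s 18 ≤ H × reg s 19 ≤ H × reg s 17 ≤ H × reg s 20 ≤ 1 ×
    reg s 20 * increasing (look g 2) j (reg s 17) (reg s 19) ≡ total

  increasingBody-spec : ∀ g m o total → 1 ≤ look g 2 → look g 2 ≤ H →
    ∀ j s → IncreasingInv g m o total (suc j) s → Tri 14 increasingBody s (IncreasingInv g m o total j)
  increasingBody-spec g m o total 1≤B B≤H j (state r _ _)
    ((refl , refl , refl) , j≡ , j≤ , x≤ , p≤ , ok≤ , tot) =
    step (size≤κ 1≤Z) $
    step (add≤κ (small j≤) 1≤Z) $
    step (mul≤κ x≤ (small B≤H)) $
    step (mul≤κ y≤ (small B≤H)) $
    step (add≤κ (small x≤) (small yB≤)) $
    step (size≤κ 0≤Z) $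
    step (add≤κ 0≤Z (small y≤)) $
    step (size≤κ 2≤Z) $
    step (mul≤κ d≤ 2≤Z) $
    step (add≤κ (small p≤) (small col≤)) $
    step (size≤κ 1≤Z) $
    step (add≤κ 1≤Z (small (≤-trans (m∸n≤m (r 17) col) p≤))) $
    step (mul≤κ (≤-trans ok≤ 1≤H) (≤-trans (m∸n≤m 1 (r 17 ∸ col)) 1≤Z)) $
    last (add≤κ 1≤Z (small col≤))
      ( (refl , refl , refl)
      , cong (_∸ 1) j≡
      , ≤-trans (m∸n≤m (r 18) 1) j≤
      , y≤
      , ≤-trans (s≤s (÷≤ (digitOf (r 2) x) 2)) (≤-trans d<B B≤H)
      , *-mono-≤ ok≤ (m∸n≤m 1 (r 17 ∸ col))
      , trans (*-assoc (r 20) _ _) tot )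
    where
    x = r 19
    d<B = digitOf< {r 2} x 1≤B
    col = digitOf (r 2) x ÷ 2
    1≤H : 1 ≤ H
    1≤H = ≤-trans (s≤s z≤n) 3≤H
    y≤ : x ÷ r 2 ≤ H
    y≤ = ≤-trans (÷≤ x (r 2)) x≤
    yB≤ = ≤-trans (÷*≤ x (r 2)) x≤
    d≤ : digitOf (r 2) x ≤ H
    d≤ = ≤-trans (m∸n≤m x (x ÷ r 2 * r 2)) x≤
    col≤ : col ≤ H
    col≤ = ≤-trans (÷≤ (digitOf (r 2) x) 2) d≤

  InitInv : List ℕ → List Bool → ℕ → State → Set
  InitInv g o y s =
    snap 16 (reg s) ≡ g × output s ≡ o × reg s 16 ≡ y × reg s 16 ≤ H × y ≤ look g 3 ×
    (∀ c → y ≤ c → c < look g 3 → upperWeight (mem s) c ≡ increasing (look g 2) (look g 1) 0 c) ×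
    (∀ c → y ≤ c → c < look g 3 → lowerWeight (mem s) c ≡ increasing (look g 2) (look g 1) 0 c)

  initBody-spec : ∀ g o → 1 ≤ look g 1 → look g 1 ≤ H → 1 ≤ look g 2 → look g 2 ≤ H → look g 3 * 3 + 2 ≤ H →
    ∀ y s → InitInv g o (suc y) s → Tri (31 * look g 1) initBody s (InitInv g o y)
  initBody-spec g o 1≤k k≤H 1≤B B≤H 3N≤H y (state r m _) (refl , refl , y≡ , y≤ , y<N , U≥ , V≥) =
    weaken (≤-trans (≤-reflexive (eq₁ (r 1))) (absorb 16 15 1≤k)) (λ _ post → post) $
    step (size≤κ 1≤Z) $
    step (add≤κ (small y≤) 1≤Z) $
    step (size≤κ 1≤Z) $
    step (size≤κ 0≤Z) $
    step (size≤κ 0≤Z) $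
    step (add≤κ 0≤Z (small c≤H)) $
    step (size≤κ 0≤Z) $
    step (add≤κ 0≤Z (small k≤H)) $
    bind (countdown (IncreasingInv (snap 17 r₁) m o total)
        (λ { _ _ (_ , _ , j≤ , _) → size≤κ (small j≤) })
        (λ { _ _ (_ , j≡ , _) → j≡ })
        (increasingBody-spec (snap 17 r₁) m o total 1≤B B≤H)
        (r 1) _
        ((refl , refl , refl) , refl , k≤H , c≤H , z≤n , ≤-refl , *-identityˡ total))
    λ { (state r′ _ _) ((keep , refl , refl) , _ , _ , _ , _ , ok≤ , tot) → after r′ keep ok≤ (trans (sym (*-identityʳ _)) tot) }
    where
    c = r 16 ∸ 1
    r₁ = (r [ 21 ↦ 1 ]) [ 16 ↦ c ]
    total = increasing (r 2) (r 1) 0 c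
    c≡ : c ≡ y
    c≡ = cong (_∸ 1) y≡
    c≤H : c ≤ H
    c≤H = ≤-trans (m∸n≤m (r 16) 1) y≤
    eq₁ : ∀ k → 8 + (k * 15 + 1 + 7) ≡ 16 + 15 * k
    eq₁ = solve-∀
    after : ∀ r′ → snap 17 r′ ≡ snap 17 r₁ → r′ 20 ≤ 1 → r′ 20 ≡ total → Tri 7 _ (state r′ m o) (InitInv (snap 16 r) o y)
    after r′ keep ok≤ ok≡ =
      step (size≤κ 3≤Z) $
      step (mul≤κ c′≤H 3≤Z) $
      step (size≤κ 1≤Z) $
      step (add≤κ (small 3c≤H) 1≤Z) $
      step (add≤κ (small 3c1≤H) (≤-trans ok≤ 1≤Z)) $
      step (add≤κ (small 3c1≤H) 1≤Z) $
      last (add≤κ (small 3c2≤H) (≤-trans ok≤ 1≤Z))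
        ( cong (take 16) keep , refl , c′≡ , c′≤H , <⇒≤ y<N , upper , lower )
      where
      at : ∀ i → look (snap 17 r′) i ≡ look (snap 17 r₁) i
      at i = cong (λ l → look l i) keep
      c′ = r′ 16
      c′≡ : c′ ≡ y
      c′≡ = trans (at 16) c≡
      c′≤H : c′ ≤ H
      c′≤H = subst (_≤ H) (sym (at 16)) c≤H
      3c2≤H : c′ * 3 + 1 + 1 ≤ H
      3c2≤H = ≤-trans (≤-trans (≤-reflexive (+-assoc (c′ * 3) 1 1))
        (+-monoˡ-≤ 2 (*-monoˡ-≤ 3 (≤-trans (≤-reflexive c′≡) (<⇒≤ y<N))))) 3N≤H
      3c1≤H = ≤-trans (m≤m+n (c′ * 3 + 1) 1) 3c2≤H
      3c≤H = ≤-trans (m≤m+n (c′ * 3) 1) 3c1≤H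
      ok≡′ : r′ 20 ≡ increasing (r 2) (r 1) 0 c′
      ok≡′ = trans ok≡ (cong (increasing (r 2) (r 1) 0) (sym (at 16)))
      later : ∀ {d} → y ≤ d → d ≢ c′ → suc y ≤ d
      later y≤d d≢ = ≤∧≢⇒< y≤d (λ y≡d → d≢ (trans (sym y≡d) (sym c′≡)))
      upper : ∀ d → y ≤ d → d < r 3 → upperWeight (putWeights m c′ (r′ 20) (r′ 20)) d ≡ increasing (r 2) (r 1) 0 d
      upper d y≤d d<N with d ≟ c′
      ... | yes refl = trans (putWeights-upper m c′ _ _) ok≡′
      ... | no  d≢   = trans (putWeights-upper-≢ m c′ _ _ d≢) (U≥ d (later y≤d d≢) d<N)
      lower : ∀ d → y ≤ d → d < r 3 → lowerWeight (putWeights m c′ (r′ 20) (r′ 20)) d ≡ increasing (r 2) (r 1) 0 d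
      lower d y≤d d<N with d ≟ c′
      ... | yes refl = trans (putWeights-lower m c′ _ _) ok≡′
      ... | no  d≢   = trans (putWeights-lower-≢ m c′ _ _ d≢) (V≥ d (later y≤d d≢) d<N)

  MainInv : (n k B N M⁻ M⁺ rounds : ℕ) → ℕ → State → Set
  MainInv n k B N M⁻ M⁺ rounds j s =
    snap 6 (reg s) ≡ n ∷ k ∷ B ∷ N ∷ M⁻ ∷ M⁺ ∷ [] × reg s 6 ≡ j × reg s 6 ≤ H ×
    ∃[ rows ] List.length rows + j ≡ rounds × output s ≡ concatMap (Vec.toList {n = n}) rows ×
      Stored N (rowsWeight B k (M⁻ +_) rows) (rowsWeight B k (M⁺ ∸_) rows) (mem s) ×
      sumBelow (rowsWeight B k (M⁻ +_) rows) N + sumBelow (rowsWeight B k (M⁺ ∸_) rows) N ≤ suc M⁻ ^ List.length rows * (2 * N)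

  module _ {n k B N M⁻ M⁺ rounds : ℕ} (fixed : Fixed n k B N M⁻ M⁺)
    (growth≤Z : (M⁺ + 2 ^ k) * (M⁺ + 2 ^ k) ^ rounds ≤ Z)
    (sums≤Z : k * (N * (2 ^ k * (M⁺ + 2 ^ k) ^ rounds)) + k * (N * (2 ^ k * (M⁺ + 2 ^ k) ^ rounds)) ≤ Z) where
    open Fixed fixed
    private
      -- A bound for both row factors M - 1 + E and M + 1 - E, so that weights stay below F^rounds.
      F = M⁺ + 2 ^ k

      U V : List (Vec Bool n) → ℕ → ℕ
      U = rowsWeight B k (M⁻ +_)
      V = rowsWeight B k (M⁺ ∸_)

      E : Vec Bool n → ℕ → ℕ
      E s = satisfaction B k (Vec.toList s)

      E≤ : ∀ s c → E s c ≤ 2 ^ k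
      E≤ s c = digitProduct-≤ 1≤B (λ d _ → literalFactor≤2 (Vec.toList s) d) k c

      1≤F : 1 ≤ F
      1≤F = ≤-trans (m^n>0 2 k) (m≤n+m (2 ^ k) M⁺)

      M⁻≤M⁺ : M⁻ ≤ M⁺
      M⁻≤M⁺ = subst (M⁻ ≤_) (sym M⁺≡) (≤-trans (n≤1+n M⁻) (n≤1+n (suc M⁻)))

      rowsWeights : ∀ rows → List.length rows ≤ rounds → Weights k B N M⁻ M⁺ (U rows) (V rows)
      rowsWeights rows len≤ = record
        { U-supp = rowsWeight-supported B k (M⁻ +_) rows
        ; V-supp = rowsWeight-supported B k (M⁺ ∸_) rows
        ; W = F ^ rounds
        ; U≤W = λ c _ → rowsWeight-≤ B k (M⁻ +_) 1≤F (λ s c → +-mono-≤ M⁻≤M⁺ (E≤ s c)) rows len≤ c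
        ; V≤W = λ c _ → rowsWeight-≤ B k (M⁺ ∸_) 1≤F (λ s c → ≤-trans (m∸n≤m M⁺ (E s c)) (m≤m+n M⁺ (2 ^ k))) rows len≤ c
        ; W≤Z = ≤-trans (m≤n*m (F ^ rounds) F {{>-nonZero 1≤F}}) growth≤Z
        ; MW≤Z = ≤-trans (*-monoˡ-≤ (F ^ rounds) (+-monoˡ-≤ (2 ^ k) M⁻≤M⁺)) growth≤Z
        ; M⁺W≤Z = ≤-trans (*-monoˡ-≤ (F ^ rounds) (m≤m+n M⁺ (2 ^ k))) growth≤Z
        ; sums≤Z = sums≤Z }

      as-row : ∀ {x : List Bool} → List.length x ≡ n → ∃[ s ] Vec.toList {n = n} s ≡ x
      as-row {x} refl = Vec.fromList x , Vec.toList∘fromList x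

    mainBody-spec : ∀ j s → MainInv n k B N M⁻ M⁺ rounds (suc j) s →
      Tri (183 * (k * (k * N))) mainBody s (MainInv n k B N M⁻ M⁺ rounds j)
    mainBody-spec j (state r m _) (globals , j≡ , j≤ , rows , len , refl , stored , tot) =
      weaken le finish $
      step (size≤κ 1≤Z) $
      step (add≤κ (small j≤) 1≤Z) $
      row-spec fixed weights _ globals stored
      where
      weights = rowsWeights rows (≤-trans (m≤m+n _ (suc j)) (≤-reflexive len))
      le : 2 + 181 * (k * (k * N)) ≤ 183 * (k * (k * N))
      le = absorb 2 181 (*-mono-≤ 1≤k (*-mono-≤ 1≤k (subst (1 ≤_) (sym N≡) (m^n>0 B {{>-nonZero 1≤B}} k))))
      finish : ∀ s′ → RowPost fixed weights (state ((r [ 21 ↦ 1 ]) [ 6 ↦ r 6 ∸ 1 ]) m (concatMap Vec.toList rows)) s′ →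
        MainInv n k B N M⁻ M⁺ rounds j s′
      finish s′ (keep , x , lenx , out≡ , bal , U≡ , V≡) with as-row {x} lenx
      ... | v , refl =
        trans (cong (take 6) keep) globals ,
        trans j′≡ (cong (_∸ 1) j≡) ,
        subst (_≤ H) (sym j′≡) (≤-trans (m∸n≤m (r 6) 1) j≤) ,
        rows ∷ʳ v ,
        trans (cong (_+ j) (List.length-++ rows)) (trans (+-assoc (List.length rows) 1 j) len) ,
        trans out≡ (sym (trans (List.concatMap-++ Vec.toList rows (v ∷ []))
          (cong (concatMap Vec.toList rows ++_) (List.++-identityʳ (Vec.toList v))))) ,
        ( (λ c c<N → trans (U≡ c c<N) (sym (rowsWeight-∷ʳ B k (M⁻ +_) rows v c)))
        , (λ c c<N → trans (V≡ c c<N) (sym (rowsWeight-∷ʳ B k (M⁺ ∸_) rows v c)))) ,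
        total
        where
        j′≡ : reg s′ 6 ≡ r 6 ∸ 1
        j′≡ = cong (λ l → look l 6) keep
        total : sumBelow (U (rows ∷ʳ v)) N + sumBelow (V (rows ∷ʳ v)) N ≤ suc M⁻ ^ List.length (rows ∷ʳ v) * (2 * N)
        total = begin
          sumBelow (U (rows ∷ʳ v)) N + sumBelow (V (rows ∷ʳ v)) N
            ≡⟨ cong₂ _+_ (sum-cong N λ c _ → rowsWeight-∷ʳ B k (M⁻ +_) rows v c)
                         (sum-cong N λ c _ → trans (rowsWeight-∷ʳ B k (M⁺ ∸_) rows v c) (cong (λ a → (a ∸ E v c) * V rows c) M⁺≡)) ⟩
          sumBelow (λ c → (M⁻ + E v c) * U rows c) N + sumBelow (λ c → (suc (suc M⁻) ∸ E v c) * V rows c) N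
            ≤⟨ subst (λ N → sumBelow (λ c → (M⁻ + E v c) * U rows c) N + sumBelow (λ c → (suc (suc M⁻) ∸ E v c) * V rows c) N
                              ≤ suc M⁻ * (sumBelow (U rows) N + sumBelow (V rows) N)) (sym N≡)
                 (total-step {B} {k} 1≤B (Vec.toList v) M⁻ (λ c _ → ≤-trans (E≤ v c) (≤-trans 2^k≤M⁺ (≤-reflexive M⁺≡))) bal) ⟩
          suc M⁻ * (sumBelow (U rows) N + sumBelow (V rows) N)
            ≤⟨ *-monoʳ-≤ (suc M⁻) tot ⟩
          suc M⁻ * (suc M⁻ ^ List.length rows * (2 * N))
            ≡⟨ *-assoc (suc M⁻) (suc M⁻ ^ List.length rows) (2 * N) ⟨
          suc M⁻ ^ suc (List.length rows) * (2 * N)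
            ≡⟨ cong (λ l → suc M⁻ ^ l * (2 * N)) (trans (+-comm 1 (List.length rows)) (sym (List.length-++ rows))) ⟩
          suc M⁻ ^ List.length (rows ∷ʳ v) * (2 * N) ∎
          where open ≤-Reasoning

-- Chernoff bounds

-- (1 − j y / x) ≤ (1 − y / x) ^ j, denominators cleared.
bernoulli-∸ : ∀ x y j → x ^ j * (x ∸ j * y) ≤ (x ∸ y) ^ j * x
bernoulli-∸ x y zero    = ≤-refl
bernoulli-∸ x y (suc j) = begin
  x * x ^ j * (x ∸ (y + j * y))          ≡⟨ eq x (x ^ j) _ ⟩
  x ^ j * (x * (x ∸ (y + j * y)))        ≤⟨ *-monoʳ-≤ (x ^ j) step ⟩
  x ^ j * ((x ∸ y) * (x ∸ j * y))        ≡⟨ eq₂ (x ^ j) (x ∸ y) _ ⟩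
  (x ∸ y) * (x ^ j * (x ∸ j * y))        ≤⟨ *-monoʳ-≤ (x ∸ y) (bernoulli-∸ x y j) ⟩
  (x ∸ y) * ((x ∸ y) ^ j * x)            ≡⟨ *-assoc (x ∸ y) ((x ∸ y) ^ j) x ⟨
  (x ∸ y) * (x ∸ y) ^ j * x              ∎
  where
  open ≤-Reasoning
  u = x ∸ j * y
  eq : ∀ a b c → a * b * c ≡ b * (a * c)
  eq = solve-∀
  eq₂ : ∀ a b c → a * (b * c) ≡ b * (a * c)
  eq₂ = solve-∀
  step : x * (x ∸ (y + j * y)) ≤ (x ∸ y) * u
  step = begin
    x * (x ∸ (y + j * y))  ≡⟨ cong (x *_) (trans (cong (x ∸_) (+-comm y (j * y))) (sym (∸-+-assoc x (j * y) y))) ⟩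
    x * (u ∸ y)            ≡⟨ *-distribˡ-∸ x u y ⟩
    x * u ∸ x * y          ≤⟨ ∸-monoʳ-≤ (x * u) (≤-trans (*-monoʳ-≤ y (m∸n≤m x (j * y))) (≤-reflexive (*-comm y x))) ⟩
    x * u ∸ y * u          ≡⟨ *-distribʳ-∸ u x y ⟨
    (x ∸ y) * u            ∎

-- This is (1 + 1/x)^j ≥ 1 + j/x with denominators cleared; the induction step drops a summand j.
bernoulli-+ : ∀ x j → x ^ j * (x + j) ≤ suc x ^ j * x
bernoulli-+ x zero    = ≤-reflexive (cong (_+ 0) (+-identityʳ x))
bernoulli-+ x (suc j) = begin
  x * x ^ j * (x + suc j)        ≡⟨ eq x (x ^ j) j ⟩
  x ^ j * (x * (x + suc j))      ≤⟨ *-monoʳ-≤ (x ^ j) (≤-trans (m≤m+n _ j) (≤-reflexive (eq₂ x j))) ⟩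
  x ^ j * (suc x * (x + j))      ≡⟨ eq₃ (x ^ j) (suc x) (x + j) ⟩
  suc x * (x ^ j * (x + j))      ≤⟨ *-monoʳ-≤ (suc x) (bernoulli-+ x j) ⟩
  suc x * (suc x ^ j * x)        ≡⟨ *-assoc (suc x) (suc x ^ j) x ⟨
  suc x * suc x ^ j * x          ∎
  where
  open ≤-Reasoning
  eq : ∀ x p j → x * p * (x + suc j) ≡ p * (x * (x + suc j))
  eq = solve-∀
  eq₂ : ∀ x j → x * (x + suc j) + j ≡ suc x * (x + j)
  eq₂ = solve-∀
  eq₃ : ∀ a b c → a * (b * c) ≡ b * (a * c)
  eq₃ = solve-∀

^-distribʳ-* : ∀ a b n → (a * b) ^ n ≡ a ^ n * b ^ n
^-distribʳ-* a b zero    = refl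
^-distribʳ-* a b (suc n) = trans (cong (a * b *_) (^-distribʳ-* a b n)) (eq a b (a ^ n) (b ^ n))
  where
  eq : ∀ a b c d → a * b * (c * d) ≡ a * c * (b * d)
  eq = solve-∀

-- Bernoulli's inequality with j = x: (1 + 1/x)^x is at least 2.
doubling : ∀ x .{{_ : NonZero x}} → 2 * x ^ x ≤ suc x ^ x
doubling x = *-cancelʳ-≤ (2 * x ^ x) (suc x ^ x) x (≤-trans (≤-reflexive (eq x (x ^ x))) (bernoulli-+ x x))
  where
  eq : ∀ x p → 2 * p * x ≡ p * (x + x)
  eq = solve-∀

-- Among the e factors 1 + 1/x there are s blocks of x, each worth at least 2; the remaining ones
-- are at least 1.
doubling^ : ∀ x .{{_ : NonZero x}} s {e} → s * x ≤ e → 2 ^ s * x ^ e ≤ suc x ^ e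
doubling^ x s {e} sx≤e = begin
  2 ^ s * x ^ e                          ≡⟨ cong (2 ^ s *_) (split x) ⟩
  2 ^ s * ((x ^ x) ^ s * x ^ f)          ≡⟨ *-assoc (2 ^ s) ((x ^ x) ^ s) (x ^ f) ⟨
  2 ^ s * (x ^ x) ^ s * x ^ f            ≡⟨ cong (_* x ^ f) (^-distribʳ-* 2 (x ^ x) s) ⟨
  (2 * x ^ x) ^ s * x ^ f                ≤⟨ *-mono-≤ (^-monoˡ-≤ s (doubling x)) (^-monoˡ-≤ f (n≤1+n x)) ⟩
  (suc x ^ x) ^ s * suc x ^ f            ≡⟨ split (suc x) ⟨
  suc x ^ e                              ∎
  where
  open ≤-Reasoning
  f = e ∸ s * x
  split : ∀ y → y ^ e ≡ (y ^ x) ^ s * y ^ f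
  split y = trans (cong (y ^_) (sym (m+[n∸m]≡n sx≤e))) (trans (^-distribˡ-+-* y (s * x) f)
    (cong (_* y ^ f) (trans (cong (y ^_) (*-comm s x)) (sym (^-*-assoc y x s)))))

-- There are h R K rows, so h R hits are expected, and h is the tolerated deviation; 2^s is a growth
-- relative to M that no weight reaches. The modulus is M = G K. Below, y stands for (K - 1)/M,
-- which is less than 1/G.
module Tails (R h s g K⁻ : ℕ) (1≤R : 1 ≤ R) (G≡ : suc g ≡ 4 * R) (h≡ : h ≡ 8 * R * s) where
  G K M C : ℕ
  G = suc g
  K = suc K⁻
  M = G * K
  C = M ∸ K⁻

  private
    M⁻ : ℕ
    M⁻ = K⁻ + g * K

    instance
      M≢0 : NonZero M
      M≢0 = _

    K⁻≤M : K⁻ ≤ M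
    K⁻≤M = ≤-trans (n≤1+n K⁻) (m≤m+n K (g * K))

    open ≤-Reasoning

  -- After division by M² this reads g y² + g y ≤ 1, exactly what (1 - g y²)(1 + y) ≥ 1 needs.
  M²-slack : g * (K⁻ * K⁻) + g * K⁻ * M ≤ M * M
  M²-slack = ≤-trans (m≤m+n _ ((1 + g) * K * (g + 1) + (1 + g) * K * K⁻ ∸ g * (K⁻ * K⁻))) (≤-reflexive (begin-equality
    g * (K⁻ * K⁻) + g * K⁻ * M + (M * (g + 1) + M * K⁻ ∸ g * (K⁻ * K⁻))
      ≡⟨ cong (_+ (M * (g + 1) + M * K⁻ ∸ g * (K⁻ * K⁻))) (+-comm (g * (K⁻ * K⁻)) (g * K⁻ * M)) ⟩
    g * K⁻ * M + g * (K⁻ * K⁻) + (M * (g + 1) + M * K⁻ ∸ g * (K⁻ * K⁻))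
      ≡⟨ +-assoc (g * K⁻ * M) _ _ ⟩
    g * K⁻ * M + (g * (K⁻ * K⁻) + (M * (g + 1) + M * K⁻ ∸ g * (K⁻ * K⁻)))
      ≡⟨ cong (g * K⁻ * M +_) (m+[n∸m]≡n small) ⟩
    g * K⁻ * M + (M * (g + 1) + M * K⁻)
      ≡⟨ eq g K⁻ ⟩
    M * M ∎))
    where
    eq : ∀ g k → g * k * ((1 + g) * (1 + k)) + ((1 + g) * (1 + k) * (g + 1) + (1 + g) * (1 + k) * k) ≡ (1 + g) * (1 + k) * ((1 + g) * (1 + k))
    eq = solve-∀
    small : g * (K⁻ * K⁻) ≤ M * (g + 1) + M * K⁻
    small = ≤-trans (≤-reflexive (sym (*-assoc g K⁻ K⁻))) (≤-trans (*-monoˡ-≤ K⁻ (*-mono-≤ (n≤1+n g) (n≤1+n K⁻))) (m≤n+m (M * K⁻) (M * (g + 1))))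

  cross : C * (M + K⁻) ≡ M * M ∸ K⁻ * K⁻
  cross = begin-equality
    (M ∸ K⁻) * (M + K⁻)                      ≡⟨ *-distribʳ-∸ (M + K⁻) M K⁻ ⟩
    M * (M + K⁻) ∸ K⁻ * (M + K⁻)             ≡⟨ cong₂ _∸_ (eq₁ M K⁻) (eq₂ M K⁻) ⟩
    (K⁻ * M + M * M) ∸ (K⁻ * M + K⁻ * K⁻)    ≡⟨ [m+n]∸[m+o]≡n∸o (K⁻ * M) (M * M) (K⁻ * K⁻) ⟩
    M * M ∸ K⁻ * K⁻                          ∎
    where
    eq₁ : ∀ m k → m * (m + k) ≡ k * m + m * m
    eq₁ = solve-∀
    eq₂ : ∀ m k → k * (m + k) ≡ k * m + k * k
    eq₂ = solve-∀

  -- (1 − y)^(G−1) (1 + y)^G ≥ 1 for y = (K − 1) / M ≤ 1 / G.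
  key : M ^ (g + G) ≤ C ^ g * (M + K⁻) ^ G
  key = *-cancelʳ-≤ _ _ (M * M) (begin
    -- Pair (1 - y)^g with (1 + y)^g to (1 - y²)^g, which is at least 1 - g y² by Bernoulli; the one
    -- remaining factor 1 + y makes up for the loss.
    M ^ (g + G) * (M * M)
      ≡⟨ cong (_* (M * M)) (trans (^-distribˡ-+-* M g G) (trans (eq₁ (M ^ g) M) (cong (_* M) (sym (^-distribʳ-* M M g))))) ⟩
    (M * M) ^ g * M * (M * M)
      ≡⟨ eq₂ ((M * M) ^ g) M ⟩
    (M * M) ^ g * (M * M * M)
      ≤⟨ *-monoʳ-≤ ((M * M) ^ g) slack ⟩
    (M * M) ^ g * ((M * M ∸ g * (K⁻ * K⁻)) * (M + K⁻))
      ≡⟨ *-assoc ((M * M) ^ g) _ _ ⟨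
    (M * M) ^ g * (M * M ∸ g * (K⁻ * K⁻)) * (M + K⁻)
      ≤⟨ *-monoˡ-≤ (M + K⁻) (bernoulli-∸ (M * M) (K⁻ * K⁻) g) ⟩
    (M * M ∸ K⁻ * K⁻) ^ g * (M * M) * (M + K⁻)
      ≡⟨ cong (λ x → x ^ g * (M * M) * (M + K⁻)) cross ⟨
    (C * (M + K⁻)) ^ g * (M * M) * (M + K⁻)
      ≡⟨ cong (λ x → x * (M * M) * (M + K⁻)) (^-distribʳ-* C (M + K⁻) g) ⟩
    C ^ g * (M + K⁻) ^ g * (M * M) * (M + K⁻)
      ≡⟨ eq₃ (C ^ g) ((M + K⁻) ^ g) (M * M) (M + K⁻) ⟩
    C ^ g * (M + K⁻) ^ G * (M * M) ∎)
    where
    eq₁ : ∀ p m → p * (m * p) ≡ p * p * m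
    eq₁ = solve-∀
    eq₂ : ∀ p m → p * m * (m * m) ≡ p * (m * m * m)
    eq₂ = solve-∀
    eq₃ : ∀ a b c d → a * b * c * d ≡ a * (d * b) * c
    eq₃ = solve-∀
    y² = K⁻ * K⁻
    slack : M * M * M ≤ (M * M ∸ g * y²) * (M + K⁻)
    slack = begin
      M * M * M                                      ≡⟨ m+n∸n≡m (M * M * M) (g * y² * (M + K⁻)) ⟨
      M * M * M + g * y² * (M + K⁻) ∸ g * y² * (M + K⁻)
        ≤⟨ ∸-monoˡ-≤ (g * y² * (M + K⁻)) (begin
             M * M * M + g * y² * (M + K⁻)           ≡⟨ eq₄ M g K⁻ ⟩
             M * M * M + K⁻ * (g * y² + g * K⁻ * M)  ≤⟨ +-monoʳ-≤ (M * M * M) (*-monoʳ-≤ K⁻ M²-slack) ⟩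
             M * M * M + K⁻ * (M * M)                ≡⟨ eq₅ M K⁻ ⟩
             M * M * (M + K⁻)                        ∎) ⟩
      M * M * (M + K⁻) ∸ g * y² * (M + K⁻)           ≡⟨ *-distribʳ-∸ (M + K⁻) (M * M) (g * y²) ⟨
      (M * M ∸ g * y²) * (M + K⁻)                    ∎
      where
      eq₄ : ∀ m g k → m * m * m + g * (k * k) * (m + k) ≡ m * m * m + k * (g * (k * k) + g * k * m)
      eq₄ = solve-∀
      eq₅ : ∀ m k → m * m * m + k * (m * m) ≡ m * m * (m + k)
      eq₅ = solve-∀

  -- Bernoulli gives (1 - 1/M)^(K - 1) ≥ 1 - y, and `key` finishes. So G hits with (K - 1)(G - 1)
  -- misses, a hit rate slightly above 1/K for K > 1, do not lower U relative to M.
  upper-drift : M ^ (G + K⁻ * g) ≤ (M + K⁻) ^ G * M⁻ ^ (K⁻ * g)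
  upper-drift = *-cancelʳ-≤ _ _ (M ^ g) {{m^n≢0 M g}} (begin
    M ^ (G + K⁻ * g) * M ^ g                       ≡⟨ cong (_* M ^ g) (^-distribˡ-+-* M G (K⁻ * g)) ⟩
    M ^ G * M ^ (K⁻ * g) * M ^ g                   ≡⟨ eq₁ (M ^ G) (M ^ (K⁻ * g)) (M ^ g) ⟩
    M ^ g * M ^ G * M ^ (K⁻ * g)                   ≡⟨ cong (_* M ^ (K⁻ * g)) (^-distribˡ-+-* M g G) ⟨
    M ^ (g + G) * M ^ (K⁻ * g)                     ≤⟨ *-monoˡ-≤ (M ^ (K⁻ * g)) key ⟩
    C ^ g * (M + K⁻) ^ G * M ^ (K⁻ * g)            ≡⟨ eq₂ (C ^ g) ((M + K⁻) ^ G) (M ^ (K⁻ * g)) ⟩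
    (M + K⁻) ^ G * (M ^ (K⁻ * g) * C ^ g)          ≤⟨ *-monoʳ-≤ ((M + K⁻) ^ G) (begin
      M ^ (K⁻ * g) * C ^ g                           ≡⟨ cong (_* C ^ g) (^-*-assoc M K⁻ g) ⟨
      (M ^ K⁻) ^ g * C ^ g                           ≡⟨ ^-distribʳ-* (M ^ K⁻) C g ⟨
      (M ^ K⁻ * C) ^ g                               ≤⟨ ^-monoˡ-≤ g (subst (λ j → M ^ K⁻ * (M ∸ j) ≤ M⁻ ^ K⁻ * M) (*-identityʳ K⁻) (bernoulli-∸ M 1 K⁻)) ⟩
      (M⁻ ^ K⁻ * M) ^ g                              ≡⟨ ^-distribʳ-* (M⁻ ^ K⁻) M g ⟩
      (M⁻ ^ K⁻) ^ g * M ^ g                          ≡⟨ cong (_* M ^ g) (^-*-assoc M⁻ K⁻ g) ⟩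
      M⁻ ^ (K⁻ * g) * M ^ g                          ∎) ⟩
    (M + K⁻) ^ G * (M⁻ ^ (K⁻ * g) * M ^ g)         ≡⟨ *-assoc ((M + K⁻) ^ G) _ _ ⟨
    (M + K⁻) ^ G * M⁻ ^ (K⁻ * g) * M ^ g           ∎)
    where
    eq₁ : ∀ a b c → a * b * c ≡ c * a * b
    eq₁ = solve-∀
    eq₂ : ∀ a b c → a * b * c ≡ b * (c * a)
    eq₂ = solve-∀

  -- The mirror image, from (1 + 1/M)^(K - 1) ≥ 1 + y: a hit rate slightly below 1/K for K > 1 does
  -- not lower V relative to M.
  lower-drift : M ^ (g + K⁻ * G) ≤ C ^ g * suc M ^ (K⁻ * G)
  lower-drift = *-cancelʳ-≤ _ _ (M ^ G) {{m^n≢0 M G}} (begin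
    M ^ (g + K⁻ * G) * M ^ G                       ≡⟨ cong (_* M ^ G) (^-distribˡ-+-* M g (K⁻ * G)) ⟩
    M ^ g * M ^ (K⁻ * G) * M ^ G                   ≡⟨ eq₁ (M ^ g) (M ^ (K⁻ * G)) (M ^ G) ⟩
    M ^ g * M ^ G * M ^ (K⁻ * G)                   ≡⟨ cong (_* M ^ (K⁻ * G)) (^-distribˡ-+-* M g G) ⟨
    M ^ (g + G) * M ^ (K⁻ * G)                     ≤⟨ *-monoˡ-≤ (M ^ (K⁻ * G)) key ⟩
    C ^ g * (M + K⁻) ^ G * M ^ (K⁻ * G)            ≡⟨ eq₂ (C ^ g) ((M + K⁻) ^ G) (M ^ (K⁻ * G)) ⟩
    C ^ g * (M ^ (K⁻ * G) * (M + K⁻) ^ G)          ≤⟨ *-monoʳ-≤ (C ^ g) (begin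
      M ^ (K⁻ * G) * (M + K⁻) ^ G                    ≡⟨ cong (_* (M + K⁻) ^ G) (^-*-assoc M K⁻ G) ⟨
      (M ^ K⁻) ^ G * (M + K⁻) ^ G                    ≡⟨ ^-distribʳ-* (M ^ K⁻) (M + K⁻) G ⟨
      (M ^ K⁻ * (M + K⁻)) ^ G                        ≤⟨ ^-monoˡ-≤ G (bernoulli-+ M K⁻) ⟩
      (suc M ^ K⁻ * M) ^ G                           ≡⟨ ^-distribʳ-* (suc M ^ K⁻) M G ⟩
      (suc M ^ K⁻) ^ G * M ^ G                       ≡⟨ cong (_* M ^ G) (^-*-assoc (suc M) K⁻ G) ⟩
      suc M ^ (K⁻ * G) * M ^ G                       ∎) ⟩
    C ^ g * (suc M ^ (K⁻ * G) * M ^ G)             ≡⟨ *-assoc (C ^ g) _ _ ⟨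
    C ^ g * suc M ^ (K⁻ * G) * M ^ G               ∎)
    where
    eq₁ : ∀ a b c → a * b * c ≡ a * c * b
    eq₁ = solve-∀
    eq₂ : ∀ a b c → a * b * c ≡ a * (c * b)
    eq₂ = solve-∀

  -- The origin of 4 and 8: a deviation of h yields a slack h M = 4 h R K (`hM≡`), and a growth by
  -- 2^s uses up half of it.
  sGM≡ : s * G * M ≡ 2 * (h * R * K)
  sGM≡ = trans (cong₂ (λ G G′ → s * G * (G′ * K)) G≡ G≡) (trans (eq s R K) (cong (λ h → 2 * (h * R * K)) (sym h≡)))
    where
    eq : ∀ s r k → s * (4 * r) * (4 * r * k) ≡ 2 * (8 * r * s * r * k)
    eq = solve-∀

  hM≡ : h * M ≡ 4 * (h * R * K)
  hM≡ = trans (cong (λ G → h * (G * K)) G≡) (eq h R K)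
    where
    eq : ∀ h r k → h * (4 * r * k) ≡ 4 * (h * r * k)
    eq = solve-∀

  private
    1≤g : 1 ≤ g
    1≤g = s≤s⁻¹ (≤-trans (s≤s (s≤s z≤n)) (≤-trans (*-monoʳ-≤ 4 1≤R) (≤-reflexive (sym G≡))))

    hRKG≡ : ∀ a b → a + b ≡ h * R * K → a * G + b * G ≡ h * R * M
    hRKG≡ a b total = trans (sym (*-distribʳ-+ G a b)) (trans (cong (_* G) total) (eq h R K G))
      where
      eq : ∀ h r k g → h * r * k * g ≡ h * r * (g * k)
      eq = solve-∀

    pow-pow : ∀ x y a b n → (x ^ a * y ^ b) ^ n ≡ x ^ (a * n) * y ^ (b * n)
    pow-pow x y a b n = trans (^-distribʳ-* (x ^ a) (y ^ b) n) (cong₂ _*_ (^-*-assoc x a n) (^-*-assoc y b n))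

  -- At a = h R + h the slack 4 h R K splits into 2 h R K for the growth and at most 2 h R K for the
  -- term a (K - 1). Every further hit adds M to one side and only K - 1 to the other.
  upper-exponent : ∀ a b → a + b ≡ h * R * K → h * R + h ≤ a → b * G + s * G * M⁻ ≤ K⁻ * g * a
  upper-exponent a b total le = +-cancelʳ-≤ (a * G + a * K⁻) _ _ (begin
    b * G + s * G * M⁻ + (a * G + a * K⁻)
      ≡⟨ eq₁ (b * G) (s * G * M⁻) (a * G) (a * K⁻) ⟩
    a * G + b * G + s * G * M⁻ + a * K⁻
      ≤⟨ +-mono-≤ (+-mono-≤ (≤-reflexive (hRKG≡ a b total)) (≤-trans (*-monoʳ-≤ (s * G) (n≤1+n M⁻)) (≤-reflexive sGM≡))) ≤-refl ⟩
    h * R * M + 2 * (h * R * K) + a * K⁻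
      ≤⟨ spread ⟩
    a * M
      ≡⟨ eq₂ a g K⁻ ⟩
    K⁻ * g * a + (a * G + a * K⁻) ∎)
    where
    eq₁ : ∀ b s a k → b + s + (a + k) ≡ a + b + s + k
    eq₁ = solve-∀
    eq₂ : ∀ a g k → a * ((1 + g) * (1 + k)) ≡ k * g * a + (a * (1 + g) + a * k)
    eq₂ = solve-∀
    base : h * R * M + 2 * (h * R * K) + (h * R + h) * K⁻ ≤ (h * R + h) * M
    base = begin
      h * R * M + 2 * (h * R * K) + (h * R + h) * K⁻
        ≤⟨ +-monoʳ-≤ (h * R * M + 2 * (h * R * K)) (begin
             (h * R + h) * K⁻       ≤⟨ *-mono-≤ (+-monoʳ-≤ (h * R) (m≤m*n h R {{>-nonZero 1≤R}})) (n≤1+n K⁻) ⟩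
             (h * R + h * R) * K    ≡⟨ eq₃ (h * R) K ⟩
             2 * (h * R * K)        ∎) ⟩
      h * R * M + 2 * (h * R * K) + 2 * (h * R * K)
        ≡⟨ eq₄ (h * R * M) (h * R * K) ⟩
      h * R * M + 4 * (h * R * K)
        ≡⟨ cong (h * R * M +_) hM≡ ⟨
      h * R * M + h * M
        ≡⟨ *-distribʳ-+ M (h * R) h ⟨
      (h * R + h) * M ∎
      where
      eq₃ : ∀ x k → (x + x) * k ≡ 2 * (x * k)
      eq₃ = solve-∀
      eq₄ : ∀ x y → x + 2 * y + 2 * y ≡ x + 4 * y
      eq₄ = solve-∀
    d = a ∸ (h * R + h)
    a≡ : a ≡ h * R + h + d
    a≡ = sym (m+[n∸m]≡n le)
    spread : h * R * M + 2 * (h * R * K) + a * K⁻ ≤ a * M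
    spread = begin
      h * R * M + 2 * (h * R * K) + a * K⁻
        ≡⟨ cong (λ a → h * R * M + 2 * (h * R * K) + a * K⁻) a≡ ⟩
      h * R * M + 2 * (h * R * K) + (h * R + h + d) * K⁻
        ≡⟨ eq₅ (h * R * M + 2 * (h * R * K)) (h * R + h) d K⁻ ⟩
      h * R * M + 2 * (h * R * K) + (h * R + h) * K⁻ + d * K⁻
        ≤⟨ +-mono-≤ base (*-monoʳ-≤ d K⁻≤M) ⟩
      (h * R + h) * M + d * M
        ≡⟨ *-distribʳ-+ M (h * R + h) d ⟨
      (h * R + h + d) * M
        ≡⟨ cong (_* M) a≡ ⟨
      a * M ∎
      where
      eq₅ : ∀ x y d k → x + (y + d) * k ≡ x + y * k + d * k
      eq₅ = solve-∀

  -- Suppose a is too large. Compare the G-th power of the weight with the a-th power of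
  -- `upper-drift`: the hits agree and there are e fewer misses. Each missing miss is worth a factor
  -- M/(M - 1), together at least 2^(s G) by `doubling^`.
  upper-tail : ∀ a b → a + b ≡ h * R * K → (M + K⁻) ^ a * M⁻ ^ b < M ^ (a + b) * 2 ^ s → a < h * R + h
  upper-tail a b total lt with a <? h * R + h
  ... | yes a< = a<
  ... | no  a≮ = contradiction (^-monoˡ-< G lt) (≤⇒≯ (*-cancelʳ-≤ _ _ (M⁻ ^ e) {{m^n≢0 M⁻ e {{M⁻≢0}}}} (begin
    (M ^ (a + b) * 2 ^ s) ^ G * M⁻ ^ e
      ≡⟨ cong (_* M⁻ ^ e) (pow-pow M 2 (a + b) s G) ⟩
    M ^ ((a + b) * G) * 2 ^ (s * G) * M⁻ ^ e
      ≡⟨ *-assoc (M ^ ((a + b) * G)) _ _ ⟩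
    M ^ ((a + b) * G) * (2 ^ (s * G) * M⁻ ^ e)
      ≤⟨ *-monoʳ-≤ (M ^ ((a + b) * G)) (doubling^ M⁻ {{M⁻≢0}} (s * G) slack) ⟩
    M ^ ((a + b) * G) * M ^ e
      ≡⟨ ^-distribˡ-+-* M ((a + b) * G) e ⟨
    M ^ ((a + b) * G + e)
      ≡⟨ cong (M ^_) exponent ⟩
    M ^ ((G + K⁻ * g) * a)
      ≡⟨ ^-*-assoc M (G + K⁻ * g) a ⟨
    (M ^ (G + K⁻ * g)) ^ a
      ≤⟨ ^-monoˡ-≤ a upper-drift ⟩
    ((M + K⁻) ^ G * M⁻ ^ (K⁻ * g)) ^ a
      ≡⟨ pow-pow (M + K⁻) M⁻ G (K⁻ * g) a ⟩
    (M + K⁻) ^ (G * a) * M⁻ ^ (K⁻ * g * a)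
      ≡⟨ cong₂ (λ x y → (M + K⁻) ^ x * M⁻ ^ y) (*-comm G a) (sym e≡) ⟩
    (M + K⁻) ^ (a * G) * M⁻ ^ (b * G + e)
      ≡⟨ cong ((M + K⁻) ^ (a * G) *_) (^-distribˡ-+-* M⁻ (b * G) e) ⟩
    (M + K⁻) ^ (a * G) * (M⁻ ^ (b * G) * M⁻ ^ e)
      ≡⟨ *-assoc ((M + K⁻) ^ (a * G)) _ _ ⟨
    (M + K⁻) ^ (a * G) * M⁻ ^ (b * G) * M⁻ ^ e
      ≡⟨ cong (_* M⁻ ^ e) (pow-pow (M + K⁻) M⁻ a b G) ⟨
    ((M + K⁻) ^ a * M⁻ ^ b) ^ G * M⁻ ^ e ∎)))
    where
    M⁻≢0 : NonZero M⁻
    M⁻≢0 = >-nonZero (≤-trans (*-mono-≤ 1≤g (s≤s z≤n)) (m≤n+m (g * K) K⁻))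
    bound = upper-exponent a b total (≮⇒≥ a≮)
    e = K⁻ * g * a ∸ b * G
    e≡ : b * G + e ≡ K⁻ * g * a
    e≡ = m+[n∸m]≡n (≤-trans (m≤m+n (b * G) _) bound)
    slack : s * G * M⁻ ≤ e
    slack = m+n≤o⇒m≤o∸n _ (≤-trans (≤-reflexive (+-comm _ (b * G))) bound)
    exponent : (a + b) * G + e ≡ (G + K⁻ * g) * a
    exponent = trans (eq a b G e) (trans (cong (G * a +_) e≡) (sym (*-distribʳ-+ a G (K⁻ * g))))
      where
      eq : ∀ a b g e → (a + b) * g + e ≡ g * a + (b * g + e)
      eq = solve-∀

  -- Here 3 h R K of the slack 4 h R K suffice: two parts for the growth and one for a + b.
  lower-exponent : ∀ a b → a + b ≡ h * R * K → a + h ≤ h * R → K⁻ * G * a + s * g * M ≤ b * g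
  lower-exponent a b total le = +-cancelʳ-≤ (a * g + (a + b)) _ _ (begin
    K⁻ * G * a + s * g * M + (a * g + (a + b))
      ≤⟨ +-mono-≤ (+-monoʳ-≤ (K⁻ * G * a) (≤-trans (*-monoˡ-≤ M (*-monoʳ-≤ s (n≤1+n g))) (≤-reflexive sGM≡)))
           (+-mono-≤ (m≤m+n (a * g) a) (≤-reflexive total)) ⟩
    K⁻ * G * a + 2 * (h * R * K) + (a * g + a + h * R * K)
      ≡⟨ eq₁ a g K⁻ (h * R * K) ⟩
    a * M + 3 * (h * R * K)
      ≤⟨ +-monoʳ-≤ (a * M) (*-monoˡ-≤ (h * R * K) (n≤1+n 3)) ⟩
    a * M + 4 * (h * R * K)
      ≡⟨ cong (a * M +_) hM≡ ⟨
    a * M + h * M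
      ≡⟨ *-distribʳ-+ M a h ⟨
    (a + h) * M
      ≤⟨ *-monoˡ-≤ M le ⟩
    h * R * M
      ≡⟨ hRKG≡ a b total ⟨
    a * G + b * G
      ≡⟨ eq₂ a b g ⟩
    b * g + (a * g + (a + b)) ∎)
    where
    eq₁ : ∀ a g k x → k * (1 + g) * a + 2 * x + (a * g + a + x) ≡ a * ((1 + g) * (1 + k)) + 3 * x
    eq₁ = solve-∀
    eq₂ : ∀ a b g → a * (1 + g) + b * (1 + g) ≡ b * g + (a * g + (a + b))
    eq₂ = solve-∀

  -- As for the upper tail, with the powers g of the weight and a of `lower-drift`: now there are f
  -- surplus misses, each worth a factor (M + 1)/M.
  lower-tail : ∀ a b → a + b ≡ h * R * K → C ^ a * suc M ^ b < M ^ (a + b) * 2 ^ s → h * R < a + h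
  lower-tail a b total lt with h * R <? a + h
  ... | yes <a = <a
  ... | no  ≮a = contradiction (^-monoˡ-< g {{>-nonZero 1≤g}} lt) (≤⇒≯ (begin
    (M ^ (a + b) * 2 ^ s) ^ g
      ≡⟨ pow-pow M 2 (a + b) s g ⟩
    M ^ ((a + b) * g) * 2 ^ (s * g)
      ≡⟨ cong (λ x → M ^ x * 2 ^ (s * g)) exponent ⟩
    M ^ ((g + K⁻ * G) * a + f) * 2 ^ (s * g)
      ≡⟨ cong (_* 2 ^ (s * g)) (^-distribˡ-+-* M ((g + K⁻ * G) * a) f) ⟩
    M ^ ((g + K⁻ * G) * a) * M ^ f * 2 ^ (s * g)
      ≡⟨ eq (M ^ ((g + K⁻ * G) * a)) (M ^ f) (2 ^ (s * g)) ⟩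
    M ^ ((g + K⁻ * G) * a) * (2 ^ (s * g) * M ^ f)
      ≤⟨ *-mono-≤ (≤-trans (≤-reflexive (sym (^-*-assoc M (g + K⁻ * G) a))) (^-monoˡ-≤ a lower-drift))
           (doubling^ M (s * g) slack) ⟩
    (C ^ g * suc M ^ (K⁻ * G)) ^ a * suc M ^ f
      ≡⟨ cong (_* suc M ^ f) (pow-pow C (suc M) g (K⁻ * G) a) ⟩
    C ^ (g * a) * suc M ^ (K⁻ * G * a) * suc M ^ f
      ≡⟨ *-assoc (C ^ (g * a)) _ _ ⟩
    C ^ (g * a) * (suc M ^ (K⁻ * G * a) * suc M ^ f)
      ≡⟨ cong (C ^ (g * a) *_) (^-distribˡ-+-* (suc M) (K⁻ * G * a) f) ⟨
    C ^ (g * a) * suc M ^ (K⁻ * G * a + f)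
      ≡⟨ cong₂ (λ x y → C ^ x * suc M ^ y) (*-comm g a) f≡ ⟩
    C ^ (a * g) * suc M ^ (b * g)
      ≡⟨ pow-pow C (suc M) a b g ⟨
    (C ^ a * suc M ^ b) ^ g ∎))
    where
    bound = lower-exponent a b total (≮⇒≥ ≮a)
    f = b * g ∸ K⁻ * G * a
    f≡ : K⁻ * G * a + f ≡ b * g
    f≡ = m+[n∸m]≡n (≤-trans (m≤m+n (K⁻ * G * a) _) bound)
    slack : s * g * M ≤ f
    slack = m+n≤o⇒m≤o∸n _ (≤-trans (≤-reflexive (+-comm _ (K⁻ * G * a))) bound)
    exponent : (a + b) * g ≡ (g + K⁻ * G) * a + f
    exponent = trans (*-distribʳ-+ g a b) (trans (cong (a * g +_) (sym f≡)) (eq₁ a g (K⁻ * G) f))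
      where
      eq₁ : ∀ a g k f → a * g + (k * a + f) ≡ (g + k) * a + f
      eq₁ = solve-∀
    eq : ∀ a b c → a * b * c ≡ a * (c * b)
    eq = solve-∀

tails : ∀ {R K Q s a b} → 1 ≤ R → 1 ≤ K → Q ≡ R * K → a + b ≡ 8 * R * s * R * K →
  ((Q * 4 ∸ 1 + K) ^ a * (Q * 4 ∸ 1) ^ b < (Q * 4) ^ (a + b) * 2 ^ s → a < 8 * R * s * R + 8 * R * s) ×
  ((Q * 4 + 1 ∸ K) ^ a * (Q * 4 + 1) ^ b < (Q * 4) ^ (a + b) * 2 ^ s → 8 * R * s * R < a + 8 * R * s)
tails {R@(suc R⁻)} {suc K⁻} {s = s} {a} {b} 1≤R _ refl total = upper , lower
  where
  g = R⁻ + 3 * R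
  open Tails R (8 * R * s) s g K⁻ 1≤R refl refl using (upper-tail; lower-tail)
  4Q≡ : suc g * suc K⁻ ≡ R * suc K⁻ * 4
  4Q≡ = eq R (suc K⁻)
    where
    eq : ∀ r k → 4 * r * k ≡ r * k * 4
    eq = solve-∀
  upper : _ → a < 8 * R * s * R + 8 * R * s
  upper lt = upper-tail a b total
    (subst (λ x → x ^ a * (K⁻ + g * suc K⁻) ^ b < (suc g * suc K⁻) ^ (a + b) * 2 ^ s) (+-suc (K⁻ + g * suc K⁻) K⁻)
      (subst (λ M → (M ∸ 1 + suc K⁻) ^ a * (M ∸ 1) ^ b < M ^ (a + b) * 2 ^ s) (sym 4Q≡) lt))
  lower : _ → 8 * R * s * R < a + 8 * R * s
  lower lt = lower-tail a b total
    (subst (λ x → (x ∸ suc K⁻) ^ a * x ^ b < (suc g * suc K⁻) ^ (a + b) * 2 ^ s) (+-comm (suc g * suc K⁻) 1)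
      (subst (λ M → (M + 1 ∸ suc K⁻) ^ a * (M + 1) ^ b < M ^ (a + b) * 2 ^ s) (sym 4Q≡) lt))

-- The whole program

findBody findDigit powBody powers logBody logarithm parameters initWeights construction : Program
findBody =
  instr (const 21 1) ⨾
  instr (arith add 12 12 21) ⨾
  instr (arith add 13 13 13) ⨾
  instr (digit 14 12) ⨾
  instr (const 15 1) ⨾
  instr (arith sub 15 15 14)
findDigit =
  instr (const 20 2) ⨾
  instr (arith mul 2 0 20) ⨾
  instr (const 12 0) ⨾
  instr (const 13 1) ⨾
  instr (digit 14 12) ⨾
  instr (const 15 1) ⨾
  instr (arith sub 15 15 14) ⨾
  whileNonZero 15 loop findBody
powBody =
  instr (const 21 1) ⨾
  instr (arith sub 12 12 21) ⨾
  instr (arith mul 3 3 2) ⨾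
  instr (arith add 14 14 14)
powers =
  -- Register 13 held 2^f for the index f of the first digit 1; doubled it is Q = 2^q with q = f +
  -- 1.
  instr (arith add 13 13 13) ⨾
  instr (const 3 1) ⨾
  instr (const 14 1) ⨾
  instr (const 12 0) ⨾
  instr (arith add 12 12 1) ⨾
  whileNonZero 12 loop powBody
logBody =
  instr (const 21 1) ⨾
  instr (arith add 15 15 21) ⨾
  instr (arith add 16 16 16) ⨾
  instr (arith quo 17 0 16)
logarithm =
  instr (const 15 0) ⨾
  instr (const 16 2) ⨾
  instr (arith quo 17 0 16) ⨾
  whileNonZero 17 loop logBody
parameters =
  instr (arith quo 6 13 14) ⨾
  instr (arith mul 6 6 13) ⨾
  instr (arith mul 6 6 15) ⨾
  instr (arith mul 6 6 1) ⨾
  instr (const 21 32) ⨾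
  instr (arith mul 6 6 21) ⨾
  instr (const 21 4) ⨾
  instr (arith mul 5 13 21) ⨾
  instr (const 21 1) ⨾
  instr (arith sub 4 5 21) ⨾
  instr (arith add 5 5 21)
initWeights =
  instr (const 16 0) ⨾
  instr (arith add 16 16 3) ⨾
  whileNonZero 16 loop initBody
construction =
  findDigit ⨾
  powers ⨾
  logarithm ⨾
  parameters ⨾
  initWeights ⨾
  whileNonZero 6 loop mainBody

÷≢0 : ∀ {x y} → 1 ≤ y → y ≤ x → x ÷ y ≢ 0
÷≢0 {x} {suc y} _ y≤x eq = <⇒≱ (m/n≡0⇒m<n {x} {suc y} eq) y≤x

<⇒÷≡0 : ∀ {x y} → x < y → x ÷ y ≡ 0
<⇒÷≡0 {y = suc y} = m<n⇒m/n≡0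

double : ∀ x → x + x ≡ 2 * x
double x = cong (x +_) (sym (+-identityʳ x))

n<2^n : ∀ n → n < 2 ^ n
n<2^n zero    = s≤s z≤n
n<2^n (suc n) = ≤-trans (+-mono-≤ (m^n>0 2 n) (n<2^n n)) (≤-reflexive (double (2 ^ n)))

-- The number m of rows, in the order in which `parameters` multiplies. The quotient is exact when
-- it is used, so its product with Q is 2^(2q - k).
roundsOf : ℕ → ℕ → ℕ → ℕ → ℕ
roundsOf k Q K l = Q ÷ K * Q * l * k * 32

bit≤1 : ∀ b → bit b ≤ 1
bit≤1 true  = ≤-refl
bit≤1 false = z≤n

-- Places ε between 2^-(f + 1) and 2^-f.
FirstDigit : Real01 → ℕ → Set
FirstDigit ε f = ε f ≡ true × (∀ i → i < f → ε i ≡ false)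

-- Correctness of the set-up phases and of the whole run

module Setup (ε : Real01) (H Z : ℕ) (3≤H : 3 ≤ H) (H≤Z : H ≤ Z) where
  open Main ε H Z 3≤H H≤Z public

  FindInv : List ℕ → ℕ → ℕ → State → Set
  FindInv g f j s =
    snap 3 (reg s) ≡ g × output s ≡ [] ×
    reg s 12 + j ≡ f × reg s 13 ≡ 2 ^ reg s 12 × reg s 15 ≡ 1 ∸ bit (ε (reg s 12))

  findBody-spec : ∀ g f → f ≤ H → 2 ^ f ≤ H → ∀ j s → FindInv g f (suc j) s → Tri 6 findBody s (FindInv g f j)
  findBody-spec g f f≤H 2^f≤H j (state r _ _) (refl , refl , i≡ , Q≡ , flag≡) =
    step (size≤κ 1≤Z) $
    step (add≤κ (small i≤H) 1≤Z) $
    step (add≤κ (small Q≤H) (small Q≤H)) $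
    step (size≤κ (small i+1≤H)) $
    step (size≤κ 1≤Z) $
    last (add≤κ 1≤Z (≤-trans (bit≤1 (ε (r 12 + 1))) 1≤Z))
      ( refl , refl , trans (+-assoc (r 12) 1 j) i≡
      , trans (cong (λ Q → Q + Q) Q≡) (trans (double (2 ^ r 12)) (cong (2 ^_) (+-comm 1 (r 12))))
      , refl )
    where
    i+1≤f : r 12 + 1 ≤ f
    i+1≤f = ≤-trans (+-monoʳ-≤ (r 12) (s≤s z≤n)) (≤-reflexive i≡)
    i+1≤H : r 12 + 1 ≤ H
    i+1≤H = ≤-trans i+1≤f f≤H
    i≤H : r 12 ≤ H
    i≤H = ≤-trans (m≤m+n (r 12) 1) i+1≤H
    Q≤H : r 13 ≤ H
    Q≤H = ≤-trans (≤-reflexive Q≡) (≤-trans (^-monoʳ-≤ 2 (≤-trans (m≤m+n (r 12) 1) i+1≤f)) 2^f≤H)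

  findDigit-spec : ∀ f n k → FirstDigit ε f → n ≤ H → f ≤ H → 2 ^ f ≤ H →
    Tri (7 + (f * 7 + 1)) findDigit (initial n k)
      (λ s → snap 3 (reg s) ≡ n ∷ k ∷ n * 2 ∷ [] × output s ≡ [] × reg s 13 ≡ 2 ^ f)
  findDigit-spec f n k (first , before) n≤H f≤H 2^f≤H =
    weaken ≤-refl (λ { s (keep , out≡ , i≡ , Q≡ , _) → keep , out≡ ,
      trans Q≡ (cong (2 ^_) (trans (sym (+-identityʳ _)) i≡)) }) $
    step (size≤κ 2≤Z) $
    step (mul≤κ n≤H 2≤Z) $
    step (size≤κ 0≤Z) $
    step (size≤κ 1≤Z) $
    step (size≤κ 0≤Z) $
    step (size≤κ 1≤Z) $
    step (add≤κ 1≤Z (≤-trans (bit≤1 (ε 0)) 1≤Z)) $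
    while (FindInv (n ∷ k ∷ n * 2 ∷ []) f)
      (λ { j s (_ , _ , _ , _ , flag≡) → size≤κ (≤-trans (≤-reflexive flag≡) (≤-trans (m∸n≤m 1 (bit (ε (reg s 12)))) 1≤Z)) })
      (λ { s (_ , _ , i≡ , _ , flag≡) → trans flag≡ (cong (λ b → 1 ∸ bit b)
           (trans (cong ε (trans (sym (+-identityʳ _)) i≡)) first)) })
      (λ { j s (_ , _ , i≡ , _ , flag≡) z → contradiction (trans (sym z) (trans flag≡ (cong (λ b → 1 ∸ bit b)
           (before (reg s 12) (≤-trans (≤-trans (s≤s (m≤m+n _ j)) (≤-reflexive (sym (+-suc _ j)))) (≤-reflexive i≡)))))) λ () })
      (findBody-spec _ f f≤H 2^f≤H)
      f _ (refl , refl , refl , refl , refl)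

  PowInv : List ℕ → ℕ → ℕ → State → Set
  PowInv g Q j s =
    snap 3 (reg s) ≡ g × output s ≡ [] × reg s 13 ≡ Q × reg s 12 ≡ j × reg s 12 ≤ H ×
    reg s 3 * look g 2 ^ j ≡ look g 2 ^ look g 1 × reg s 14 * 2 ^ j ≡ 2 ^ look g 1

  powBody-spec : ∀ g Q → 1 ≤ look g 2 → look g 2 ≤ H → look g 2 ^ look g 1 ≤ H → 2 ^ look g 1 ≤ H →
    ∀ j s → PowInv g Q (suc j) s → Tri 4 powBody s (PowInv g Q j)
  powBody-spec g Q 1≤B B≤H N≤H K≤H j (state r _ _) (refl , refl , refl , j≡ , j≤ , N≡ , K≡) =
    step (size≤κ 1≤Z) $
    step (add≤κ (small j≤) 1≤Z) $
    step (mul≤κ N′≤ (small B≤H)) $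
    last (add≤κ (small K′≤) (small K′≤))
      ( refl , refl , refl , cong (_∸ 1) j≡ , ≤-trans (m∸n≤m (r 12) 1) j≤
      , trans (*-assoc (r 3) (r 2) _) N≡
      , trans (eq (r 14) (2 ^ j)) K≡ )
    where
    eq : ∀ a p → (a + a) * p ≡ a * (2 * p)
    eq = solve-∀
    N′≤ : r 3 ≤ H
    N′≤ = ≤-trans (m≤m*n (r 3) (r 2 ^ suc j) {{m^n≢0 (r 2) (suc j) {{>-nonZero 1≤B}}}}) (≤-trans (≤-reflexive N≡) N≤H)
    K′≤ : r 14 ≤ H
    K′≤ = ≤-trans (m≤m*n (r 14) (2 ^ suc j) {{m^n≢0 2 (suc j)}}) (≤-trans (≤-reflexive K≡) K≤H)

  powers-spec : ∀ s (let r = reg s) → output s ≡ [] → r 13 ≤ H → r 1 ≤ H →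
    1 ≤ r 2 → r 2 ≤ H → r 2 ^ r 1 ≤ H → 2 ^ r 1 ≤ H →
    Tri (5 + (r 1 * 5 + 1)) powers s (λ s′ → snap 3 (reg s′) ≡ snap 3 r × output s′ ≡ [] ×
      reg s′ 13 ≡ r 13 + r 13 × reg s′ 3 ≡ r 2 ^ r 1 × reg s′ 14 ≡ 2 ^ r 1)
  powers-spec (state r m _) refl Q≤H k≤H 1≤B B≤H N≤H K≤H =
    weaken ≤-refl (λ { s (keep , out≡ , Q≡ , _ , _ , N≡ , K≡) → keep , out≡ , Q≡ ,
      trans (sym (*-identityʳ _)) N≡ , trans (sym (*-identityʳ _)) K≡ }) $
    step (add≤κ (small Q≤H) (small Q≤H)) $
    step (size≤κ 1≤Z) $
    step (size≤κ 1≤Z) $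
    step (size≤κ 0≤Z) $
    step (add≤κ 0≤Z (small k≤H)) $
    countdown (PowInv (snap 3 r) (r 13 + r 13))
      (λ { _ _ (_ , _ , _ , _ , j≤ , _) → size≤κ (small j≤) })
      (λ { _ _ (_ , _ , _ , j≡ , _) → j≡ })
      (powBody-spec (snap 3 r) (r 13 + r 13) 1≤B B≤H N≤H K≤H)
      (r 1) _ (refl , refl , refl , refl , k≤H , *-identityˡ _ , *-identityˡ _)

  -- Register 15 counts up to l, the logarithm of n: the tested quotient n ÷ 2^(i + 1) is nonzero
  -- exactly while i is less than l.
  LogInv : List ℕ → ℕ → ℕ → State → Set
  LogInv g l j s =
    snap 15 (reg s) ≡ g × output s ≡ [] ×
    reg s 15 + j ≡ l × reg s 16 ≡ 2 ^ suc (reg s 15) × reg s 17 ≡ look g 0 ÷ reg s 16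

  logBody-spec : ∀ g l → look g 0 ≤ H → l ≤ H → 2 ^ suc l ≤ H → ∀ j s → LogInv g l (suc j) s → Tri 4 logBody s (LogInv g l j)
  logBody-spec g l n≤H l≤H 2^l≤H j (state r _ _) (refl , refl , i≡ , p≡ , z≡) =
    step (size≤κ 1≤Z) $
    step (add≤κ (small (≤-trans (m≤m+n (r 15) (suc j)) (≤-trans (≤-reflexive i≡) l≤H))) 1≤Z) $
    step (add≤κ (small (≤-trans (m≤m+n (r 16) (r 16)) 2p≤)) (small (≤-trans (m≤m+n (r 16) (r 16)) 2p≤))) $
    last (mul≤κ n≤H (small 2p≤))
      (refl , refl , trans (+-assoc (r 15) 1 j) i≡ , p′≡ , refl)
    where
    p′≡ : r 16 + r 16 ≡ 2 ^ suc (r 15 + 1)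
    p′≡ = trans (cong (λ p → p + p) p≡) (trans (double (2 ^ suc (r 15))) (cong (λ x → 2 ^ suc x) (+-comm 1 (r 15))))
    2p≤ : r 16 + r 16 ≤ H
    2p≤ = ≤-trans (≤-reflexive p′≡) (≤-trans (^-monoʳ-≤ 2 (s≤s (≤-trans (+-monoʳ-≤ (r 15) (s≤s z≤n)) (≤-reflexive i≡)))) 2^l≤H)

  logarithm-spec : ∀ l s (let r = reg s) → output s ≡ [] → 2 ^ l ≤ r 0 → r 0 < 2 ^ suc l → r 0 ≤ H → l ≤ H → 2 ^ suc l ≤ H →
    Tri (3 + (l * 5 + 1)) logarithm s (λ s′ → snap 15 (reg s′) ≡ snap 15 r × output s′ ≡ [] × reg s′ 15 ≡ l)
  logarithm-spec l (state r m _) refl 2^l≤n n< n≤H l≤H 2^l≤H =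
    weaken ≤-refl (λ { s (keep , out≡ , i≡ , _) → keep , out≡ , trans (sym (+-identityʳ _)) i≡ }) $
    step (size≤κ 0≤Z) $
    step (size≤κ 2≤Z) $
    step (mul≤κ n≤H 2≤Z) $
    while (LogInv (snap 15 r) l)
      (λ { _ s (_ , _ , _ , _ , z≡) → size≤κ (small (≤-trans (≤-reflexive z≡) (≤-trans (÷≤ (r 0) (reg s 16)) n≤H))) })
      (λ { s (_ , _ , i≡ , p≡ , z≡) → trans z≡ (<⇒÷≡0
           (subst (r 0 <_) (sym (trans p≡ (cong (λ x → 2 ^ suc x) (trans (sym (+-identityʳ _)) i≡)))) n<)) })
      (λ { j s (_ , _ , i≡ , p≡ , z≡) z → ÷≢0 (subst (1 ≤_) (sym p≡) (m^n>0 2 (suc (reg s 15))))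
           (≤-trans (≤-reflexive p≡) (≤-trans (^-monoʳ-≤ 2
             (≤-trans (≤-trans (s≤s (m≤m+n _ j)) (≤-reflexive (sym (+-suc _ j)))) (≤-reflexive i≡))) 2^l≤n))
           (trans (sym z≡) z) })
      (logBody-spec (snap 15 r) l n≤H l≤H 2^l≤H)
      l _ (refl , refl , refl , refl , refl)

  parameters-spec : ∀ s (let r = reg s) → output s ≡ [] → 1 ≤ r 1 → 32 ≤ Z → r 14 ≤ H →
    roundsOf (r 1) (r 13) (r 14) (r 15) ≤ H → 1 ≤ r 15 → r 15 ≤ H → r 1 ≤ H → r 13 * 4 + 1 ≤ H →
    Tri 11 parameters s (λ s′ → snap 4 (reg s′) ≡ snap 4 r × output s′ ≡ [] ×
      reg s′ 4 ≡ r 13 * 4 ∸ 1 × reg s′ 5 ≡ r 13 * 4 + 1 ×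
      reg s′ 6 ≡ roundsOf (r 1) (r 13) (r 14) (r 15))
  parameters-spec (state r m _) refl 1≤k 32≤Z K≤H rounds≤H 1≤l l≤H k≤H M≤H =
    step (mul≤κ Q≤H (small K≤H)) $
    step (mul≤κ (≤-trans (÷≤ (r 13) (r 14)) Q≤H) (small Q≤H)) $
    step (mul≤κ a₂≤ (small l≤H)) $
    step (mul≤κ a₃≤ (small k≤H)) $
    step (size≤κ 32≤Z) $
    step (mul≤κ a₄≤ 32≤Z) $
    step (size≤κ 4≤Z) $
    step (mul≤κ Q≤H 4≤Z) $
    step (size≤κ 1≤Z) $
    step (add≤κ (small 4Q≤H) 1≤Z) $
    last (add≤κ (small 4Q≤H) 1≤Z) (refl , refl , refl , refl , refl)
    where
    4Q≤H : r 13 * 4 ≤ H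
    4Q≤H = ≤-trans (m≤m+n _ 1) M≤H
    Q≤H : r 13 ≤ H
    Q≤H = ≤-trans (m≤m*n (r 13) 4) 4Q≤H
    4≤Z : 4 ≤ Z
    4≤Z = ≤-trans (s≤s (s≤s (s≤s (s≤s z≤n)))) 32≤Z
    a₂ = r 13 ÷ r 14 * r 13
    a₄≤ : a₂ * r 15 * r 1 ≤ H
    a₄≤ = ≤-trans (m≤m*n (a₂ * r 15 * r 1) 32) rounds≤H
    a₃≤ : a₂ * r 15 ≤ H
    a₃≤ = ≤-trans (m≤m*n (a₂ * r 15) (r 1) {{>-nonZero 1≤k}}) a₄≤
    a₂≤ : a₂ ≤ H
    a₂≤ = ≤-trans (m≤m*n a₂ (r 15) {{>-nonZero 1≤l}}) a₃≤

  initWeights-spec : ∀ s (let r = reg s) → output s ≡ [] →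
    1 ≤ r 1 → r 1 ≤ H → 1 ≤ r 2 → r 2 ≤ H → r 3 * 3 + 2 ≤ H →
    Tri (2 + (r 3 * suc (31 * r 1) + 1)) initWeights s (λ s′ → snap 16 (reg s′) ≡ snap 16 r × output s′ ≡ [] ×
      Stored (r 3) (increasing (r 2) (r 1) 0) (increasing (r 2) (r 1) 0) (mem s′))
  initWeights-spec (state r m _) refl 1≤k k≤H 1≤B B≤H 3N≤H =
    weaken ≤-refl (λ { s (keep , out≡ , _ , _ , _ , U≡ , V≡) → keep , out≡ , (λ c c< → U≡ c z≤n c<) , (λ c c< → V≡ c z≤n c<) }) $
    step (size≤κ 0≤Z) $
    step (add≤κ 0≤Z (small N≤H)) $
    countdown (InitInv (snap 16 r) [])
      (λ { _ _ (_ , _ , _ , y≤ , _) → size≤κ (small y≤) })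
      (λ { _ _ (_ , _ , y≡ , _) → y≡ })
      (initBody-spec (snap 16 r) [] 1≤k k≤H 1≤B B≤H 3N≤H)
      (r 3) _
      (refl , refl , refl , N≤H , ≤-refl ,
       (λ c N≤c c< → contradiction (≤-trans c< N≤c) (<-irrefl refl)) , (λ c N≤c c< → contradiction (≤-trans c< N≤c) (<-irrefl refl)))
    where
    N≤H : r 3 ≤ H
    N≤H = ≤-trans (m≤m*n (r 3) 3) (≤-trans (m≤m+n (r 3 * 3) 2) 3N≤H)

  module _ {n k f l Q rounds : ℕ} (first : FirstDigit ε f)
    (Q≡ : Q ≡ 2 ^ f + 2 ^ f) (rounds≡ : rounds ≡ roundsOf k Q (2 ^ k) l)
    (fixed : Fixed n k (n * 2) ((n * 2) ^ k) (Q * 4 ∸ 1) (Q * 4 + 1))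
    (2^l≤n : 2 ^ l ≤ n) (n< : n < 2 ^ suc l) (1≤l : 1 ≤ l) (32≤Z : 32 ≤ Z) (k≤f : k ≤ f)
    (rounds≤H : rounds ≤ H)
    (growth≤Z : (Q * 4 + 1 + 2 ^ k) * (Q * 4 + 1 + 2 ^ k) ^ rounds ≤ Z)
    (sums≤Z : k * ((n * 2) ^ k * (2 ^ k * (Q * 4 + 1 + 2 ^ k) ^ rounds)) + k * ((n * 2) ^ k * (2 ^ k * (Q * 4 + 1 + 2 ^ k) ^ rounds)) ≤ Z) where
    open Fixed fixed
    private
      B N M⁻ M⁺ : ℕ
      B = n * 2
      N = B ^ k
      M⁻ = Q * 4 ∸ 1
      M⁺ = Q * 4 + 1

      2^f≤Q : 2 ^ f ≤ Q
      2^f≤Q = ≤-trans (m≤m+n (2 ^ f) (2 ^ f)) (≤-reflexive (sym Q≡))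

      f≤Q : f ≤ Q
      f≤Q = ≤-trans (<⇒≤ (n<2^n f)) 2^f≤Q

      Q≤M⁺ : Q * 4 ≤ M⁺
      Q≤M⁺ = m≤m+n (Q * 4) 1

      Q≤H : Q ≤ H
      Q≤H = ≤-trans (m≤m*n Q 4) (≤-trans Q≤M⁺ M⁺≤H)

      B≤H : B ≤ H
      B≤H = ≤-trans (m≤m*n B 3) 3B≤H

      N≤H : N ≤ H
      N≤H = ≤-trans (m≤m*n N 3) (≤-trans (m≤m+n (N * 3) 2) 3N≤H)

      l≤n : l ≤ n
      l≤n = ≤-trans (<⇒≤ (n<2^n l)) 2^l≤n

      2^l≤B : 2 ^ suc l ≤ B
      2^l≤B = ≤-trans (*-monoʳ-≤ 2 2^l≤n) (≤-reflexive (*-comm 2 n))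

      1≤N : 1 ≤ N
      1≤N = m^n>0 B {{>-nonZero 1≤B}} k

      1≤Q÷K : 1 ≤ Q ÷ 2 ^ k
      1≤Q÷K = n≢0⇒n>0 (÷≢0 (m^n>0 2 k) (≤-trans (^-monoʳ-≤ 2 k≤f) 2^f≤Q))

      Found Powered Logged Prepared Initialised : State → Set
      Found s = snap 3 (reg s) ≡ n ∷ k ∷ B ∷ [] × output s ≡ [] × reg s 13 ≡ 2 ^ f
      Powered s = snap 4 (reg s) ≡ n ∷ k ∷ B ∷ N ∷ [] × output s ≡ [] × reg s 13 ≡ Q × reg s 14 ≡ 2 ^ k
      Logged s = Powered s × reg s 15 ≡ l
      Prepared s = snap 7 (reg s) ≡ n ∷ k ∷ B ∷ N ∷ M⁻ ∷ M⁺ ∷ rounds ∷ [] × output s ≡ []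
      Initialised s = Prepared s × Stored N (increasing B k 0) (increasing B k 0) (mem s)

      powers-phase : ∀ s → Found s → Tri (5 + (k * 5 + 1)) powers s Powered
      powers-phase s (keep , out≡ , q≡) = weaken (≤-reflexive (cong (λ k → 5 + (k * 5 + 1)) (cong (λ l → look l 1) keep)))
        (λ { s′ (keep′ , out′≡ , Q≡′ , N≡′ , K≡′) →
          four {reg s′} (trans keep′ keep) (trans N≡′ (cong (λ l → look l 2 ^ look l 1) keep)) ,
          out′≡ , trans Q≡′ (trans (cong₂ _+_ q≡ q≡) (sym Q≡)) , trans K≡′ (cong (λ l → 2 ^ look l 1) keep) })
        (powers-spec s out≡ (≤-trans (≤-reflexive q≡) (≤-trans 2^f≤Q Q≤H)) (back (λ l → look l 1 ≤ H) k≤H)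
          (back (λ l → 1 ≤ look l 2) 1≤B) (back (λ l → look l 2 ≤ H) B≤H)
          (back (λ l → look l 2 ^ look l 1 ≤ H) N≤H) (back (λ l → 2 ^ look l 1 ≤ H) 2^k≤))
        where
        back : (P : List ℕ → Set) → P (n ∷ k ∷ B ∷ []) → P (snap 3 (reg s))
        back P = subst P (sym keep)
        four : ∀ {r : ℕ → ℕ} → snap 3 r ≡ n ∷ k ∷ B ∷ [] → r 3 ≡ N → snap 4 r ≡ n ∷ k ∷ B ∷ N ∷ []
        four eq eq₃ = cong₂ (λ l x → l ++ x ∷ []) eq eq₃

      log-phase : ∀ s → Powered s → Tri (3 + (l * 5 + 1)) logarithm s Logged
      log-phase s (keep , out≡ , Q≡ , K≡) = weaken ≤-refl
        (λ { s′ (keep′ , out′≡ , l≡) → (trans (cong (take 4) keep′) keep , out′≡ ,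
          trans (cong (λ l → look l 13) keep′) Q≡ , trans (cong (λ l → look l 14) keep′) K≡) , l≡ })
        (logarithm-spec l s out≡ (back (λ r → 2 ^ l ≤ look r 0) 2^l≤n) (back (λ r → look r 0 < 2 ^ suc l) n<)
          (back (λ r → look r 0 ≤ H) n≤H) (≤-trans l≤n n≤H) (≤-trans 2^l≤B B≤H))
        where
        back : (P : List ℕ → Set) → P (n ∷ k ∷ B ∷ N ∷ []) → P (snap 4 (reg s))
        back P = subst P (sym keep)

      parameters-phase : ∀ s → Logged s → Tri 11 parameters s Prepared
      parameters-phase s ((keep , out≡ , q≡ , K≡) , l≡) = weaken ≤-refl
        (λ { s′ (keep′ , out′≡ , M⁻≡ , M⁺≡′ , rounds≡′) →
          seven {reg s′} (trans keep′ keep) (trans M⁻≡ (cong (λ Q → Q * 4 ∸ 1) q≡)) (trans M⁺≡′ (cong (λ Q → Q * 4 + 1) q≡))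
            (trans rounds≡′ parameter-rounds) , out′≡ })
        (parameters-spec s out≡ (back (λ l → 1 ≤ look l 1) 1≤k) 32≤Z (≤-trans (≤-reflexive K≡) 2^k≤)
          (≤-trans (≤-reflexive parameter-rounds) rounds≤H) (subst (1 ≤_) (sym l≡) 1≤l)
          (≤-trans (≤-reflexive l≡) (≤-trans l≤n n≤H)) (back (λ l → look l 1 ≤ H) k≤H)
          (subst (λ Q → Q * 4 + 1 ≤ H) (sym q≡) M⁺≤H))
        where
        back : (P : List ℕ → Set) → P (n ∷ k ∷ B ∷ N ∷ []) → P (snap 4 (reg s))
        back P = subst P (sym keep)
        parameter-rounds : roundsOf (reg s 1) (reg s 13) (reg s 14) (reg s 15) ≡ rounds
        parameter-rounds = trans (cong (λ k → roundsOf k (reg s 13) (reg s 14) (reg s 15)) (cong (λ l → look l 1) keep))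
          (trans (cong (λ Q → roundsOf k Q (reg s 14) (reg s 15)) q≡) (trans (cong₂ (roundsOf k Q) K≡ l≡) (sym rounds≡)))
        seven : ∀ {r : ℕ → ℕ} {a b c} → snap 4 r ≡ n ∷ k ∷ B ∷ N ∷ [] → r 4 ≡ a → r 5 ≡ b → r 6 ≡ c →
          snap 7 r ≡ n ∷ k ∷ B ∷ N ∷ a ∷ b ∷ c ∷ []
        seven {r} eq refl refl refl = cong (_++ r 4 ∷ r 5 ∷ r 6 ∷ []) eq

      init-phase : ∀ s → Prepared s → Tri (2 + (N * suc (31 * k) + 1)) initWeights s Initialised
      init-phase s (keep , out≡) = weaken (≤-reflexive (cong (λ l → 2 + (look l 3 * suc (31 * look l 1) + 1)) keep))
        (λ { s′ (keep′ , out′≡ , stored) → (trans (cong (take 7) keep′) keep , out′≡) ,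
          subst (λ l → Stored (look l 3) (increasing (look l 2) (look l 1) 0) (increasing (look l 2) (look l 1) 0) (mem s′)) keep stored })
        (initWeights-spec s out≡ (back (λ l → 1 ≤ look l 1) 1≤k) (back (λ l → look l 1 ≤ H) k≤H)
          (back (λ l → 1 ≤ look l 2) 1≤B) (back (λ l → look l 2 ≤ H) B≤H) (back (λ l → look l 3 * 3 + 2 ≤ H) 3N≤H))
        where
        back : (P : List ℕ → Set) → P (n ∷ k ∷ B ∷ N ∷ M⁻ ∷ M⁺ ∷ rounds ∷ []) → P (snap 7 (reg s))
        back P = subst P (sym keep)

      main-phase : ∀ s → Initialised s → Tri (rounds * suc (183 * (k * (k * N))) + 1) (whileNonZero 6 loop mainBody) s (MainInv n k B N M⁻ M⁺ rounds 0)
      main-phase s ((keep , out≡) , U≡ , V≡) =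
        countdown (MainInv n k B N M⁻ M⁺ rounds)
          (λ { _ _ (_ , _ , j≤ , _) → size≤κ (small j≤) })
          (λ { _ _ (_ , j≡ , _) → j≡ })
          (mainBody-spec fixed growth≤Z sums≤Z)
          rounds s
          ( cong (take 6) keep , left≡ , ≤-trans (≤-reflexive left≡) rounds≤H , [] , refl , out≡
          , ((λ c c< → trans (U≡ c c<) (sym (*-identityʳ _))) , (λ c c< → trans (V≡ c c<) (sym (*-identityʳ _))))
          , ≤-trans (+-mono-≤ total≤ total≤) (≤-reflexive (trans (double N) (sym (+-identityʳ (2 * N))))) )
        where
        left≡ : reg s 6 ≡ rounds
        left≡ = cong (λ l → look l 6) keep
        total≤ : sumBelow (λ c → increasing B k 0 c * 1) N ≤ N
        total≤ = ≤-trans (sum-mono N λ c _ → ≤-trans (≤-reflexive (*-identityʳ _)) (increasing≤1 B k 0 c))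
          (≤-reflexive (trans (sum-const 1 N) (*-identityʳ N)))

    effort : ℕ
    effort = rounds * (k * (k * N))

    private
      cost≤ : 7 + (f * 7 + 1) + (5 + (k * 5 + 1) + (3 + (l * 5 + 1) + (11 + (2 + (N * suc (31 * k) + 1) +
        (rounds * suc (183 * (k * (k * N))) + 1))))) ≤ 266 * effort
      cost≤ = ≤-trans
        (+-mono-≤ (const≤ 7) (+-mono-≤ (+-mono-≤ (times≤ 7 f≤) (const≤ 1)) (+-mono-≤ (+-mono-≤ (const≤ 5) (+-mono-≤ (times≤ 5 k≤) (const≤ 1)))
          (+-mono-≤ (+-mono-≤ (const≤ 3) (+-mono-≤ (times≤ 5 l≤) (const≤ 1))) (+-mono-≤ (const≤ 11) (+-mono-≤ (+-mono-≤ (const≤ 2) init≤) main≤))))))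
        (≤-reflexive (eq effort))
        where
        1≤Q : 1 ≤ Q
        1≤Q = ≤-trans (m^n>0 2 f) 2^f≤Q
        1≤kkN : 1 ≤ k * (k * N)
        1≤kkN = *-mono-≤ 1≤k (*-mono-≤ 1≤k 1≤N)
        factors : ∀ {a b} → 1 ≤ b → a ≤ a * b
        factors {a} {b} 1≤b = m≤m*n a b {{>-nonZero 1≤b}}
        Ql≤rounds : Q * l ≤ rounds
        Ql≤rounds = ≤-trans (≤-trans (≤-trans (*-monoˡ-≤ l (m≤n*m Q (Q ÷ 2 ^ k) {{>-nonZero 1≤Q÷K}})) (factors 1≤k)) (factors (s≤s z≤n)))
          (≤-reflexive (sym rounds≡))
        Q≤rounds : Q ≤ rounds
        Q≤rounds = ≤-trans (factors 1≤l) Ql≤rounds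
        rounds≤ : rounds ≤ effort
        rounds≤ = factors 1≤kkN
        1≤rounds : 1 ≤ rounds
        1≤rounds = ≤-trans 1≤Q Q≤rounds
        kkN≤ : k * (k * N) ≤ effort
        kkN≤ = m≤n*m (k * (k * N)) rounds {{>-nonZero 1≤rounds}}
        kN≤ : k * N ≤ effort
        kN≤ = ≤-trans (m≤n*m (k * N) k {{>-nonZero 1≤k}}) kkN≤
        const≤ : ∀ a → a ≤ a * effort
        const≤ a = m≤m*n a effort {{>-nonZero (≤-trans 1≤rounds rounds≤)}}
        times≤ : ∀ {x} a → x ≤ effort → x * a ≤ a * effort
        times≤ {x} a x≤ = ≤-trans (≤-reflexive (*-comm x a)) (*-monoʳ-≤ a x≤)
        f≤ : f ≤ effort
        f≤ = ≤-trans f≤Q (≤-trans Q≤rounds rounds≤)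
        k≤ : k ≤ effort
        k≤ = ≤-trans (factors 1≤N) kN≤
        l≤ : l ≤ effort
        l≤ = ≤-trans (m≤n*m l Q {{>-nonZero 1≤Q}}) (≤-trans Ql≤rounds rounds≤)
        init≤ : N * suc (31 * k) + 1 ≤ 33 * effort
        init≤ = ≤-trans (loop-≤ N 31 1≤N 1≤k) (*-monoʳ-≤ 33 (≤-trans (≤-reflexive (*-comm N k)) kN≤))
        main≤ : rounds * suc (183 * (k * (k * N))) + 1 ≤ 185 * effort
        main≤ = loop-≤ rounds 183 1≤rounds 1≤kkN
        eq : ∀ x → 7 * x + (7 * x + 1 * x + (5 * x + (5 * x + 1 * x) + (3 * x + (5 * x + 1 * x) + (11 * x + (2 * x + 33 * x + 185 * x))))) ≡ 266 * x
        eq = solve-∀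

    construction-spec : Tri (266 * effort) construction (initial n k) (MainInv n k B N M⁻ M⁺ rounds 0)
    construction-spec =
      weaken cost≤ (λ _ post → post) $
      bind (findDigit-spec f n k first n≤H (≤-trans f≤Q Q≤H) (≤-trans 2^f≤Q Q≤H)) λ s₁ found →
      bind (powers-phase s₁ found) λ s₂ powered →
      bind (log-phase s₂ powered) λ s₃ logged →
      bind (parameters-phase s₃ logged) λ s₄ prepared →
      bind (init-phase s₄ prepared) λ s₅ initialised →
      main-phase s₅ initialised

-- Rational and binary bounds

fraction-<⁻ : ∀ {a b c d} .{{_ : NonZero b}} .{{_ : NonZero d}} → pos a /ℚ b <ℚ pos c /ℚ d → a * d < c * b
fraction-<⁻ {a} {suc b} {c} {suc d} lt with ℚᵘ.<-respʳ-≃ (ℚ.toℚᵘ-fromℚᵘ (mkℚᵘ (pos c) d)) (ℚᵘ.<-respˡ-≃ (ℚ.toℚᵘ-fromℚᵘ (mkℚᵘ (pos a) b)) (ℚ.toℚᵘ-mono-< lt))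
... | *<* lt′ = ℤ.drop‿+<+ (subst₂ ℤ._<_ (sym (ℤ.pos-* a (suc d))) (sym (ℤ.pos-* c (suc b))) lt′)

∣⊖∣≤ : ∀ {x y w} → x ≤ y + w → y ≤ x + w → ℤ.∣ x ⊖ y ∣ ≤ w
∣⊖∣≤ {x} {y} {w} x≤ y≤ with ≤-total x y
... | inj₁ x≤y = ≤-trans (≤-reflexive (ℤ.∣⊖∣-≤ x≤y)) (m≤n+o⇒m∸n≤o y x y≤)
... | inj₂ y≤x = ≤-trans (≤-reflexive (trans (ℤ.∣m⊖n∣≡∣n⊖m∣ x y) (ℤ.∣⊖∣-≤ y≤x))) (m≤n+o⇒m∸n≤o x y x≤)

-- Confines the passage through integers and rationals to one place: w bounds the numerator of the
-- difference over the common denominator b d.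
fraction-distance : ∀ {a b c d e g} w .{{_ : NonZero b}} .{{_ : NonZero d}} .{{_ : NonZero g}} →
  a * d ≤ c * b + w → c * b ≤ a * d + w → w * g ≤ e * (b * d) →
  ∣ (pos a /ℚ b) -ℚ (pos c /ℚ d) ∣ℚ ≤ℚ pos e /ℚ g
fraction-distance {a} {suc b} {c} {suc d} {e} {suc g} w ad≤ cb≤ wg≤ = ℚ.toℚᵘ-cancel-≤
  (ℚᵘ.≤-respˡ-≃ (ℚᵘ.≃-sym left) (ℚᵘ.≤-respʳ-≃ (ℚᵘ.≃-sym (ℚ.toℚᵘ-fromℚᵘ (mkℚᵘ (pos e) g))) (*≤* bound)))
  where
  x = pos a /ℚ suc b
  y = pos c /ℚ suc d
  x′ = mkℚᵘ (pos a) b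
  y′ = mkℚᵘ (pos c) d
  left : ℚ.toℚᵘ ∣ x -ℚ y ∣ℚ ℚᵘ.≃ ℚᵘ.∣ x′ ℚᵘ.- y′ ∣
  left = ℚᵘ.≃-trans (ℚ.toℚᵘ-homo-∣-∣ (x -ℚ y)) (ℚᵘ.∣-∣-cong
    (ℚᵘ.≃-trans (ℚ.toℚᵘ-homo-+ x (ℚ.- y)) (ℚᵘ.+-cong (ℚ.toℚᵘ-fromℚᵘ x′)
      (ℚᵘ.≃-trans (ℚ.toℚᵘ-homo‿- y) (ℚᵘ.-‿cong (ℚ.toℚᵘ-fromℚᵘ y′))))))
  numerator : pos a ℤ.* pos (suc d) ℤ.+ ℤ.- (pos c) ℤ.* pos (suc b) ≡ (a * suc d) ⊖ (c * suc b)
  numerator = trans (cong₂ ℤ._+_ (sym (ℤ.pos-* a (suc d)))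
      (trans (sym (ℤ.neg-distribˡ-* (pos c) (pos (suc b)))) (cong ℤ.-_ (sym (ℤ.pos-* c (suc b))))))
    (ℤ.m-n≡m⊖n (a * suc d) (c * suc b))
  bound : pos ℤ.∣ pos a ℤ.* pos (suc d) ℤ.+ ℤ.- (pos c) ℤ.* pos (suc b) ∣ ℤ.* pos (suc g) ℤ.≤ pos e ℤ.* pos (suc b * suc d)
  bound = subst₂ ℤ._≤_ (ℤ.pos-* ℤ.∣ pos a ℤ.* pos (suc d) ℤ.+ ℤ.- (pos c) ℤ.* pos (suc b) ∣ (suc g)) (ℤ.pos-* e (suc b * suc d)) (ℤ.+≤+
    (≤-trans (*-monoˡ-≤ (suc g) (≤-trans (≤-reflexive (cong ℤ.∣_∣ numerator)) (∣⊖∣≤ ad≤ cb≤))) wg≤))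

-- Only finitely many digits can be inspected; the positivity of ε later supplies an m whose prefix
-- is not 0.
search : ∀ ε m → (∀ i → i < m → ε i ≡ false) ⊎ ∃[ f ] FirstDigit ε f
search ε zero = inj₁ λ _ ()
search ε (suc m) with search ε m
... | inj₂ found  = inj₂ found
... | inj₁ before with ε m in eq
...   | true  = inj₂ (m , eq , before)
...   | false = inj₁ λ i i< → case-last i i<
  where
  case-last : ∀ i → i < suc m → ε i ≡ false
  case-last i i< with i ≟ m
  ... | yes refl = eq
  ... | no  i≢m  = before i (≤∧≢⇒< (s≤s⁻¹ i<) i≢m)

prefix-zero : ∀ ε m → (∀ i → i < m → ε i ≡ false) → prefix ε m ≡ 0
prefix-zero ε zero    _      = refl
prefix-zero ε (suc m) before = cong₂ (λ p b → 2 * p + bit b)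
  (prefix-zero ε m λ i i<m → before i (m≤n⇒m≤1+n i<m)) (before m ≤-refl)

module Digits (ε : Real01) (f : ℕ) (first : FirstDigit ε f) where
  -- The induction carries the upper end `suc p` of the dyadic interval, because suc (2p + 1) = 2 ·
  -- suc p.
  prefix-upper′ : ∀ j → suc (prefix ε (j + f)) * 2 ^ f ≤ 2 ^ (j + f)
  prefix-upper′ zero    = ≤-reflexive (trans (cong (λ p → suc p * 2 ^ f) (prefix-zero ε f (proj₂ first))) (+-identityʳ (2 ^ f)))
  prefix-upper′ (suc j) = begin
    suc (2 * p + bit (ε (j + f))) * 2 ^ f  ≤⟨ *-monoˡ-≤ (2 ^ f) (s≤s (+-monoʳ-≤ (2 * p) (bit≤1 (ε (j + f))))) ⟩
    suc (2 * p + 1) * 2 ^ f                ≡⟨ eq p (2 ^ f) ⟩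
    2 * (suc p * 2 ^ f)                    ≤⟨ *-monoʳ-≤ 2 (prefix-upper′ j) ⟩
    2 ^ (suc j + f)                        ∎
    where
    open ≤-Reasoning
    p = prefix ε (j + f)
    eq : ∀ p x → suc (2 * p + 1) * x ≡ 2 * (suc p * x)
    eq = solve-∀

  prefix-upper : ∀ m → prefix ε m * 2 ^ f ≤ 2 ^ m
  prefix-upper m with ≤-total f m
  ... | inj₁ f≤m = ≤-trans (*-monoˡ-≤ (2 ^ f) (n≤1+n (prefix ε m)))
    (subst (λ m → suc (prefix ε m) * 2 ^ f ≤ 2 ^ m) (m∸n+n≡m f≤m) (prefix-upper′ (m ∸ f)))
  ... | inj₂ m≤f = ≤-trans (≤-reflexive (cong (_* 2 ^ f) (prefix-zero ε m λ i i<m → proj₂ first i (≤-trans i<m m≤f)))) z≤n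

  prefix-lower′ : ∀ j → 2 ^ (j + suc f) ≤ prefix ε (j + suc f) * 2 ^ suc f
  prefix-lower′ zero    = ≤-reflexive (sym (trans (cong (_* 2 ^ suc f)
    (cong₂ (λ p b → 2 * p + bit b) (prefix-zero ε f (proj₂ first)) (proj₁ first))) (+-identityʳ (2 ^ suc f))))
  prefix-lower′ (suc j) = ≤-trans (*-monoʳ-≤ 2 (prefix-lower′ j)) (≤-trans (≤-reflexive (sym (*-assoc 2 (prefix ε (j + suc f)) (2 ^ suc f))))
    (*-monoˡ-≤ (2 ^ suc f) (m≤m+n (2 * prefix ε (j + suc f)) (bit (ε (j + suc f))))))

  prefix-lower : ∀ m → 2 ^ m ≤ suc (prefix ε m) * 2 ^ suc f
  prefix-lower m with ≤-total (suc f) m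
  ... | inj₁ f<m = ≤-trans (subst (λ m → 2 ^ m ≤ prefix ε m * 2 ^ suc f) (m∸n+n≡m f<m) (prefix-lower′ (m ∸ suc f)))
    (*-monoˡ-≤ (2 ^ suc f) (n≤1+n (prefix ε m)))
  ... | inj₂ m≤f = ≤-trans (^-monoʳ-≤ 2 m≤f) (m≤m+n (2 ^ suc f) _)

-- If f were less than k, then ε ≥ 2^-(f + 1) ≥ 2^-k.
firstDigit : ∀ ε k → 0ℚ <ᴿ ε → ε ᴿ< 1 /2^ k → ∃[ f ] FirstDigit ε f × k ≤ f
firstDigit ε k (m , 0<ε) (m′ , ε<) with search ε m
... | inj₁ before = contradiction (fraction-<⁻ {0} {1} {prefix ε m} {2 ^ m} {{_}} {{m^n≢0 2 m}} 0<ε)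
  (≤⇒≯ (≤-reflexive (cong (_* 1) (prefix-zero ε m before))))
... | inj₂ (f , first) = f , first , ≮⇒≥ λ f<k → <⇒≱
  (fraction-<⁻ {suc (prefix ε m′)} {2 ^ m′} {1} {2 ^ k} {{m^n≢0 2 m′}} {{m^n≢0 2 k}} ε<)
  (≤-trans (≤-reflexive (+-identityʳ (2 ^ m′))) (≤-trans (Digits.prefix-lower ε f first m′)
    (*-monoʳ-≤ (suc (prefix ε m′)) (^-monoʳ-≤ 2 f<k))))

<2^⌊log₂⌋ : ∀ n → n < 2 ^ suc ⌊log₂ n ⌋
<2^⌊log₂⌋ n = ≰⇒> λ le → <⇒≱ (n<1+n ⌊log₂ n ⌋) (≤-trans (≤-reflexive (sym (⌊log₂[2^n]⌋≡n (suc ⌊log₂ n ⌋)))) (⌊log₂⌋-mono-≤ le))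

2^⌊log₂⌋≤ : ∀ n → 1 ≤ n → 2 ^ ⌊log₂ n ⌋ ≤ n
2^⌊log₂⌋≤ n 1≤n = go n n ≤-refl 1≤n
  where
  go : ∀ b n → n ≤ b → 1 ≤ n → 2 ^ ⌊log₂ n ⌋ ≤ n
  go (suc b) (suc zero)       _         _ = ≤-refl
  go (suc b) n@(suc (suc n′)) (s≤s n≤b) _ = begin
    2 ^ ⌊log₂ n ⌋              ≡⟨ cong (2 ^_) (m+[n∸m]≡n {1} 1≤log) ⟨
    2 * 2 ^ (⌊log₂ n ⌋ ∸ 1)    ≡⟨ cong (λ l → 2 * 2 ^ l) (⌊log₂⌊n/2⌋⌋≡⌊log₂n⌋∸1 n) ⟨
    2 * 2 ^ ⌊log₂ ⌊ n /2⌋ ⌋    ≤⟨ *-monoʳ-≤ 2 (go b ⌊ n /2⌋ (≤-trans (⌊n/2⌋≤n′ n′) n≤b) (s≤s z≤n)) ⟩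
    2 * ⌊ n /2⌋                ≡⟨ double ⌊ n /2⌋ ⟨
    ⌊ n /2⌋ + ⌊ n /2⌋          ≤⟨ +-monoʳ-≤ ⌊ n /2⌋ (⌊n/2⌋≤⌈n/2⌉ n) ⟩
    ⌊ n /2⌋ + ⌈ n /2⌉          ≡⟨ ⌊n/2⌋+⌈n/2⌉≡n n ⟩
    n                          ∎
    where
    open ≤-Reasoning
    1≤log : 1 ≤ ⌊log₂ n ⌋
    1≤log = ⌊log₂⌋-mono-≤ {2} {n} (s≤s (s≤s z≤n))
    ⌊n/2⌋≤n′ : ∀ n′ → ⌊ suc (suc n′) /2⌋ ≤ suc n′
    ⌊n/2⌋≤n′ n′ = s≤s (⌊n/2⌋≤n n′)

size≤ : ∀ {x e} → x ≤ 2 ^ e → size x ≤ suc e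
size≤ {x} {e} x≤ = s≤s (≤-trans (⌊log₂⌋-mono-≤ x≤) (≤-reflexive (⌊log₂[2^n]⌋≡n e)))

size≥ : ∀ {x e} → 2 ^ e ≤ x → suc e ≤ size x
size≥ {x} {e} le = s≤s (≤-trans (≤-reflexive (sym (⌊log₂[2^n]⌋≡n e))) (⌊log₂⌋-mono-≤ le))

-- The clauses of the theorem

literalFactor-lookup : ∀ {n} (s : Vec Bool n) i b →
  literalFactor (Vec.toList s) (literal (toℕ i) b) ≡ settled (agrees b (lookup s i))
literalFactor-lookup (x Vec.∷ s) Fin.zero    true  = refl
literalFactor-lookup (x Vec.∷ s) Fin.zero    false = refl
literalFactor-lookup (x Vec.∷ s) (Fin.suc i) b     = literalFactor-lookup s i b

agrees-refl : ∀ b → agrees b b ≡ true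
agrees-refl true  = refl
agrees-refl false = refl

agrees-≢ : ∀ b c → c ≢ b → agrees b c ≡ false
agrees-≢ true  true  ne = contradiction refl ne
agrees-≢ true  false ne = refl
agrees-≢ false true  ne = refl
agrees-≢ false false ne = contradiction refl ne

-- The first column becomes the lowest digit, since `increasing` reads the digits from the lowest
-- upwards.
clauseCode : ∀ {n k} → (Fin k → Fin n) → (Fin k → Bool) → ℕ
clauseCode {k = zero}      i σ = 0
clauseCode {n} {k = suc k} i σ = clauseCode (i ∘ Fin.suc) (σ ∘ Fin.suc) * (n * 2) + literal (toℕ (i Fin.zero)) (σ Fin.zero)

literal<2n : ∀ {n} (i : Fin n) b → literal (toℕ i) b < n * 2
literal<2n {n} i b = begin-strict
  toℕ i * 2 + bit b  <⟨ +-monoʳ-< (toℕ i * 2) (bit<2 b) ⟩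
  toℕ i * 2 + 2      ≡⟨ +-comm (toℕ i * 2) 2 ⟩
  suc (toℕ i) * 2    ≤⟨ *-monoˡ-≤ 2 (Fin.toℕ<n i) ⟩
  n * 2              ∎
  where
  open ≤-Reasoning
  bit<2 : ∀ b → bit b < 2
  bit<2 true  = ≤-refl
  bit<2 false = s≤s z≤n

clauseCode< : ∀ {n k} (i : Fin k → Fin n) σ → clauseCode i σ < (n * 2) ^ k
clauseCode< {k = zero}      i σ = ≤-refl
clauseCode< {n} {k = suc k} i σ = begin-strict
  c * B + literal (toℕ (i Fin.zero)) (σ Fin.zero)  <⟨ +-monoʳ-< (c * B) (literal<2n (i Fin.zero) (σ Fin.zero)) ⟩
  c * B + B                                        ≡⟨ +-comm (c * B) B ⟩
  suc c * B                                        ≤⟨ *-monoˡ-≤ B (clauseCode< (i ∘ Fin.suc) (σ ∘ Fin.suc)) ⟩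
  B ^ k * B                                        ≡⟨ *-comm (B ^ k) B ⟩
  B ^ suc k                                        ∎
  where
  open ≤-Reasoning
  B = n * 2
  c = clauseCode (i ∘ Fin.suc) (σ ∘ Fin.suc)

module _ {n k} (i : Fin (suc k) → Fin n) (σ : Fin (suc k) → Bool) where
  clauseCode-digit : digitOf (n * 2) (clauseCode i σ) ≡ literal (toℕ (i Fin.zero)) (σ Fin.zero)
  clauseCode-digit = digitOf[h*P+l] (clauseCode (i ∘ Fin.suc) (σ ∘ Fin.suc)) (literal<2n (i Fin.zero) (σ Fin.zero))

  clauseCode-÷ : clauseCode i σ ÷ (n * 2) ≡ clauseCode (i ∘ Fin.suc) (σ ∘ Fin.suc)
  clauseCode-÷ = [h*P+l]÷P (clauseCode (i ∘ Fin.suc) (σ ∘ Fin.suc)) (literal<2n (i Fin.zero) (σ Fin.zero))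

satisfied : ∀ {n k} (i : Fin k → Fin n) σ s → Matches i σ s →
  satisfaction (n * 2) k (Vec.toList s) (clauseCode i σ) ≡ 2 ^ k
satisfied {k = zero}  i σ s ok = refl
satisfied {n} {suc k} i σ s ok = cong₂ _*_
  (trans (cong (literalFactor (Vec.toList s)) (clauseCode-digit i σ)) (trans (literalFactor-lookup s (i Fin.zero) (σ Fin.zero))
    (cong settled (trans (cong (agrees (σ Fin.zero)) (ok Fin.zero)) (agrees-refl (σ Fin.zero))))))
  (trans (cong (digitProduct (literalFactor (Vec.toList s)) (n * 2) k) (clauseCode-÷ i σ))
    (satisfied (i ∘ Fin.suc) (σ ∘ Fin.suc) s (ok ∘ Fin.suc)))

unsatisfied : ∀ {n k} (i : Fin k → Fin n) σ s → ¬ Matches i σ s →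
  satisfaction (n * 2) k (Vec.toList s) (clauseCode i σ) ≡ 0
unsatisfied {k = zero}  i σ s bad = contradiction (λ ()) bad
unsatisfied {n} {suc k} i σ s bad with lookup s (i Fin.zero) Bool.≟ σ Fin.zero
... | no ne = cong (_* digitProduct T (n * 2) k (clauseCode i σ ÷ (n * 2)))
  (trans (cong T (clauseCode-digit i σ)) (trans (literalFactor-lookup s (i Fin.zero) (σ Fin.zero))
    (cong settled (agrees-≢ (σ Fin.zero) (lookup s (i Fin.zero)) ne))))
  where
  T = literalFactor (Vec.toList s)
... | yes eq = trans (cong (T (digitOf (n * 2) (clauseCode i σ)) *_)
  (trans (cong (digitProduct T (n * 2) k) (clauseCode-÷ i σ))
    (unsatisfied (i ∘ Fin.suc) (σ ∘ Fin.suc) s λ ok → bad λ { Fin.zero → eq ; (Fin.suc j) → ok j })))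
  (*-zeroʳ (T (digitOf (n * 2) (clauseCode i σ))))
  where
  T = literalFactor (Vec.toList s)

increasing-clauseCode : ∀ {n k p} (i : Fin k → Fin n) σ → (∀ a b → a Fin.< b → i a Fin.< i b) → (∀ j → p ≤ toℕ (i j)) →
  increasing (n * 2) k p (clauseCode i σ) ≡ 1
increasing-clauseCode {k = zero}      i σ mono p≤ = refl
increasing-clauseCode {n} {suc k} {p} i σ mono p≤ = trans
  (cong₂ (λ col x → (1 ∸ (p ∸ col)) * increasing (n * 2) k (suc col) x) column (clauseCode-÷ i σ))
  (cong₂ (λ x y → (1 ∸ x) * y) (m≤n⇒m∸n≡0 (p≤ Fin.zero))
    (increasing-clauseCode (i ∘ Fin.suc) (σ ∘ Fin.suc) (λ a b a<b → mono (Fin.suc a) (Fin.suc b) (s≤s a<b))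
      λ j → mono Fin.zero (Fin.suc j) (s≤s z≤n)))
  where
  column : digitOf (n * 2) (clauseCode i σ) ÷ 2 ≡ toℕ (i Fin.zero)
  column = trans (cong (_÷ 2) (clauseCode-digit i σ)) (literal÷2 (toℕ (i Fin.zero)) (σ Fin.zero))

module _ {n k} (i : Fin k → Fin n) (σ : Fin k → Bool) where
  matching : List (Vec Bool n) → ℕ
  matching rows = List.length (List.filter (matches? i σ) rows)

  matching≤ : ∀ rows → matching rows ≤ List.length rows
  matching≤ = List.length-filter (matches? i σ)

  -- On a complete row E is 2^k or 0, so a weight depends only on the numbers of hits and misses.
  product-matching : ∀ (g : ℕ → ℕ) rows →
    product (List.map (λ s → g (satisfaction (n * 2) k (Vec.toList s) (clauseCode i σ))) rows) ≡
    g (2 ^ k) ^ matching rows * g 0 ^ (List.length rows ∸ matching rows)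
  product-matching g []         = refl
  product-matching g (s ∷ rows) with matches? i σ s
  ... | yes ok  = begin
    g (E s) * product (List.map (λ s → g (E s)) rows)
      ≡⟨ cong₂ _*_ (cong g (satisfied i σ s ok)) (product-matching g rows) ⟩
    g (2 ^ k) * (g (2 ^ k) ^ matching rows * g 0 ^ (List.length rows ∸ matching rows))
      ≡⟨ *-assoc (g (2 ^ k)) (g (2 ^ k) ^ matching rows) _ ⟨
    g (2 ^ k) ^ suc (matching rows) * g 0 ^ (suc (List.length rows) ∸ suc (matching rows))
      ≡⟨ cong (λ a → g (2 ^ k) ^ a * g 0 ^ (suc (List.length rows) ∸ a)) (cong List.length (List.filter-accept (matches? i σ) ok)) ⟨
    g (2 ^ k) ^ matching (s ∷ rows) * g 0 ^ (suc (List.length rows) ∸ matching (s ∷ rows)) ∎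
    where
    open ≡-Reasoning
    E = λ s → satisfaction (n * 2) k (Vec.toList s) (clauseCode i σ)
  ... | no  bad = begin
    g (E s) * product (List.map (λ s → g (E s)) rows)
      ≡⟨ cong₂ _*_ (cong g (unsatisfied i σ s bad)) (product-matching g rows) ⟩
    g 0 * (g (2 ^ k) ^ matching rows * g 0 ^ (List.length rows ∸ matching rows))
      ≡⟨ eq (g 0) (g (2 ^ k) ^ matching rows) (g 0 ^ (List.length rows ∸ matching rows)) ⟩
    g (2 ^ k) ^ matching rows * g 0 ^ suc (List.length rows ∸ matching rows)
      ≡⟨ cong (λ e → g (2 ^ k) ^ matching rows * g 0 ^ e) (+-∸-assoc 1 (matching≤ rows)) ⟨
    g (2 ^ k) ^ matching rows * g 0 ^ (suc (List.length rows) ∸ matching rows)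
      ≡⟨ cong (λ a → g (2 ^ k) ^ a * g 0 ^ (suc (List.length rows) ∸ a)) (cong List.length (List.filter-reject (matches? i σ) bad)) ⟨
    g (2 ^ k) ^ matching (s ∷ rows) * g 0 ^ (suc (List.length rows) ∸ matching (s ∷ rows)) ∎
    where
    open ≡-Reasoning
    E = λ s → satisfaction (n * 2) k (Vec.toList s) (clauseCode i σ)
    eq : ∀ a b c → a * (b * c) ≡ b * (a * c)
    eq = solve-∀

-- Choice of the parameters, independence and size of the set

module Assembly (ε : Real01) (n k f : ℕ) (2≤n : 2 ≤ n) (1≤k : 1 ≤ k) (k≤f : k ≤ f) (first : FirstDigit ε f) where
  l B N K Q R rounds growth H Z a : ℕ
  l = ⌊log₂ n ⌋
  B = n * 2
  N = B ^ k
  K = 2 ^ k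
  Q = 2 ^ f + 2 ^ f
  R = Q ÷ K
  rounds = roundsOf k Q K l
  growth = Q * 4 + 1 + K
  H = N * 3 + 2 + growth + rounds
  -- Weights stay below growth^rounds. The coefficient leaves room for one more row factor, for the
  -- sum of one X and one Y, and for H itself.
  Z = (growth + 2 * (k * (N * K)) + H) * growth ^ rounds
  -- The common scale: all short numbers are at most 2^(9a), and the logarithmic factors of the time
  -- become powers of a.
  a = k * l + f + 1

  2^l≤n : 2 ^ l ≤ n
  2^l≤n = 2^⌊log₂⌋≤ n (≤-trans (s≤s z≤n) 2≤n)

  n< : n < 2 ^ suc l
  n< = <2^⌊log₂⌋ n

  1≤l : 1 ≤ l
  1≤l = n≢0⇒n>0 λ l≡0 → <⇒≱ (subst (λ l → n < 2 ^ suc l) l≡0 n<) 2≤n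

  1≤n : 1 ≤ n
  1≤n = ≤-trans (s≤s z≤n) 2≤n

  1≤B : 1 ≤ B
  1≤B = *-mono-≤ 1≤n (s≤s z≤n)

  1≤N : 1 ≤ N
  1≤N = m^n>0 B {{>-nonZero 1≤B}} k

  1≤K : 1 ≤ K
  1≤K = m^n>0 2 k

  2^f≤Q : 2 ^ f ≤ Q
  2^f≤Q = m≤m+n (2 ^ f) (2 ^ f)

  K≤2^f : K ≤ 2 ^ f
  K≤2^f = ^-monoʳ-≤ 2 k≤f

  K≤Q : K ≤ Q
  K≤Q = ≤-trans K≤2^f 2^f≤Q

  1≤Q : 1 ≤ Q
  1≤Q = ≤-trans 1≤K K≤Q

  -- The quotient is exact, as both numbers are powers of 2 and k ≤ f.
  Q≡RK : Q ≡ R * K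
  Q≡RK = trans (double (2 ^ f)) (trans (cong (2 ^_) (sym (m∸n+n≡m (m≤n⇒m≤1+n k≤f))))
    (trans (^-distribˡ-+-* 2 (suc f ∸ k) k) (cong (_* K) (sym R≡))))
    where
    R≡ : R ≡ 2 ^ (suc f ∸ k)
    R≡ = trans (cong (_÷ K) (trans (double (2 ^ f)) (trans (cong (2 ^_) (sym (m∸n+n≡m (m≤n⇒m≤1+n k≤f))))
        (trans (^-distribˡ-+-* 2 (suc f ∸ k) k) (sym (+-identityʳ _))))))
      ([h*P+l]÷P (2 ^ (suc f ∸ k)) {K} {0} 1≤K)

  1≤R : 1 ≤ R
  1≤R = n≢0⇒n>0 (÷≢0 1≤K K≤Q)

  B≤N : B ≤ N
  B≤N = ≤-trans (≤-reflexive (sym (^-identityʳ B))) (^-monoʳ-≤ B {{>-nonZero 1≤B}} 1≤k)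

  3N≤H : N * 3 + 2 ≤ H
  3N≤H = ≤-trans (m≤m+n (N * 3 + 2) growth) (m≤m+n (N * 3 + 2 + growth) rounds)

  N≤H : N ≤ H
  N≤H = ≤-trans (m≤m*n N 3) (≤-trans (m≤m+n (N * 3) 2) 3N≤H)

  growth≤H : growth ≤ H
  growth≤H = ≤-trans (m≤n+m growth (N * 3 + 2)) (m≤m+n (N * 3 + 2 + growth) rounds)

  K≤H : K ≤ H
  K≤H = ≤-trans (m≤n+m K (Q * 4 + 1)) growth≤H

  rounds≤H : rounds ≤ H
  rounds≤H = m≤n+m rounds (N * 3 + 2 + growth)

  3≤H : 3 ≤ H
  3≤H = ≤-trans (*-monoˡ-≤ 3 1≤N) (≤-trans (m≤m+n (N * 3) 2) 3N≤H)

  1≤growth : 1 ≤ growth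
  1≤growth = ≤-trans 1≤K (m≤n+m K (Q * 4 + 1))

  1≤growth^rounds : 1 ≤ growth ^ rounds
  1≤growth^rounds = m^n>0 growth {{>-nonZero 1≤growth}} rounds

  H≤Z : H ≤ Z
  H≤Z = ≤-trans (m≤n+m H (growth + 2 * (k * (N * K)))) (m≤m*n _ (growth ^ rounds) {{>-nonZero 1≤growth^rounds}})

  1≤RQlk : 1 ≤ R * Q * l * k
  1≤RQlk = *-mono-≤ (*-mono-≤ (*-mono-≤ 1≤R 1≤Q) 1≤l) 1≤k

  32≤rounds : 32 ≤ rounds
  32≤rounds = *-monoˡ-≤ 32 1≤RQlk

  open Setup ε H Z 3≤H H≤Z

  fixed : Fixed n k B N (Q * 4 ∸ 1) (Q * 4 + 1)
  fixed = record
    { 1≤k = 1≤k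
    ; k≤H = ≤-trans (<⇒≤ (n<2^n k)) K≤H
    ; 2^k≤ = K≤H
    ; n≤H = ≤-trans (m≤m*n n 2) (≤-trans B≤N N≤H)
    ; 1≤n = 1≤n
    ; B≡ = refl
    ; 1≤B = 1≤B
    ; 3B≤H = ≤-trans (*-monoˡ-≤ 3 B≤N) (≤-trans (m≤m+n (N * 3) 2) 3N≤H)
    ; N≡ = refl
    ; 3N≤H = 3N≤H
    ; M⁺≡ = trans (+-comm (Q * 4) 1) (cong suc (sym (m+[n∸m]≡n {1} {Q * 4} (*-mono-≤ 1≤Q (s≤s (z≤n {3}))))))
    ; M⁺≤H = ≤-trans (m≤m+n (Q * 4 + 1) K) growth≤H
    ; M≤H = ≤-trans (+-monoˡ-≤ K (≤-trans (m∸n≤m (Q * 4) 1) (m≤m+n (Q * 4) 1))) growth≤H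
    ; 2^k≤M⁺ = ≤-trans K≤Q (≤-trans (m≤m*n Q 4) (m≤m+n (Q * 4) 1)) }

  growth≤Z : growth * growth ^ rounds ≤ Z
  growth≤Z = *-monoˡ-≤ (growth ^ rounds) (≤-trans (m≤m+n growth (2 * (k * (N * K)))) (m≤m+n _ H))

  sums≤Z : k * (N * (K * growth ^ rounds)) + k * (N * (K * growth ^ rounds)) ≤ Z
  sums≤Z = ≤-trans (≤-reflexive (eq k N K (growth ^ rounds)))
    (*-monoˡ-≤ (growth ^ rounds) (≤-trans (m≤n+m (2 * (k * (N * K))) growth) (m≤m+n _ H)))
    where
    eq : ∀ k n p w → k * (n * (p * w)) + k * (n * (p * w)) ≡ 2 * (k * (n * p)) * w
    eq = solve-∀

  -- Fixes s = 4 k l. From n < 2^(l + 1) follows 2N < 2^(1 + (l + 2) k), and k, l ≥ 1 bring the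
  -- exponent below 4 k l.
  2N<2^s : 2 * N < 2 ^ (4 * (k * l))
  2N<2^s = begin-strict
    2 * N                  <⟨ *-monoʳ-< 2 (^-monoˡ-< k {{>-nonZero 1≤k}} (*-monoˡ-< 2 n<)) ⟩
    2 * (2 ^ suc l * 2) ^ k  ≡⟨ cong (λ x → 2 * x ^ k) (*-comm (2 ^ suc l) 2) ⟩
    2 * (2 ^ (2 + l)) ^ k  ≡⟨ cong (2 *_) (^-*-assoc 2 (2 + l) k) ⟩
    2 ^ suc ((2 + l) * k)  ≤⟨ ^-monoʳ-≤ 2 exponent ⟩
    2 ^ (4 * (k * l))      ∎
    where
    open ≤-Reasoning
    exponent : suc ((2 + l) * k) ≤ 4 * (k * l)
    exponent = begin
      1 + (2 + l) * k                      ≡⟨ eq k l ⟩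
      1 + 2 * k + k * l                    ≤⟨ +-monoˡ-≤ (k * l) (+-mono-≤ (*-mono-≤ 1≤k 1≤l) (*-monoʳ-≤ 2 (m≤m*n k l {{>-nonZero 1≤l}}))) ⟩
      k * l + 2 * (k * l) + k * l          ≡⟨ eq₂ (k * l) ⟩
      4 * (k * l)                          ∎
      where
      eq : ∀ k l → 1 + (2 + l) * k ≡ 1 + 2 * k + k * l
      eq = solve-∀
      eq₂ : ∀ x → x + 2 * x + x ≡ 4 * x
      eq₂ = solve-∀

  roundsK≡ : rounds * K ≡ 32 * (k * l) * (Q * Q)
  roundsK≡ = trans (eq R Q l k K) (cong (λ q → 32 * (k * l) * (q * Q)) (sym Q≡RK))
    where
    eq : ∀ r q l k x → r * q * l * k * 32 * x ≡ 32 * (k * l) * (r * x * q)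
    eq = solve-∀

  Final : State → Set
  Final = MainInv n k B N (Q * 4 ∸ 1) (Q * 4 + 1) rounds 0

  module Result {s : State} (final : Final s) where
    rows : List (Vec Bool n)
    rows = proj₁ (proj₂ (proj₂ (proj₂ final)))

    length-rows : List.length rows ≡ rounds
    length-rows = trans (sym (+-identityʳ _)) (proj₁ (proj₂ (proj₂ (proj₂ (proj₂ final)))))

    output≡ : output s ≡ concatMap Vec.toList rows
    output≡ = proj₁ (proj₂ (proj₂ (proj₂ (proj₂ (proj₂ final)))))

    total≤ : sumBelow (rowsWeight B k (Q * 4 ∸ 1 +_) rows) N + sumBelow (rowsWeight B k (Q * 4 + 1 ∸_) rows) N ≤ suc (Q * 4 ∸ 1) ^ List.length rows * (2 * N)
    total≤ = proj₂ (proj₂ (proj₂ (proj₂ (proj₂ (proj₂ (proj₂ final))))))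

    nonempty : ∃[ S ] toList S ≡ rows
    nonempty with rows in eq
    ... | []     = contradiction (≤-trans 32≤rounds (≤-reflexive (trans (sym length-rows) (cong List.length eq)))) λ ()
    ... | x ∷ xs = (x List⁺.∷ xs) , refl

    S : List⁺ (Vec Bool n)
    S = proj₁ nonempty

    toList-S : toList S ≡ rows
    toList-S = proj₂ nonempty

    length-S : length S ≡ rounds
    length-S = trans (cong List.length toList-S) length-rows

    -- The tolerated deviation in the number of hits; as a fraction of the h R K rows it is 1/(R K)
    -- = 2^-q.
    h : ℕ
    h = 8 * R * (4 * (k * l))

    rounds≡hRK : rounds ≡ h * R * K
    rounds≡hRK = trans (cong (λ Q → R * Q * l * k * 32) Q≡RK) (eq R K k l)
      where
      eq : ∀ r x k l → r * (r * x) * l * k * 32 ≡ 8 * r * (4 * (k * l)) * r * x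
      eq = solve-∀

    module _ (i : Fin k → Fin n) (mono : ∀ x y → x Fin.< y → i x Fin.< i y) (σ : Fin k → Bool) where
      private
        c = clauseCode i σ
        hits = matching i σ rows
        misses = List.length rows ∸ hits

        hits+misses : hits + misses ≡ List.length rows
        hits+misses = m+[n∸m]≡n (matching≤ i σ rows)

        c<N : c < N
        c<N = clauseCode< i σ

        weight : ∀ (g : ℕ → ℕ) →
          rowsWeight B k g rows c ≡ g K ^ hits * g 0 ^ misses
        weight g = trans (cong (_* product (List.map (λ s → g (satisfaction B k (Vec.toList s) c)) rows))
            (increasing-clauseCode i σ mono λ _ → z≤n))
          (trans (*-identityˡ _) (product-matching i σ g rows))

        4Q≡ : suc (Q * 4 ∸ 1) ≡ Q * 4
        4Q≡ = m+[n∸m]≡n {1} {Q * 4} (*-mono-≤ 1≤Q (s≤s (z≤n {3})))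

        -- Applied to the weights of a single clause, which are at most the total: the initial total
        -- of at most 2N is all that they can gain over M^m.
        total< : ∀ {w} → w ≤ suc (Q * 4 ∸ 1) ^ List.length rows * (2 * N) → w < (Q * 4) ^ (hits + misses) * 2 ^ (4 * (k * l))
        total< {w} w≤ = ≤-trans (s≤s (≤-trans w≤ (≤-reflexive (cong₂ (λ M e → M ^ e * (2 * N)) 4Q≡ (sym hits+misses)))))
          (*-monoʳ-< ((Q * 4) ^ (hits + misses)) {{m^n≢0 (Q * 4) (hits + misses) {{>-nonZero (*-mono-≤ 1≤Q (s≤s (z≤n {3})))}}}} 2N<2^s)

        upper< : (Q * 4 ∸ 1 + K) ^ hits * (Q * 4 ∸ 1) ^ misses < (Q * 4) ^ (hits + misses) * 2 ^ (4 * (k * l))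
        upper< = subst (_< (Q * 4) ^ (hits + misses) * 2 ^ (4 * (k * l)))
          (trans (weight (λ e → Q * 4 ∸ 1 + e)) (cong (λ x → (Q * 4 ∸ 1 + K) ^ hits * x ^ misses) (+-identityʳ (Q * 4 ∸ 1))))
          (total< (≤-trans (term≤sum (rowsWeight B k (Q * 4 ∸ 1 +_) rows) N c<N) (≤-trans (m≤m+n _ _) total≤)))

        lower< : (Q * 4 + 1 ∸ K) ^ hits * (Q * 4 + 1) ^ misses < (Q * 4) ^ (hits + misses) * 2 ^ (4 * (k * l))
        lower< = subst (_< (Q * 4) ^ (hits + misses) * 2 ^ (4 * (k * l))) (weight (λ e → Q * 4 + 1 ∸ e))
          (total< (≤-trans (term≤sum (rowsWeight B k (Q * 4 + 1 ∸_) rows) N c<N)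
            (≤-trans (m≤n+m _ (sumBelow (rowsWeight B k (Q * 4 ∸ 1 +_) rows) N)) total≤)))

        bounds : (_ → hits < h * R + h) × (_ → h * R < hits + h)
        bounds = tails {R} {K} {Q} {4 * (k * l)} {hits} {misses} 1≤R 1≤K Q≡RK (trans hits+misses (trans length-rows rounds≡hRK))

      hits-upper : hits ≤ h * R + h
      hits-upper = <⇒≤ (proj₁ bounds upper<)

      hits-lower : h * R ≤ hits + h
      hits-lower = <⇒≤ (proj₂ bounds lower<)

    independent : AlmostIndependent k ε S
    -- Over the denominator `length S * K` the error is at most h K, which is 2^-(f + 1) and hence
    -- below every upper approximation of ε.
    independent i mono σ m = fraction-distance {hits} {length S} {1} {K} {suc (prefix ε m)} {2 ^ m} (h * K)
      {{_}} {{m^n≢0 2 k}} {{m^n≢0 2 m}} above below small-error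
      where
      hits = List.length (List.filter (matches? i σ) (toList S))
      hits≡ : hits ≡ matching i σ rows
      hits≡ = cong (λ rows → List.length (List.filter (matches? i σ) rows)) toList-S
      length≡ : 1 * length S ≡ h * R * K
      length≡ = trans (*-identityˡ _) (trans length-S rounds≡hRK)
      open ≤-Reasoning
      above : hits * K ≤ 1 * length S + h * K
      above = begin
        hits * K                  ≡⟨ cong (_* K) hits≡ ⟩
        matching i σ rows * K     ≤⟨ *-monoˡ-≤ K (hits-upper i mono σ) ⟩
        (h * R + h) * K           ≡⟨ *-distribʳ-+ K (h * R) h ⟩
        h * R * K + h * K         ≡⟨ cong (_+ h * K) length≡ ⟨
        1 * length S + h * K      ∎
      below : 1 * length S ≤ hits * K + h * K
      below = begin
        1 * length S                  ≡⟨ length≡ ⟩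
        h * R * K                     ≤⟨ *-monoˡ-≤ K (hits-lower i mono σ) ⟩
        (matching i σ rows + h) * K   ≡⟨ *-distribʳ-+ K (matching i σ rows) h ⟩
        matching i σ rows * K + h * K ≡⟨ cong (λ x → x * K + h * K) hits≡ ⟨
        hits * K + h * K              ∎
      small-error : h * K * 2 ^ m ≤ suc (prefix ε m) * (length S * K)
      small-error = begin
        h * K * 2 ^ m                               ≤⟨ *-monoʳ-≤ (h * K) (Digits.prefix-lower ε f first m) ⟩
        h * K * (suc (prefix ε m) * 2 ^ suc f)      ≡⟨ cong (λ q → h * K * (suc (prefix ε m) * q)) (trans (sym (double (2 ^ f))) Q≡RK) ⟩
        h * K * (suc (prefix ε m) * (R * K))        ≡⟨ eq h K (suc (prefix ε m)) R ⟩
        suc (prefix ε m) * (h * R * K * K)          ≡⟨ cong (λ x → suc (prefix ε m) * (x * K)) (trans (sym length≡) (*-identityˡ _)) ⟩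
        suc (prefix ε m) * (length S * K)           ∎
        where
        eq : ∀ h x p r → h * x * (p * (r * x)) ≡ p * (h * r * x * x)
        eq = solve-∀

    -- The size times K is exactly 32 k l Q² with Q = 2 · 2^f, and ε ≤ 2^-f; hence 128 = 32 · 4.
    length-bound : length S * 2 ^ k ≤ 128 * (k * l) / ε ↑ 2
    length-bound m = begin
      length S * K * p ^ 2                      ≡⟨ cong (λ x → x * K * p ^ 2) length-S ⟩
      rounds * K * p ^ 2                        ≡⟨ cong (_* p ^ 2) roundsK≡ ⟩
      32 * (k * l) * (Q * Q) * p ^ 2            ≡⟨ eq (k * l) (2 ^ f) p ⟩
      128 * (k * l) * (p * 2 ^ f) ^ 2           ≤⟨ *-monoʳ-≤ (128 * (k * l)) (^-monoˡ-≤ 2 (Digits.prefix-upper ε f first m)) ⟩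
      128 * (k * l) * (2 ^ m) ^ 2               ∎
      where
      open ≤-Reasoning
      p = prefix ε m
      eq : ∀ x y p → 32 * x * ((y + y) * (y + y)) * (p * (p * 1)) ≡ 128 * x * (p * y * (p * y * 1))
      eq = solve-∀

  -- The running time

  2≤a : 2 ≤ a
  2≤a = +-mono-≤ (≤-trans (*-mono-≤ 1≤k 1≤l) (m≤m+n (k * l) f)) (≤-refl {1})

  private
    kl≤a : k * l ≤ a
    kl≤a = ≤-trans (m≤m+n (k * l) f) (m≤m+n (k * l + f) 1)

    1+f≤a : suc f ≤ a
    1+f≤a = ≤-trans (≤-reflexive (+-comm 1 f)) (+-monoˡ-≤ 1 (m≤n+m f (k * l)))

    pow-≤ : ∀ {x y} → x ≤ y → 2 ^ x ≤ 2 ^ y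
    pow-≤ = ^-monoʳ-≤ 2

    Q≤ : Q ≤ 2 ^ a
    Q≤ = ≤-trans (≤-reflexive (double (2 ^ f))) (pow-≤ 1+f≤a)

    K≤ : K ≤ 2 ^ a
    K≤ = ≤-trans K≤Q Q≤

    k≤2^a : k ≤ 2 ^ a
    k≤2^a = ≤-trans (<⇒≤ (n<2^n k)) K≤

    l≤2^a : l ≤ 2 ^ a
    l≤2^a = ≤-trans (<⇒≤ (n<2^n l)) (pow-≤ (≤-trans (m≤n*m l k {{>-nonZero 1≤k}}) kl≤a))

    N≤ : N ≤ 2 ^ (3 * a)
    N≤ = begin
      B ^ k                ≤⟨ ^-monoˡ-≤ k (*-monoˡ-≤ 2 (<⇒≤ n<)) ⟩
      (2 ^ suc l * 2) ^ k  ≡⟨ cong (_^ k) (*-comm (2 ^ suc l) 2) ⟩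
      (2 ^ (2 + l)) ^ k    ≡⟨ ^-*-assoc 2 (2 + l) k ⟩
      2 ^ ((2 + l) * k)    ≤⟨ pow-≤ (begin
        (2 + l) * k              ≤⟨ *-monoˡ-≤ k (+-monoˡ-≤ l (*-monoʳ-≤ 2 1≤l)) ⟩
        (2 * l + l) * k          ≡⟨ eq k l ⟩
        3 * (k * l)              ≤⟨ *-monoʳ-≤ 3 kl≤a ⟩
        3 * a                    ∎) ⟩
      2 ^ (3 * a)          ∎
      where
      open ≤-Reasoning
      eq : ∀ k l → (2 * l + l) * k ≡ 3 * (k * l)
      eq = solve-∀

    pow-scale : ∀ j {e} → e ≤ j → 2 ^ (e * a) ≤ 2 ^ (j * a)
    pow-scale j e≤j = pow-≤ (*-monoˡ-≤ a e≤j)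

    -- Since a ≥ 2, numerical factors are absorbed by a few further multiples of a in the exponent.
    pow-step : ∀ c e d → c ≤ 2 * d → 2 ^ c * 2 ^ (e * a) ≤ 2 ^ ((d + e) * a)
    pow-step c e d c≤2d = ≤-trans (≤-reflexive (sym (^-distribˡ-+-* 2 c (e * a)))) (pow-≤ (≤-trans
      (+-monoˡ-≤ (e * a) (≤-trans c≤2d (≤-trans (≤-reflexive (*-comm 2 d)) (*-monoʳ-≤ d 2≤a)))) (≤-reflexive (sym (*-distribʳ-+ a d e)))))

    pow-* : ∀ x y {u v} → u ≤ 2 ^ (x * a) → v ≤ 2 ^ (y * a) → u * v ≤ 2 ^ ((x + y) * a)
    pow-* x y u≤ v≤ = ≤-trans (*-mono-≤ u≤ v≤) (≤-reflexive (trans (sym (^-distribˡ-+-* 2 (x * a) (y * a)))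
      (cong (2 ^_) (sym (*-distribʳ-+ a x y)))))

    pow1 : ∀ {x} → x ≤ 2 ^ a → x ≤ 2 ^ (1 * a)
    pow1 {x} = subst (λ e → x ≤ 2 ^ e) (sym (*-identityˡ a))

    rounds≤ : rounds ≤ 2 ^ (7 * a)
    rounds≤ = pow-* 4 3 (pow-* 3 1 (pow-* 2 1 (pow-* 1 1 (pow1 (≤-trans (÷≤ Q K) Q≤)) (pow1 Q≤)) (pow1 l≤2^a)) (pow1 k≤2^a))
      (pow-≤ {5} (≤-trans (n≤1+n 5) (*-monoʳ-≤ 3 2≤a)))

    growth≤ : growth ≤ 2 ^ (3 * a)
    growth≤ = begin
      Q * 4 + 1 + K                ≤⟨ +-mono-≤ (+-mono-≤ (*-monoˡ-≤ 4 (pow1 Q≤)) (m^n>0 2 (1 * a))) (pow1 K≤) ⟩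
      x * 4 + x + x                ≡⟨ eq x ⟩
      6 * x                        ≤⟨ *-monoˡ-≤ x (≤-trans (n≤1+n 6) (n≤1+n 7)) ⟩
      2 ^ 3 * x                    ≤⟨ pow-step 3 1 2 (n≤1+n 3) ⟩
      2 ^ (3 * a)                  ∎
      where
      open ≤-Reasoning
      x = 2 ^ (1 * a)
      eq : ∀ x → x * 4 + x + x ≡ 6 * x
      eq = solve-∀

    H≤ : H ≤ 2 ^ (9 * a)
    H≤ = begin
      N * 3 + 2 + growth + rounds   ≤⟨ +-mono-≤ (+-mono-≤ (+-mono-≤ (*-monoˡ-≤ 3 (≤-trans N≤ (pow-scale 7 (s≤s (s≤s (s≤s z≤n))))))
                                         (*-monoʳ-≤ 2 (m^n>0 2 (7 * a)))) (≤-trans growth≤ (pow-scale 7 (s≤s (s≤s (s≤s z≤n)))))) rounds≤ ⟩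
      x * 3 + 2 * x + x + x         ≡⟨ eq x ⟩
      7 * x                         ≤⟨ *-monoˡ-≤ x (n≤1+n 7) ⟩
      2 ^ 3 * x                     ≤⟨ pow-step 3 7 2 (n≤1+n 3) ⟩
      2 ^ (9 * a)                   ∎
      where
      open ≤-Reasoning
      x = 2 ^ (7 * a)
      eq : ∀ x → x * 3 + 2 * x + x + x ≡ 7 * x
      eq = solve-∀

    Z≤ : Z ≤ 2 ^ (10 * a + 3 * a * rounds)
    Z≤ = begin
      (growth + 2 * (k * (N * K)) + H) * growth ^ rounds
        ≤⟨ *-mono-≤ base (≤-trans (^-monoˡ-≤ rounds growth≤) (≤-reflexive (^-*-assoc 2 (3 * a) rounds))) ⟩
      2 ^ (10 * a) * 2 ^ (3 * a * rounds)
        ≡⟨ ^-distribˡ-+-* 2 (10 * a) (3 * a * rounds) ⟨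
      2 ^ (10 * a + 3 * a * rounds) ∎
      where
      open ≤-Reasoning
      x = 2 ^ (9 * a)
      eq : ∀ x → x + 2 * x + x ≡ 4 * x
      eq = solve-∀
      base : growth + 2 * (k * (N * K)) + H ≤ 2 ^ (10 * a)
      base = begin
        growth + 2 * (k * (N * K)) + H
          ≤⟨ +-mono-≤ (+-mono-≤ (≤-trans growth≤ (pow-scale 9 (s≤s (s≤s (s≤s z≤n)))))
               (*-monoʳ-≤ 2 (≤-trans (pow-* 1 4 (pow1 k≤2^a) (pow-* 3 1 N≤ (pow1 K≤))) (pow-scale 9 (s≤s (s≤s (s≤s (s≤s (s≤s z≤n))))))))) H≤ ⟩
        x + 2 * x + x   ≡⟨ eq x ⟩
        2 ^ 2 * x       ≤⟨ pow-step 2 9 1 ≤-refl ⟩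
        2 ^ (10 * a)    ∎

    1≤rounds : 1 ≤ rounds
    1≤rounds = ≤-trans (s≤s z≤n) 32≤rounds

    1≤a : 1 ≤ a
    1≤a = ≤-trans (s≤s z≤n) 2≤a

    size-H≤ : size H ≤ 10 * a
    size-H≤ = ≤-trans (size≤ {e = 9 * a} H≤) (≤-trans (+-monoˡ-≤ (9 * a) 1≤a) (≤-reflexive refl))

    size-Z≤ : size Z ≤ 14 * (a * rounds)
    size-Z≤ = begin
      size Z                                             ≤⟨ size≤ {e = 10 * a + 3 * a * rounds} Z≤ ⟩
      1 + (10 * a + 3 * a * rounds)                      ≤⟨ +-mono-≤ 1≤x (+-monoˡ-≤ (3 * a * rounds) (*-monoʳ-≤ 10 (m≤m*n a rounds {{>-nonZero 1≤rounds}}))) ⟩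
      a * rounds + (10 * (a * rounds) + 3 * a * rounds)  ≡⟨ eq a rounds ⟩
      14 * (a * rounds)                                  ∎
      where
      open ≤-Reasoning
      1≤x : 1 ≤ a * rounds
      1≤x = *-mono-≤ 1≤a 1≤rounds
      eq : ∀ a r → a * r + (10 * (a * r) + 3 * a * r) ≡ 14 * (a * r)
      eq = solve-∀

    rounds≤klQQ : rounds ≤ 32 * (k * l) * (Q * Q)
    rounds≤klQQ = ≤-trans (≤-reflexive (eq R Q l k)) (*-monoʳ-≤ (32 * (k * l)) (*-monoˡ-≤ Q (÷≤ Q K)))
      where
      eq : ∀ r q l k → r * q * l * k * 32 ≡ 32 * (k * l) * (r * q)
      eq = solve-∀

  work : ℕ
  work = n ^ k * (2 ^ f) ^ 4

  -- The two factors rounds, one from the number of rounds and one from the length of the weights, give 1/ε⁴.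
  rounds²N≤ : rounds * (rounds * N) ≤ 32 * 32 * 16 * (a * a) * work
  rounds²N≤ = begin
    rounds * (rounds * N)
      ≡⟨ cong (λ N → rounds * (rounds * N)) (^-distribʳ-* n 2 k) ⟩
    rounds * (rounds * (n ^ k * K))
      ≡⟨ eq₁ rounds (n ^ k) K ⟩
    n ^ k * (rounds * (rounds * K))
      -- The K in N = n^k K cancels the 2^-k of one `rounds`; the 2^-k of the other is given away.
      ≤⟨ *-monoʳ-≤ (n ^ k) (*-mono-≤ rounds≤klQQ (≤-reflexive roundsK≡)) ⟩
    n ^ k * (32 * (k * l) * (Q * Q) * (32 * (k * l) * (Q * Q)))
      ≤⟨ *-monoʳ-≤ (n ^ k) (*-mono-≤ (*-monoˡ-≤ (Q * Q) (*-monoʳ-≤ 32 kl≤a)) (*-monoˡ-≤ (Q * Q) (*-monoʳ-≤ 32 kl≤a))) ⟩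
    n ^ k * (32 * a * (Q * Q) * (32 * a * (Q * Q)))
      ≡⟨ eq₂ 32 (n ^ k) a (Q * Q) ⟩
    32 * 32 * (a * a) * (n ^ k * (Q * Q * (Q * Q)))
      ≡⟨ cong (λ q → 32 * 32 * (a * a) * (n ^ k * q)) (eq₃ (2 ^ f)) ⟩
    32 * 32 * (a * a) * (n ^ k * (16 * (2 ^ f) ^ 4))
      ≡⟨ eq₄ (32 * 32) (a * a) (n ^ k) 16 ((2 ^ f) ^ 4) ⟩
    32 * 32 * 16 * (a * a) * work ∎
    where
    open ≤-Reasoning
    eq₁ : ∀ r p x → r * (r * (p * x)) ≡ p * (r * (r * x))
    eq₁ = solve-∀
    eq₂ : ∀ c p a q → p * (c * a * q * (c * a * q)) ≡ c * c * (a * a) * (p * (q * q))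
    eq₂ = solve-∀
    eq₃ : ∀ y → (y + y) * (y + y) * ((y + y) * (y + y)) ≡ 16 * (y * (y * (y * (y * 1))))
    eq₃ = solve-∀
    eq₄ : ∀ c x p d y → c * x * (p * (d * y)) ≡ c * d * x * (p * y)
    eq₄ = solve-∀

  -- The exponent 6 consists of two from k², two from `size H` and `size Z`, and two from the
  -- factors k l of the two `rounds`.
  time-bound : ∀ c D {t} → c * (10 * 14 * (32 * 32 * 16)) ≡ D →
    t ≤ c * (rounds * (k * (k * N))) * (size H * size Z) → t ≤ D * (work * a ^ 6)
  time-bound c D {t} D≡ t≤ = begin
    t                                                                          ≤⟨ t≤ ⟩
    c * (rounds * (k * (k * N))) * (size H * size Z)                           ≤⟨ *-mono-≤ (*-monoʳ-≤ c (*-monoʳ-≤ rounds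
                                                                                   (*-mono-≤ k≤a (*-monoˡ-≤ N k≤a)))) (*-mono-≤ size-H≤ size-Z≤) ⟩
    c * (rounds * (a * (a * N))) * (10 * a * (14 * (a * rounds)))              ≡⟨ eq₁ c rounds a N 10 14 ⟩
    c * (10 * 14) * (a * a * (a * a)) * (rounds * (rounds * N))                ≤⟨ *-monoʳ-≤ (c * (10 * 14) * (a * a * (a * a))) rounds²N≤ ⟩
    c * (10 * 14) * (a * a * (a * a)) * (32 * 32 * 16 * (a * a) * work)        ≡⟨ eq₂ c (10 * 14) a (32 * 32 * 16) work ⟩
    c * (10 * 14 * (32 * 32 * 16)) * (work * a ^ 6)                            ≡⟨ cong (_* (work * a ^ 6)) D≡ ⟩
    D * (work * a ^ 6)                                                         ∎
    where
    open ≤-Reasoning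
    k≤a : k ≤ a
    k≤a = ≤-trans (m≤m*n k l {{>-nonZero 1≤l}}) kl≤a
    eq₁ : ∀ c r a n x y → c * (r * (a * (a * n))) * (x * a * (y * (a * r))) ≡ c * (x * y) * (a * a * (a * a)) * (r * (r * n))
    eq₁ = solve-∀
    eq₂ : ∀ c x a y w → c * x * (a * a * (a * a)) * (y * (a * a) * w) ≡ c * (x * y) * (w * (a * (a * (a * (a * (a * (a * 1)))))))
    eq₂ = solve-∀

  -- Makes `size t` at least a as soon as t exceeds `work`.
  2^kl+f≤work : 2 ^ (k * l + f) ≤ work
  2^kl+f≤work = begin
    2 ^ (k * l + f)      ≡⟨ ^-distribˡ-+-* 2 (k * l) f ⟩
    2 ^ (k * l) * 2 ^ f  ≡⟨ cong (λ e → 2 ^ e * 2 ^ f) (*-comm k l) ⟩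
    2 ^ (l * k) * 2 ^ f  ≡⟨ cong (_* 2 ^ f) (^-*-assoc 2 l k) ⟨
    (2 ^ l) ^ k * 2 ^ f  ≤⟨ *-mono-≤ (^-monoˡ-≤ k 2^l≤n) (≤-trans (≤-reflexive (sym (^-identityʳ (2 ^ f)))) (^-monoʳ-≤ (2 ^ f) {{m^n≢0 2 f}} {1} {4} (s≤s z≤n))) ⟩
    work                 ∎
    where open ≤-Reasoning

  -- If t is below work there is nothing to show; otherwise size t dominates a, and the polynomial factor in a is absorbed.
  time-in-size : ∀ D {t} → 1 ≤ D → t ≤ D * (work * a ^ 6) → t ≤ D * (work * size t ^ 6)
  time-in-size D {t} 1≤D t≤ with t ≤? work
  ... | yes t≤work = ≤-trans t≤work (≤-trans (m≤m*n work (size t ^ 6) {{m^n≢0 (size t) 6}}) (m≤n*m (work * size t ^ 6) D {{>-nonZero 1≤D}}))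
  ... | no  t≰work = ≤-trans t≤ (*-monoʳ-≤ D (*-monoʳ-≤ work (^-monoˡ-≤ 6 (subst (_≤ size t) (+-comm 1 (k * l + f))
    (size≥ {t} {k * l + f} (≤-trans 2^kl+f≤work (<⇒≤ (≰⇒> t≰work))))))))

  time-in-ε : ∀ D {t} → t ≤ D * (work * size t ^ 6) → t ≤ D * (n ^ k * size t ^ 6) / ε ↑ 4
  time-in-ε D {t} t≤ m = begin
    t * p ^ 4                                            ≤⟨ *-monoˡ-≤ (p ^ 4) t≤ ⟩
    D * (work * size t ^ 6) * p ^ 4                      ≡⟨ eq D (n ^ k) ((2 ^ f) ^ 4) (size t ^ 6) (p ^ 4) ⟩
    D * (n ^ k * size t ^ 6) * (p ^ 4 * (2 ^ f) ^ 4)     ≡⟨ cong (D * (n ^ k * size t ^ 6) *_) (^-distribʳ-* p (2 ^ f) 4) ⟨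
    D * (n ^ k * size t ^ 6) * (p * 2 ^ f) ^ 4           ≤⟨ *-monoʳ-≤ (D * (n ^ k * size t ^ 6)) (^-monoˡ-≤ 4 (Digits.prefix-upper ε f first m)) ⟩
    D * (n ^ k * size t ^ 6) * (2 ^ m) ^ 4               ∎
    where
    open ≤-Reasoning
    p = prefix ε m
    eq : ∀ d x y z w → d * (x * y * z) * w ≡ d * (x * z) * (w * y)
    eq = solve-∀

  Outcome : ℕ → Set
  Outcome D = ∃[ S ] ∃[ t ]
    (Constructs construction n k ε S t
    × AlmostIndependent k ε S
    × length S * 2 ^ k ≤ 128 * (k * ⌊log₂ n ⌋) / ε ↑ 2
    × t ≤ D * (n ^ k * size t ^ 6) / ε ↑ 4)

  -- The constants enter as variables tied by an equation, so the estimates treat them as opaque.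
  outcome-of-run : ∀ c D → 1 ≤ D → c * (10 * 14 * (32 * 32 * 16)) ≡ D →
    Tri (c * (rounds * (k * (k * N)))) construction (initial n k) Final →
    Outcome D
  outcome-of-run c D 1≤D D≡ (tri (s , t , run , t≤ , final)) =
    S , t , (s , run , trans output≡ (cong (concatMap Vec.toList) (sym toList-S))) , independent , length-bound ,
    time-in-ε D {t} (time-in-size D {t} 1≤D (time-bound c D {t} D≡ t≤))
    where open Result {s} final

  outcome : ∀ D → 1 ≤ D → 266 * (10 * 14 * (32 * 32 * 16)) ≡ D → Outcome D
  outcome D 1≤D D≡ = outcome-of-run 266 D 1≤D D≡
    (construction-spec first refl refl fixed 2^l≤n n< 1≤l (≤-trans 32≤rounds (≤-trans rounds≤H H≤Z)) k≤f rounds≤H growth≤Z sums≤Z)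

theorem5 : ∃[ p ] ∃[ C ] ∃[ D ] ∃[ e ]
    (∀ (n k : ℕ) (ε : Real01) → 2 ≤ n → 1 ≤ k → k ≤ n →
    0ℚ <ᴿ ε → ε ᴿ< 1 /2^ k →
    ∃[ S ] ∃[ t ]
    (Constructs p n k ε S t
    × AlmostIndependent k ε S
    × length S * 2 ^ k ≤ C * (k * ⌊log₂ n ⌋) / ε ↑ 2
    × t ≤ D * (n ^ k * size t ^ e) / ε ↑ 4))
-- In D, 266 is the instruction count per unit of `effort`, 10 and 14 come from `size H` and
-- `size Z`, 32 * 32 from the two `rounds`, and 16 from Q^4 = 16 · 2^(4f).
theorem5 = construction , 128 , 266 * (10 * 14 * (32 * 32 * 16)) , 6 , λ n k ε 2≤n 1≤k k≤n 0<ε ε<2^-k →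
  let f , first , k≤f = firstDigit ε k 0<ε ε<2^-k in
  Assembly.outcome ε n k f 2≤n 1≤k k≤f first (266 * (10 * 14 * (32 * 32 * 16))) (s≤s z≤n) refl
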